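{- Let $p$ be an odd prime, $m$ an even positive integer, $M=\mathbb F_{p^m}$, $Q=p^{m/2}$, $1\le k\le m-1$, $q=p^k$, $r=p^{k+m/2}$, $e=\gcd(k,m)$ with $m/e$ odd, $d=\gcd(k+m/2,m)$, $\mathbb E=\mathbb F_{p^e}$, $\mathbb D=\mathbb F_{p^d}$. Let $B\in M$ be a non-square and $A\in M$ with $AB\in\mathbb F_Q^\times$, and let $\mathcal C$ be the spread set described in the context. Suppose $X,Y$ are invertible $\mathbb F_p$-linear maps of $M\times M$ with $\{X\circ R\circ Y^{ -1}:R\in\mathcal C\}=\mathcal C$. Then $Y$ is semilinear over $\mathbb E$ and $X$ is semilinear over $\mathbb D$.
   Context: One has $e=2d$, $\mathbb E=\mathbb F_q\cap M$ and $\mathbb D=\mathbb F_r\cap M\subseteq \mathbb E$. $\mathcal C=\{R_{u,v}:u,v\in M\}$ where $R_{u,v}(x,y)=(x^qu+xu^q+B(y^qv+yv^q),\ x^rv+Axv^r+Ay^ru+yu^r)$ for $x,y\in M$. A map $Z$ of $M\times M$ is semilinear over a subfield $K\subseteq M$ if it is additive and there is a field automorphism $\sigma$ of $K$ with $Z(\lambda x,\lambda y)=\sigma(\lambda)Z(x,y)$ for all $\lambda\in K$, $x,y\in M$. -}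

module Defs where

open import Level using (_⊔_)
open import Algebra.Bundles using (CommutativeRing)
open import Data.Nat as ℕ using (ℕ; zero; suc)
open import Data.Fin using (Fin)
open import Data.Product using (_×_; _,_; proj₁; proj₂; Σ; ∃)
open import Relation.Nullary using (¬_)
open import Relation.Binary.PropositionalEquality as ≡ using (_≡_)
open import Function.Bundles using (Inverse)

module _ {c ℓ} (R : CommutativeRing c ℓ) where
  open CommutativeRing R

  pow : Carrier → ℕ → Carrier
  pow x zero = 1#
  pow x (suc n) = x * pow x n

  -- n · x  (integer multiple; n · 1 ranges over the prime field)
  times : ℕ → Carrier → Carrier
  times zero x = 0#
  times (suc n) x = x + times n x

  IsField : Set (c ⊔ ℓ)
  IsField = (¬ (1# ≈ 0#)) × (∀ x → ¬ (x ≈ 0#) → ∃ λ y → x * y ≈ 1#)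

  IsFiniteFieldOfOrder : ℕ → Set (c ⊔ ℓ)
  IsFiniteFieldOfOrder N = IsField × Inverse setoid (≡.setoid (Fin N))

  IsSquare : Carrier → Set (c ⊔ ℓ)
  IsSquare b = ∃ λ y → y * y ≈ b

  -- the subfield 𝔽_{p^t} ∩ M = { x | x^{p^t} = x } (for t ∣ m)
  InSubfield : ℕ → Carrier → Set ℓ
  InSubfield pt x = pow x pt ≈ x

  Pair : Set c
  Pair = Carrier × Carrier

  _≈²_ : Pair → Pair → Set ℓ
  (a , b) ≈² (a' , b') = (a ≈ a') × (b ≈ b')

  Rmap : (A B : Carrier) (q r : ℕ) (u v : Carrier) → Pair → Pair
  Rmap A B q r u v (x , y) =
    ( pow x q * u + x * pow u q + B * (pow y q * v + y * pow v q)
    , pow x r * v + A * x * pow v r + A * pow y r * u + y * pow u r )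

  Congruent : (Pair → Pair) → Set (c ⊔ ℓ)
  Congruent Z = ∀ z w → z ≈² w → Z z ≈² Z w

  Additive : (Pair → Pair) → Set (c ⊔ ℓ)
  Additive Z = ∀ x y x' y' → Z (x + x' , y + y') ≈² (proj₁ (Z (x , y)) + proj₁ (Z (x' , y')) , proj₂ (Z (x , y)) + proj₂ (Z (x' , y')))

  -- 𝔽_p-linear map of M × M (𝔽_p = { n · 1 })
  FpLinear : (Pair → Pair) → Set (c ⊔ ℓ)
  FpLinear Z = Congruent Z × Additive Z ×
    (∀ n x y → Z (times n 1# * x , times n 1# * y) ≈² (times n 1# * proj₁ (Z (x , y)) , times n 1# * proj₂ (Z (x , y))))

  IsInverseOf : (Pair → Pair) → (Pair → Pair) → Set (c ⊔ ℓ)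
  IsInverseOf Z' Z = Congruent Z' × (∀ z → Z (Z' z) ≈² z) × (∀ z → Z' (Z z) ≈² z)

  IsAutomorphismOf : (K : Carrier → Set ℓ) → (Carrier → Carrier) → Set (c ⊔ ℓ)
  IsAutomorphismOf K σ =
    (∀ x y → K x → K y → x ≈ y → σ x ≈ σ y) ×
    (∀ x → K x → K (σ x)) ×
    (∀ x y → K x → K y → σ (x + y) ≈ σ x + σ y) ×
    (∀ x y → K x → K y → σ (x * y) ≈ σ x * σ y) ×
    (σ 1# ≈ 1#) ×
    (∀ x y → K x → K y → σ x ≈ σ y → x ≈ y) ×
    (∀ y → K y → ∃ λ x → K x × (σ x ≈ y))

  SemilinearOver : (K : Carrier → Set ℓ) → (Pair → Pair) → Set (c ⊔ ℓ)
  SemilinearOver K Z = Additive Z × ∃ λ σ → IsAutomorphismOf K σ ×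
    (∀ λ' x y → K λ' → Z (λ' * x , λ' * y) ≈² (σ λ' * proj₁ (Z (x , y)) , σ λ' * proj₂ (Z (x , y))))

module Submission where

-- Write F, G, H for the power maps x ↦ x^q, x^Q, x^r, so that H = G ∘ F, and read R_{u,v}(x,y) as a
-- commutative product (x,y) ⋆ (u,v) on V = M × M.
--
-- Self-adjoint operators.  If W z ⋆ w = z ⋆ W′ w for all z, w, then W = diag(s, H s) with F s = s; comparing
-- the four blocks of W gives functional equations in two variables that force each block to be a scalar.
-- An autotopism conjugates self-adjoint operators to self-adjoint ones, hence Y diag(s, H s) Y⁻¹ = diag(ρ, H ρ).
--
-- Derivations.  A scalar s of M is a derivation of ⋆ : (s z) ⋆ w + z ⋆ (s w) = diag(F s + s, H s + s)(z ⋆ w).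
-- Choose ι ∈ 𝔼 with G ι = - ι.  Up to a self-adjoint operator, D = Y ι Y⁻¹ is again a derivation, and it
-- commutes with Y diag(ι, - ι) Y⁻¹ = diag(κ, - κ).  Such derivations are diagonal: each block reduces to an
-- additive map a of M with (a x ⊛ u) + (x ⊛ a u) = Z (x ⊛ u), where x ⊛ u = x^q u + x u^q, and these are scalars;
-- the off-diagonal blocks would give F B = H A · A · B, contradicting that A is a non-square.
--
-- From D² = κ² one gets D = ± κ, and since 𝔼 is spanned by 1 and ι over its G-fixed elements, Y is
-- 𝔼-semilinear.  On 𝔻 the scalars pass through ⋆, so X inherits the automorphism of Y.

open import Algebra.Bundles using (CommutativeRing)
open import Algebra.Solver.Ring.AlmostCommutativeRing using (fromCommutativeRing; _-Raw-AlmostCommutative⟶_)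
open import Level using (_⊔_)
open import Data.Product using (_×_; _,_; proj₁; proj₂; ∃)
open import Data.Sum using (_⊎_; inj₁; inj₂)
open import Data.Fin.Base using (Fin)
open import Data.Fin.Permutation using (Permutation; permutation)
open import Data.Maybe.Base using (Maybe; just; nothing)
open import Data.Nat.Base using (ℕ; _!)
open import Data.Nat.Combinatorics using (_C_; nCk≡n!/k![n-k]!; k![n∸k]!∣n!; nCk≡nC[n∸k]; nCn≡1)
open import Data.Nat.Divisibility using (_∣_; divides; ∣1⇒≡1; ∣⇒≤; m∣m*n)
open import Data.Nat.DivMod using (m/n*n≡m)
open import Data.Nat.GCD using (gcd; gcd-GCD; gcd[m,n]∣m; module Bézout)
open import Data.Nat.Induction using (<-rec)
open import Data.Nat.Primality using (Prime; euclidsLemma; ¬prime[0]; ¬prime[1]; prime[2]; prime⇒irreducible; prime⇒nonTrivial)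
open import Data.Nat.Solver using (module +-*-Solver)
open import Data.Vec.Base as Vec using (Vec; []; _∷_)
open import Data.Vec.Functional using (replicate)
open import Function.Bundles using (Inverse)
open import Function.Definitions using (Injective)
open import Relation.Binary.Definitions using (Decidable)
open import Relation.Nullary using (¬_; Dec; yes; no; contradiction)
import Data.Fin.Base as Fin
import Data.Fin.Properties as Fin
import Data.Nat.Base as ℕ
import Data.Nat.Properties as ℕ
import Relation.Binary.PropositionalEquality as ≡
open import Defs

-- Self-adjoint operators alone do not suffice. A scalar of 𝔼 is one of them only when H fixes it,
-- that is, on 𝔻, and ι lies outside 𝔻. They determine Y diag(ι, - ι) Y⁻¹ but not Y ι Y⁻¹; the
-- relative sign of the two coordinates is what the derivations supply. Conjugating the scalar ι
-- yields D on the left factor and some D′ on the right one. As ⋆ is commutative, the same rule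
-- holds with D and D′ exchanged, so D - D′ is self-adjoint and D + D′ acts alike on both factors:
-- this is the correction by a self-adjoint operator. The oddness of m/e enters twice. F has odd
-- order, so an element fixed by F⁴ is fixed by F, which keeps the conjugates of a moved g apart;
-- and m/2 is an odd multiple of e/2, which produces ι. F may still have order three, so every
-- elimination must avoid dividing by F³ g - g.

module IntegerSolver {c ℓ} (R : CommutativeRing c ℓ) where

  open import Data.Nat.Base using (zero; suc)
  open import Data.Integer.Base as ℤ using (ℤ; +_; -[1+_]; _⊖_)
  import Data.Integer.Properties as ℤ
  open CommutativeRing R
  open import Algebra.Properties.Ring ring
  open import Algebra.Properties.Semiring.Mult.TCOptimised semiring
    using (1+×; ×-homo-+; ×1-homo-*) renaming (_×_ to infixl 8 _·_)
  open import Relation.Binary.Reasoning.Setoid setoid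

  -- Coefficients live in ℤ, where equality is decidable and arithmetic computes, so that identities
  -- with signs and cancelling constants can be checked over any commutative ring.
  fromℤ : ℤ → Carrier
  fromℤ (+ n) = n · 1#
  fromℤ -[1+ n ] = - (suc n · 1#)

  fromℤ-⊖ : ∀ m n → fromℤ (m ⊖ n) ≈ m · 1# - n · 1#
  fromℤ-⊖ m zero = sym (trans (+-congˡ -0#≈0#) (+-identityʳ _))
  fromℤ-⊖ zero (suc n) = sym (+-identityˡ _)
  fromℤ-⊖ (suc m) (suc n) = begin
    fromℤ (suc m ⊖ suc n)                     ≡⟨ ≡.cong fromℤ (ℤ.[1+m]⊖[1+n]≡m⊖n m n) ⟩
    fromℤ (m ⊖ n)                             ≈⟨ fromℤ-⊖ m n ⟩
    m · 1# - n · 1#                           ≈⟨ +-congˡ (trans (sym (+-identityˡ _)) (+-congʳ (sym (-‿inverseʳ 1#)))) ⟩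
    m · 1# + (1# - 1# - n · 1#)               ≈⟨ +-congˡ (+-assoc 1# _ _) ⟩
    m · 1# + (1# + (- 1# - n · 1#))           ≈⟨ +-assoc _ _ _ ⟨
    m · 1# + 1# + (- 1# - n · 1#)             ≈⟨ +-cong (trans (+-comm _ 1#) (sym (1+× m 1#))) (trans (-‿+-comm 1# _) (-‿cong (sym (1+× n 1#)))) ⟩
    suc m · 1# - suc n · 1#                   ∎

  fromℤ-+ : ∀ i j → fromℤ (i ℤ.+ j) ≈ fromℤ i + fromℤ j
  fromℤ-+ (+ m) (+ n) = ×-homo-+ 1# m n
  fromℤ-+ (+ m) -[1+ n ] = fromℤ-⊖ m (suc n)
  fromℤ-+ -[1+ m ] (+ n) = trans (fromℤ-⊖ n (suc m)) (+-comm _ _)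
  fromℤ-+ -[1+ m ] -[1+ n ] = begin
    fromℤ (-[1+ m ] ℤ.+ -[1+ n ])        ≡⟨ ≡.cong fromℤ (ℤ.neg-distrib-+ (+ suc m) (+ suc n)) ⟨
    - ((suc m ℕ.+ suc n) · 1#)           ≈⟨ -‿cong (×-homo-+ 1# (suc m) (suc n)) ⟩
    - (suc m · 1# + suc n · 1#)          ≈⟨ -‿+-comm _ _ ⟨
    - (suc m · 1#) - suc n · 1#          ∎

  fromℤ-neg : ∀ i → fromℤ (ℤ.- i) ≈ - fromℤ i
  fromℤ-neg (+ zero) = sym -0#≈0#
  fromℤ-neg (+ suc n) = refl
  fromℤ-neg -[1+ n ] = sym (-‿involutive _)

  fromℤ-*⁺ : ∀ m j → fromℤ (+ m ℤ.* j) ≈ m · 1# * fromℤ j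
  fromℤ-*⁺ m (+ n) = trans (reflexive (≡.cong fromℤ (≡.sym (ℤ.pos-* m n)))) (×1-homo-* m n)
  fromℤ-*⁺ m -[1+ n ] = begin
    fromℤ (+ m ℤ.* -[1+ n ])             ≡⟨ ≡.cong fromℤ (ℤ.neg-distribʳ-* (+ m) (+ suc n)) ⟨
    fromℤ (ℤ.- (+ m ℤ.* + suc n))        ≈⟨ fromℤ-neg (+ m ℤ.* + suc n) ⟩
    - fromℤ (+ m ℤ.* + suc n)            ≈⟨ -‿cong (fromℤ-*⁺ m (+ suc n)) ⟩
    - (m · 1# * (suc n · 1#))            ≈⟨ -‿distribʳ-* _ _ ⟩
    m · 1# * - (suc n · 1#)              ∎

  fromℤ-* : ∀ i j → fromℤ (i ℤ.* j) ≈ fromℤ i * fromℤ j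
  fromℤ-* (+ m) j = fromℤ-*⁺ m j
  fromℤ-* -[1+ m ] j = begin
    fromℤ (-[1+ m ] ℤ.* j)       ≡⟨ ≡.cong fromℤ (ℤ.neg-distribˡ-* (+ suc m) j) ⟨
    fromℤ (ℤ.- (+ suc m ℤ.* j))  ≈⟨ fromℤ-neg (+ suc m ℤ.* j) ⟩
    - fromℤ (+ suc m ℤ.* j)      ≈⟨ -‿cong (fromℤ-*⁺ (suc m) j) ⟩
    - (suc m · 1# * fromℤ j)     ≈⟨ -‿distribˡ-* _ _ ⟩
    - (suc m · 1#) * fromℤ j     ∎

  ℤ-morphism : ℤ.+-*-rawRing -Raw-AlmostCommutative⟶ fromCommutativeRing R
  ℤ-morphism = record
    { ⟦_⟧ = fromℤ
    ; +-homo = fromℤ-+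
    ; *-homo = fromℤ-*
    ; -‿homo = fromℤ-neg
    ; 0-homo = refl
    ; 1-homo = refl
    }

  fromℤ≟ : ∀ i j → Maybe (fromℤ i ≈ fromℤ j)
  fromℤ≟ i j with i ℤ.≟ j
  ... | yes i≡j = just (reflexive (≡.cong fromℤ i≡j))
  ... | no _ = nothing

  open import Algebra.Solver.Ring ℤ.+-*-rawRing (fromCommutativeRing R) ℤ-morphism fromℤ≟ public
    using (solve; _:=_; _:+_; _:*_; _:-_; :-_; con; Polynomial)

  :0 :1 :2 : ∀ {n} → Polynomial n
  :0 = con (+ 0)
  :1 = con (+ 1)
  :2 = con (+ 2)

-- Combining equations; additive maps, ring endomorphisms and fields

module RingTools {c ℓ} (R : CommutativeRing c ℓ) where

  open CommutativeRing R
  open import Algebra.Properties.Ring ring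
  open IntegerSolver R public

  ≈⇒-≈0 : ∀ {x y} → x ≈ y → x - y ≈ 0#
  ≈⇒-≈0 {x} {y} e = trans (+-congʳ e) (-‿inverseʳ y)

  -≈0⇒≈ : ∀ {x y} → x - y ≈ 0# → x ≈ y
  -≈0⇒≈ {x} {y} = x∙y⁻¹≈ε⇒x≈y x y

  -- Equations are derived by certificates: x - y is an explicit combination of the differences l -
  -- r of known equations. The cofactors k are read off from the polynomial identity handed to the
  -- solver.
  comb₁ : ∀ {x y l r k} → l ≈ r → x - y ≈ k * (l - r) → x ≈ y
  comb₁ e eq = -≈0⇒≈ (trans eq (trans (*-congˡ (≈⇒-≈0 e)) (zeroʳ _)))

  comb₂ : ∀ {x y l r k l′ r′ k′} → l ≈ r → l′ ≈ r′ →
          x - y ≈ k * (l - r) + k′ * (l′ - r′) → x ≈ y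
  comb₂ e e′ eq = comb₁ e (trans eq (trans (+-congˡ (trans (*-congˡ (≈⇒-≈0 e′)) (zeroʳ _))) (+-identityʳ _)))

  comb₃ : ∀ {x y l r k l′ r′ k′ l″ r″ k″} → l ≈ r → l′ ≈ r′ → l″ ≈ r″ →
          x - y ≈ k * (l - r) + k′ * (l′ - r′) + k″ * (l″ - r″) → x ≈ y
  comb₃ e e′ e″ eq = comb₂ e e′ (trans eq (trans (+-congˡ (trans (*-congˡ (≈⇒-≈0 e″)) (zeroʳ _))) (+-identityʳ _)))

  comb₄ : ∀ {x y l r k l′ r′ k′ l″ r″ k″ l‴ r‴ k‴} → l ≈ r → l′ ≈ r′ → l″ ≈ r″ → l‴ ≈ r‴ →
          x - y ≈ k * (l - r) + k′ * (l′ - r′) + k″ * (l″ - r″) + k‴ * (l‴ - r‴) → x ≈ y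
  comb₄ e e′ e″ e‴ eq = comb₃ e e′ e″ (trans eq (trans (+-congˡ (trans (*-congˡ (≈⇒-≈0 e‴)) (zeroʳ _))) (+-identityʳ _)))

  record IsAdd (f : Carrier → Carrier) : Set (c ⊔ ℓ) where
    field
      cong : ∀ {x y} → x ≈ y → f x ≈ f y
      +-homo : ∀ x y → f (x + y) ≈ f x + f y
    0-homo : f 0# ≈ 0#
    0-homo = +-identityˡ-unique (f 0#) (f 0#) (trans (sym (+-homo 0# 0#)) (cong (+-identityˡ 0#)))
    neg-homo : ∀ x → f (- x) ≈ - f x
    neg-homo x = +-inverseˡ-unique (f (- x)) (f x)
      (trans (sym (+-homo (- x) x)) (trans (cong (-‿inverseˡ x)) 0-homo))
    sub-homo : ∀ x y → f (x - y) ≈ f x - f y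
    sub-homo x y = trans (+-homo x (- y)) (+-congˡ (neg-homo y))

  ∘-isAdd : ∀ {f h} → IsAdd f → IsAdd h → IsAdd (λ x → f (h x))
  ∘-isAdd p q = record
    { cong = λ e → p.cong (q.cong e)
    ; +-homo = λ x y → trans (p.cong (q.+-homo x y)) (p.+-homo _ _) }
    where
    module p = IsAdd p
    module q = IsAdd q

  +-isAdd : ∀ {f h} → IsAdd f → IsAdd h → IsAdd (λ x → f x + h x)
  +-isAdd {f} {h} p q = record
    { cong = λ e → +-cong (p.cong e) (q.cong e)
    ; +-homo = λ x y → trans (+-cong (p.+-homo x y) (q.+-homo x y))
        (solve 4 (λ a b c d → a :+ b :+ (c :+ d) := a :+ c :+ (b :+ d)) refl (f x) (f y) (h x) (h y)) }
    where
    module p = IsAdd p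
    module q = IsAdd q

  scale-isAdd : ∀ s → IsAdd (s *_)
  scale-isAdd s = record { cong = *-congˡ ; +-homo = distribˡ s }

  *-isAdd : ∀ s {f} → IsAdd f → IsAdd (λ x → s * f x)
  *-isAdd s p = ∘-isAdd (scale-isAdd s) p

  neg-isAdd : ∀ {f} → IsAdd f → IsAdd (λ x → - f x)
  neg-isAdd {f} p = record
    { cong = λ e → -‿cong (p.cong e)
    ; +-homo = λ x y → trans (-‿cong (p.+-homo x y)) (sym (-‿+-comm _ _)) }
    where module p = IsAdd p

  record IsEndo (φ : Carrier → Carrier) : Set (c ⊔ ℓ) where
    field
      isAdd : IsAdd φ
      *-homo : ∀ x y → φ (x * y) ≈ φ x * φ y
      1-homo : φ 1# ≈ 1#
    open IsAdd isAdd public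

  ∘-isEndo : ∀ {φ ψ} → IsEndo φ → IsEndo ψ → IsEndo (λ x → φ (ψ x))
  ∘-isEndo p q = record
    { isAdd = ∘-isAdd p.isAdd q.isAdd
    ; *-homo = λ x y → trans (p.cong (q.*-homo x y)) (p.*-homo _ _)
    ; 1-homo = trans (p.cong q.1-homo) p.1-homo }
    where
    module p = IsEndo p
    module q = IsEndo q

  module Field (isField : IsField R) (_≟_ : Decidable _≈_) where

    1≉0 : ¬ (1# ≈ 0#)
    1≉0 = proj₁ isField

    inv : ∀ x → ¬ (x ≈ 0#) → Carrier
    inv x x≉0 = proj₁ (proj₂ isField x x≉0)

    inv-r : ∀ x (x≉0 : ¬ (x ≈ 0#)) → x * inv x x≉0 ≈ 1#
    inv-r x x≉0 = proj₂ (proj₂ isField x x≉0)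

    cancel0 : ∀ {x y} → ¬ (x ≈ 0#) → x * y ≈ 0# → y ≈ 0#
    cancel0 {x} {y} x≉0 xy≈0 = comb₂ xy≈0 (inv-r x x≉0)
      (solve 3 (λ x y z → y :- :0 := z :* (x :* y :- :0) :+ (:- y) :* (x :* z :- :1)) refl x y (inv x x≉0))

    cancel : ∀ {x y z} → ¬ (x ≈ 0#) → x * y ≈ x * z → y ≈ z
    cancel {x} {y} {z} x≉0 e = -≈0⇒≈ (cancel0 x≉0 (trans (trans (distribˡ x y (- z)) (+-congˡ (sym (-‿distribʳ-* x z)))) (≈⇒-≈0 e)))

    *-≉0 : ∀ {x y} → ¬ (x ≈ 0#) → ¬ (y ≈ 0#) → ¬ (x * y ≈ 0#)
    *-≉0 x≉0 y≉0 e = y≉0 (cancel0 x≉0 e)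

    *≈0 : ∀ {x y} → x * y ≈ 0# → x ≈ 0# ⊎ y ≈ 0#
    *≈0 {x} e with x ≟ 0#
    ... | yes x≈0 = inj₁ x≈0
    ... | no x≉0 = inj₂ (cancel0 x≉0 e)

    sign : ∀ {a b} → a * a ≈ b * b → a ≈ b ⊎ a ≈ - b
    sign {a} {b} e with *≈0 {a - b} {a + b} (comb₁ e (solve 2 (λ a b → (a :- b) :* (a :+ b) :- :0 := :1 :* (a :* a :- b :* b)) refl a b))
    ... | inj₁ p = inj₁ (-≈0⇒≈ p)
    ... | inj₂ p = inj₂ (comb₁ p (solve 2 (λ a b → a :- (:- b) := :1 :* (a :+ b :- :0)) refl a b))

    endo-≈0 : ∀ {φ} → IsEndo φ → ∀ {x} → φ x ≈ 0# → x ≈ 0#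
    endo-≈0 {φ} h {x} e with x ≟ 0#
    ... | yes x≈0 = x≈0
    ... | no x≉0 = contradiction
      (trans (sym h.1-homo) (trans (h.cong (sym (inv-r x x≉0))) (trans (h.*-homo _ _) (trans (*-congʳ e) (zeroˡ _))))) 1≉0
      where module h = IsEndo h

    endo-injective : ∀ {φ} → IsEndo φ → ∀ {x y} → φ x ≈ φ y → x ≈ y
    endo-injective h {x} {y} e = -≈0⇒≈ (endo-≈0 h (trans (IsEndo.sub-homo h x y) (≈⇒-≈0 e)))

    endo-≉0 : ∀ {φ} → IsEndo φ → ∀ {x} → ¬ (x ≈ 0#) → ¬ (φ x ≈ 0#)
    endo-≉0 h x≉0 e = x≉0 (endo-≈0 h e)

    -≉0 : ∀ {x y} → ¬ (x ≈ y) → ¬ (x - y ≈ 0#)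
    -≉0 n e = n (-≈0⇒≈ e)

-- The functional equation behind the blocks of a self-adjoint operator

module SelfAdjointMaps {c ℓ} (R : CommutativeRing c ℓ) (isField : IsField R) (_≟_ : Decidable (CommutativeRing._≈_ R)) where

  open CommutativeRing R
  open RingTools R
  open Field isField _≟_

  -- One equation serves all four blocks: (φ, a, b) is (F, 1, 1) for the two diagonal blocks, and
  -- (H, A, 1) or (H, 1, A) for the other two. Injectivity of z ↦ a φ z + b z forces f and g to
  -- agree.
  module SelfAdjoint (φ : Carrier → Carrier) (φ-endo : IsEndo φ) (a b : Carrier)
    (a≉0 : ¬ (a ≈ 0#)) (b≉0 : ¬ (b ≈ 0#))
    (ψ-inj : ∀ z → a * φ z + b * z ≈ 0# → z ≈ 0#)
    (x₀ : Carrier) (x₀-moved : ¬ (φ (φ x₀) ≈ x₀))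
    (f g : Carrier → Carrier)
    (adj : ∀ x u → a * φ (f x) * u + b * f x * φ u ≈ b * φ x * g u + a * x * φ (g u))
    where
    private
      module φ = IsEndo φ-endo
      γ = f 1#

      ψ-injective : ∀ {z w} → a * φ z + b * z ≈ a * φ w + b * w → z ≈ w
      ψ-injective {z} {w} e = -≈0⇒≈ (ψ-inj (z - w) (comb₂ (φ.sub-homo z w) e
        (solve 7 (λ a b z w φz φw φd →
          a :* φd :+ b :* (z :- w) :- :0 :=
          a :* (φd :- (φz :- φw)) :+ :1 :* (a :* φz :+ b :* z :- (a :* φw :+ b :* w)))
          refl a b z w (φ z) (φ w) (φ (z - w)))))

      f1≈g1 : γ ≈ g 1#
      f1≈g1 = ψ-injective (comb₂ (adj 1# 1#) φ.1-homo
        (solve 7 (λ a b s t φs φt o →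
          a :* φs :+ b :* s :- (a :* φt :+ b :* t) :=
          :1 :* (a :* φs :* :1 :+ b :* s :* o :- (b :* o :* t :+ a :* :1 :* φt)) :+ (b :* (t :- s)) :* (o :- :1))
          refl a b γ (g 1#) (φ γ) (φ (g 1#)) (φ 1#)))

      -- The case u = 1, which allows φ (f x) to be eliminated in favour of f x.
      ψf : ∀ x → a * φ (f x) + b * f x ≈ b * φ x * γ + a * x * φ γ
      ψf x = comb₄ (adj x 1#) φ.1-homo f1≈g1 (φ.cong f1≈g1)
        (solve 11 (λ a b x φx y φy s φs t φt o →
          a :* φy :+ b :* y :- (b :* φx :* s :+ a :* x :* φs) :=
          :1 :* (a :* φy :* :1 :+ b :* y :* o :- (b :* φx :* t :+ a :* x :* φt)) :+ (:- (b :* y)) :* (o :- :1)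
          :+ (:- (b :* φx)) :* (s :- t) :+ (:- (a :* x)) :* (φs :- φt))
          refl a b x (φ x) (f x) (φ (f x)) γ (φ γ) (g 1#) (φ (g 1#)) (φ 1#))

      g≈f : ∀ u → g u ≈ f u
      g≈f u = ψ-injective (trans (comb₂ (adj 1# u) φ.1-homo
        (solve 9 (λ a b u φu y φy s φs o →
          a :* φy :+ b :* y :- (b :* φu :* s :+ a :* u :* φs) :=
          (:- :1) :* (a :* φs :* u :+ b :* s :* φu :- (b :* o :* y :+ a :* :1 :* φy)) :+ (:- (b :* y)) :* (o :- :1))
          refl a b u (φ u) (g u) (φ (g u)) γ (φ γ) (φ 1#))) (sym (ψf u)))

      δ : Carrier → Carrier
      δ x = φ x - x

      -- Eliminating φ (f x) and φ (f u) from `adj` by `ψf` leaves this symmetric relation. Fixing u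
      -- = x₀ then determines f up to the two constants γ and κ.
      proportional : ∀ x u → (f x - γ * x) * δ u ≈ (f u - γ * u) * δ x
      proportional x u = cancel b≉0 (comb₃ (trans (adj x u) (+-cong (*-congˡ (g≈f u)) (*-congˡ (φ.cong (g≈f u))))) (ψf x) (ψf u)
        (solve 12 (λ a b s φs x φx u φu y φy z φz →
          b :* ((y :- s :* x) :* (φu :- u)) :- b :* ((z :- s :* u) :* (φx :- x)) :=
          :1 :* (a :* φy :* u :+ b :* y :* φu :- (b :* φx :* z :+ a :* x :* φz))
          :+ (:- u) :* (a :* φy :+ b :* y :- (b :* φx :* s :+ a :* x :* φs))
          :+ x :* (a :* φz :+ b :* z :- (b :* φu :* s :+ a :* u :* φs)))
          refl a b γ (φ γ) x (φ x) u (φ u) (f x) (φ (f x)) (f u) (φ (f u))))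

      δx₀≉0 : ¬ (δ x₀ ≈ 0#)
      δx₀≉0 e = x₀-moved (trans (φ.cong (-≈0⇒≈ e)) (-≈0⇒≈ e))

      κ : Carrier
      κ = (f x₀ - γ * x₀) * inv (δ x₀) δx₀≉0

      f-form : ∀ x → f x ≈ γ * x + κ * δ x
      f-form x = cancel δx₀≉0 (comb₂ (proportional x x₀) (inv-r (δ x₀) δx₀≉0)
        (solve 8 (λ s x x0 y z d d0 i →
          d0 :* y :- d0 :* (s :* x :+ (z :- s :* x0) :* i :* d) :=
          :1 :* ((y :- s :* x) :* d0 :- (z :- s :* x0) :* d) :+ (:- ((z :- s :* x0) :* d)) :* (d0 :* i :- :1))
          refl γ x x₀ (f x) (f x₀) (δ x) (δ x₀) (inv (δ x₀) δx₀≉0)))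

      -- a φ (f x) + b f x, computed once from ψf and once from f-form
      constraint : ∀ x → a * φ κ * φ (δ x) ≈ (b * γ - a * φ γ - b * κ) * δ x
      constraint x = comb₃ (ψf x) (f-form x)
        (trans (φ.cong (f-form x)) (trans (φ.+-homo _ _) (+-cong (φ.*-homo γ x) (φ.*-homo κ (δ x)))))
        (solve 11 (λ a b s φs k φk x φx φd y φy →
          a :* φk :* φd :- (b :* s :- a :* φs :- b :* k) :* (φx :- x) :=
          :1 :* (a :* φy :+ b :* y :- (b :* φx :* s :+ a :* x :* φs))
          :+ (:- b) :* (y :- (s :* x :+ k :* (φx :- x)))
          :+ (:- a) :* (φy :- (φs :* φx :+ φk :* φd)))
          refl a b γ (φ γ) κ (φ κ) x (φ x) (φ (δ x)) (f x) (φ (f x)))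

      δ-square : ∀ x → δ (x * x) ≈ δ x * (φ x + x)
      δ-square x = comb₁ (φ.*-homo x x)
        (solve 3 (λ x φx q → q :- x :* x :- (φx :- x) :* (φx :+ x) := :1 :* (q :- φx :* φx)) refl x (φ x) (φ (x * x)))

      -- Comparing `constraint` at x₀ and at x₀², where δ (x²) = δ x (φ x + x), leaves a φ κ φ (δ
      -- x₀) (φ² x₀ - x₀) = 0. This is why x₀ has to be moved by φ² and not only by φ.
      φκ≈0 : φ κ ≈ 0#
      φκ≈0 = cancel0 (*-≉0 (*-≉0 a≉0 (endo-≉0 φ-endo δx₀≉0)) (-≉0 x₀-moved)) (comb₄
        (constraint (x₀ * x₀)) (constraint x₀) (δ-square x₀)
        (trans (φ.cong (δ-square x₀)) (trans (φ.*-homo _ _) (*-congˡ (φ.+-homo _ _))))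
        (solve 10 (λ a φk m x x1 x2 d φd ds φds →
          a :* φd :* (x2 :- x) :* φk :- :0 :=
          :1 :* (a :* φk :* φds :- m :* ds) :+ (:- (x1 :+ x)) :* (a :* φk :* φd :- m :* d)
          :+ m :* (ds :- d :* (x1 :+ x)) :+ (:- (a :* φk)) :* (φds :- φd :* (x2 :+ x1)))
          refl a (φ κ) (b * γ - a * φ γ - b * κ) x₀ (φ x₀) (φ (φ x₀)) (δ x₀) (φ (δ x₀)) (δ (x₀ * x₀)) (φ (δ (x₀ * x₀)))))

      κ≈0 : κ ≈ 0#
      κ≈0 = endo-≈0 φ-endo φκ≈0

    scalar : ∀ x → f x ≈ f 1# * x
    scalar x = trans (f-form x) (trans (+-congˡ (trans (*-congʳ κ≈0) (zeroˡ _))) (+-identityʳ _))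

    scalar′ : ∀ x → g x ≈ f 1# * x
    scalar′ x = trans (g≈f x) (scalar x)

    eigenvalue : a * φ (f 1#) ≈ b * f 1#
    eigenvalue = sym (cancel δx₀≉0 (comb₃ (constraint x₀) φκ≈0 κ≈0
      (solve 8 (λ a b s φs k φk d φd →
        d :* (b :* s) :- d :* (a :* φs) :=
        (:- :1) :* (a :* φk :* φd :- (b :* s :- a :* φs :- b :* k) :* d) :+ (a :* φd) :* (φk :- :0) :+ (b :* d) :* (k :- :0))
        refl a b γ (φ γ) κ (φ κ) (δ x₀) (φ (δ x₀)))))

-- Derivations of `⊛` on the field are scalars

module Derivations {c ℓ} (R : CommutativeRing c ℓ) (isField : IsField R) (_≟_ : Decidable (CommutativeRing._≈_ R))
  (F : CommutativeRing.Carrier R → CommutativeRing.Carrier R) (F-endo : RingTools.IsEndo R F)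
  (F⁴-fixed : ∀ x → CommutativeRing._≈_ R (F (F (F (F x)))) x → CommutativeRing._≈_ R (F x) x)
  (g : CommutativeRing.Carrier R) (g-moved : ¬ CommutativeRing._≈_ R (F g) g)
  where

  open CommutativeRing R
  open RingTools R
  open import Algebra.Properties.Ring ring
  open Field isField _≟_
  module F = IsEndo F-endo

  F-injective : ∀ {x y} → F x ≈ F y → x ≈ y
  F-injective = endo-injective F-endo

  infixl 7 _⊛_
  _⊛_ : Carrier → Carrier → Carrier
  x ⊛ u = F x * u + x * F u

  -- `Z` is a second additive map, unrelated to `a` in advance: (a, a, Z) is an infinitesimal
  -- autotopism rather than a derivation in the strict sense.
  record IsDerivation (a Z : Carrier → Carrier) : Set (c ⊔ ℓ) where
    field
      a-add : IsAdd a
      Z-add : IsAdd Z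
      leibniz : ∀ x u → a x ⊛ u + x ⊛ a u ≈ Z (x ⊛ u)

  -- The difference w₃ - w is missing from the list because it vanishes when F has order three.
  module Moved {w : Carrier} (w-moved : ¬ (F w ≈ w)) where
    w₁ w₂ w₃ w₄ : Carrier
    w₁ = F w
    w₂ = F w₁
    w₃ = F w₂
    w₄ = F w₃

    ≉₁₀ : ¬ (w₁ - w ≈ 0#)
    ≉₁₀ = -≉0 w-moved
    ≉₂₁ : ¬ (w₂ - w₁ ≈ 0#)
    ≉₂₁ e = w-moved (F-injective (-≈0⇒≈ e))
    ≉₃₂ : ¬ (w₃ - w₂ ≈ 0#)
    ≉₃₂ e = ≉₂₁ (≈⇒-≈0 (F-injective (-≈0⇒≈ e)))
    ≉₄₃ : ¬ (w₄ - w₃ ≈ 0#)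
    ≉₄₃ e = ≉₃₂ (≈⇒-≈0 (F-injective (-≈0⇒≈ e)))
    ≉₄₀ : ¬ (w₄ - w ≈ 0#)
    ≉₄₀ e = w-moved (F⁴-fixed w (-≈0⇒≈ e))
    ≉₂₀ : ¬ (w₂ - w ≈ 0#)
    ≉₂₀ e = ≉₄₀ (≈⇒-≈0 (trans (F.cong (F.cong (-≈0⇒≈ e))) (-≈0⇒≈ e)))
    ≉₃₁ : ¬ (w₃ - w₁ ≈ 0#)
    ≉₃₁ e = ≉₂₀ (≈⇒-≈0 (F-injective (-≈0⇒≈ e)))

  module g = Moved g-moved

  -- Evaluation at 1, g, g² and g³ gives a Vandermonde system with nodes g, F g, F² g, F³ g. Only
  -- the two middle coefficients are claimed: isolating c₀ or c₃ would divide by F³ g - g, which can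
  -- be zero.
  four-term-independence : ∀ c₀ c₁ c₂ c₃ → (∀ x → c₀ * x + c₁ * F x + c₂ * F (F x) + c₃ * F (F (F x)) ≈ 0#) → c₁ ≈ 0# × c₂ ≈ 0#
  four-term-independence c₀ c₁ c₂ c₃ vanish =
    cancel0 (*-≉0 (*-≉0 g.≉₁₀ g.≉₂₁) g.≉₃₁) (comb₄ e₃ e₂ e₁ e₀ (solve 8 (λ c₀ c₁ c₂ c₃ v₀ v₁ v₂ v₃ →
      (v₁ :- v₀) :* (v₂ :- v₁) :* (v₃ :- v₁) :* c₁ :- :0 :=
      :1 :* (c₀ :* (v₀ :* (v₀ :* v₀)) :+ c₁ :* (v₁ :* (v₁ :* v₁)) :+ c₂ :* (v₂ :* (v₂ :* v₂)) :+ c₃ :* (v₃ :* (v₃ :* v₃)) :- :0)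
      :+ (:- (v₀ :+ v₂ :+ v₃)) :* (c₀ :* (v₀ :* v₀) :+ c₁ :* (v₁ :* v₁) :+ c₂ :* (v₂ :* v₂) :+ c₃ :* (v₃ :* v₃) :- :0)
      :+ (v₀ :* v₂ :+ v₀ :* v₃ :+ v₂ :* v₃) :* (c₀ :* v₀ :+ c₁ :* v₁ :+ c₂ :* v₂ :+ c₃ :* v₃ :- :0)
      :+ (:- (v₀ :* v₂ :* v₃)) :* (c₀ :+ c₁ :+ c₂ :+ c₃ :- :0)) refl c₀ c₁ c₂ c₃ g g.w₁ g.w₂ g.w₃)) ,
    cancel0 (*-≉0 (*-≉0 g.≉₂₀ g.≉₂₁) g.≉₃₂) (comb₄ e₃ e₂ e₁ e₀ (solve 8 (λ c₀ c₁ c₂ c₃ v₀ v₁ v₂ v₃ →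
      (v₂ :- v₀) :* (v₂ :- v₁) :* (v₃ :- v₂) :* c₂ :- :0 :=
      (:- :1) :* (c₀ :* (v₀ :* (v₀ :* v₀)) :+ c₁ :* (v₁ :* (v₁ :* v₁)) :+ c₂ :* (v₂ :* (v₂ :* v₂)) :+ c₃ :* (v₃ :* (v₃ :* v₃)) :- :0)
      :+ (v₀ :+ v₁ :+ v₃) :* (c₀ :* (v₀ :* v₀) :+ c₁ :* (v₁ :* v₁) :+ c₂ :* (v₂ :* v₂) :+ c₃ :* (v₃ :* v₃) :- :0)
      :+ (:- (v₀ :* v₁ :+ v₀ :* v₃ :+ v₁ :* v₃)) :* (c₀ :* v₀ :+ c₁ :* v₁ :+ c₂ :* v₂ :+ c₃ :* v₃ :- :0)
      :+ (v₀ :* v₁ :* v₃) :* (c₀ :+ c₁ :+ c₂ :+ c₃ :- :0)) refl c₀ c₁ c₂ c₃ g g.w₁ g.w₂ g.w₃))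
    where
    F-sq : ∀ v → F (v * v) ≈ F v * F v
    F-sq v = F.*-homo v v
    F-cb : ∀ v → F (v * (v * v)) ≈ F v * (F v * F v)
    F-cb v = trans (F.*-homo v (v * v)) (*-congˡ (F-sq v))
    iter : ∀ {u v₁ v₂ v₃} → F u ≈ v₁ → F v₁ ≈ v₂ → F v₂ ≈ v₃ → c₀ * u + c₁ * v₁ + c₂ * v₂ + c₃ * v₃ ≈ 0#
    iter {u} p q r = trans (sym (+-cong (+-cong (+-congˡ (*-congˡ p)) (*-congˡ p₂)) (*-congˡ (trans (F.cong p₂) r)))) (vanish u)
      where p₂ = trans (F.cong p) q
    e₃ : c₀ * (g * (g * g)) + c₁ * (g.w₁ * (g.w₁ * g.w₁)) + c₂ * (g.w₂ * (g.w₂ * g.w₂)) + c₃ * (g.w₃ * (g.w₃ * g.w₃)) ≈ 0#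
    e₃ = iter (F-cb g) (F-cb g.w₁) (F-cb g.w₂)
    e₂ : c₀ * (g * g) + c₁ * (g.w₁ * g.w₁) + c₂ * (g.w₂ * g.w₂) + c₃ * (g.w₃ * g.w₃) ≈ 0#
    e₂ = iter (F-sq g) (F-sq g.w₁) (F-sq g.w₂)
    e₁ : c₀ * g + c₁ * g.w₁ + c₂ * g.w₂ + c₃ * g.w₃ ≈ 0#
    e₁ = vanish g
    e₀ : c₀ + c₁ + c₂ + c₃ ≈ 0#
    e₀ = trans (sym (+-cong (+-cong (+-cong (*-identityʳ c₀) (*-identityʳ c₁)) (*-identityʳ c₂)) (*-identityʳ c₃)))
           (iter F.1-homo F.1-homo F.1-homo)

  module _ {a Z : Carrier → Carrier} (der : IsDerivation a Z) {w : Carrier} (w-moved : ¬ (F w ≈ w)) where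
    open IsDerivation der
    open Moved w-moved
    private
      module a = IsAdd a-add
      module Z = IsAdd Z-add

    -- The quadratic (z - w₂)(z - w) vanishes at w₂ = F w₁, and its image (z - w₃)(z - w₁) under F
    -- vanishes at w₁. Attaching powers of w₁ to x and the coefficients of the first quadratic to t
    -- therefore kills F x * t and x * F t together. What is left of the Leibniz rule has `P`, `Q`,
    -- `S`, `T` as coefficients of t, F t, F x and x.
    P Q S T : Carrier → Carrier
    P x = F (a (w₁ * w₁ * x)) - (w₂ + w) * F (a (w₁ * x)) + w₂ * w * F (a x)
    Q x = a (w₁ * w₁ * x) - (w₃ + w₁) * a (w₁ * x) + w₃ * w₁ * a x
    S t = w₂ * w₂ * a t - w₂ * a ((w₂ + w) * t) + a (w₂ * w * t)
    T t = w₁ * w₁ * F (a t) - w₁ * F (a ((w₂ + w) * t)) + F (a (w₂ * w * t))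

    expand : ∀ {x x₁ u u₁} → F x ≈ x₁ → F u ≈ u₁ →
             F (a x) * u + a x * u₁ + (x₁ * a u + x * F (a u)) ≈ Z (x₁ * u + x * u₁)
    expand {x} {x₁} {u} {u₁} p q = trans (sym lhs) (trans (leibniz x u) (Z.cong (+-cong (*-congʳ p) (*-congˡ q))))
      where
      lhs : a x ⊛ u + x ⊛ a u ≈ F (a x) * u + a x * u₁ + (x₁ * a u + x * F (a u))
      lhs = +-cong (+-congˡ (*-congˡ q)) (+-congʳ (*-congʳ p))

    -- Z disappears because w₁² x ⊛ t - w₁ x ⊛ (w₂ + w) t + x ⊛ (w₂ w t) = 0
    bilinear : ∀ x t → P x * t + Q x * F t + S t * F x + T t * x ≈ 0#
    bilinear x t = comb₄
      (expand {w₁ * w₁ * x} {w₂ * w₂ * F x} (trans (F.*-homo _ x) (*-congʳ (F.*-homo w₁ w₁))) (refl {F t}))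
      (expand {w₁ * x} {w₂ * F x} {(w₂ + w) * t} {(w₃ + w₁) * F t} (F.*-homo w₁ x) (trans (F.*-homo _ t) (*-congʳ (F.+-homo w₂ w))))
      (expand {x} {F x} {w₂ * w * t} {w₃ * w₁ * F t} refl (trans (F.*-homo _ t) (*-congʳ (F.*-homo w₂ w))))
      Z-relation
      (solve 23 (λ w w₁ w₂ w₃ x x₁ t t₁ p₁ φp₁ p₂ φp₂ p₃ φp₃ n₁ φn₁ n₂ φn₂ n₃ φn₃ z₁ z₂ z₃ →
        (φp₁ :- (w₂ :+ w) :* φp₂ :+ w₂ :* w :* φp₃) :* t :+ (p₁ :- (w₃ :+ w₁) :* p₂ :+ w₃ :* w₁ :* p₃) :* t₁
        :+ (w₂ :* w₂ :* n₁ :- w₂ :* n₂ :+ n₃) :* x₁ :+ (w₁ :* w₁ :* φn₁ :- w₁ :* φn₂ :+ φn₃) :* x :- :0 :=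
        :1 :* (φp₁ :* t :+ p₁ :* t₁ :+ (w₂ :* w₂ :* x₁ :* n₁ :+ w₁ :* w₁ :* x :* φn₁) :- z₁)
        :+ (:- :1) :* (φp₂ :* ((w₂ :+ w) :* t) :+ p₂ :* ((w₃ :+ w₁) :* t₁) :+ (w₂ :* x₁ :* n₂ :+ w₁ :* x :* φn₂) :- z₂)
        :+ :1 :* (φp₃ :* (w₂ :* w :* t) :+ p₃ :* (w₃ :* w₁ :* t₁) :+ (x₁ :* n₃ :+ x :* φn₃) :- z₃)
        :+ :1 :* (z₁ :+ z₃ :- z₂))
        refl w w₁ w₂ w₃ x (F x) t (F t) (a (w₁ * w₁ * x)) (F (a (w₁ * w₁ * x))) (a (w₁ * x)) (F (a (w₁ * x))) (a x) (F (a x))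
        (a t) (F (a t)) (a ((w₂ + w) * t)) (F (a ((w₂ + w) * t))) (a (w₂ * w * t)) (F (a (w₂ * w * t))) (Z z₁) (Z z₂) (Z z₃))
      where
      z₁ = w₂ * w₂ * F x * t + w₁ * w₁ * x * F t
      z₂ = w₂ * F x * ((w₂ + w) * t) + w₁ * x * ((w₃ + w₁) * F t)
      z₃ = F x * (w₂ * w * t) + x * (w₃ * w₁ * F t)
      Z-relation : Z z₁ + Z z₃ ≈ Z z₂
      Z-relation = trans (sym (Z.+-homo z₁ z₃)) (Z.cong
        (solve 8 (λ w w₁ w₂ w₃ x x₁ t t₁ →
          w₂ :* w₂ :* x₁ :* t :+ w₁ :* w₁ :* x :* t₁ :+ (x₁ :* (w₂ :* w :* t) :+ x :* (w₃ :* w₁ :* t₁)) :=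
          w₂ :* x₁ :* ((w₂ :+ w) :* t) :+ w₁ :* x :* ((w₃ :+ w₁) :* t₁)) refl w w₁ w₂ w₃ x (F x) t (F t)))

    private
      θ≉0 : ¬ (F g - g ≈ 0#)
      θ≉0 = g.≉₁₀
      θ⁻¹ ρ⁻¹ : Carrier
      θ⁻¹ = inv (F g - g) θ≉0
      ρ⁻¹ = inv (w₄ - w) ≉₄₀

      κ₀ κ₁ κ₂ κ₃ : Carrier
      κ₀ = (T g - F g * T 1#) * θ⁻¹
      κ₁ = (S g - F g * S 1#) * θ⁻¹
      κ₂ = (g * T 1# - T g) * θ⁻¹
      κ₃ = (g * S 1# - S g) * θ⁻¹

      -- The choices t = g and t = 1 in `bilinear` are two linear equations for P x and Q x, with
      -- determinant F g - g up to sign.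
      P-form : ∀ x → P x ≈ κ₀ * x + κ₁ * F x
      P-form x = cancel θ≉0 (comb₄ (bilinear x g) (bilinear x 1#) F.1-homo (inv-r (F g - g) θ≉0)
        (solve 12 (λ p q g g₁ x x₁ o i s s′ t t′ →
          (g₁ :- g) :* p :- (g₁ :- g) :* ((t :- g₁ :* t′) :* i :* x :+ (s :- g₁ :* s′) :* i :* x₁) :=
          (:- :1) :* (p :* g :+ q :* g₁ :+ s :* x₁ :+ t :* x :- :0)
          :+ g₁ :* (p :* :1 :+ q :* o :+ s′ :* x₁ :+ t′ :* x :- :0)
          :+ (:- (g₁ :* q)) :* (o :- :1)
          :+ (:- ((t :- g₁ :* t′) :* x :+ (s :- g₁ :* s′) :* x₁)) :* ((g₁ :- g) :* i :- :1))
          refl (P x) (Q x) g (F g) x (F x) (F 1#) θ⁻¹ (S g) (S 1#) (T g) (T 1#)))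

      Q-form : ∀ x → Q x ≈ κ₂ * x + κ₃ * F x
      Q-form x = cancel θ≉0 (comb₄ (bilinear x g) (bilinear x 1#) F.1-homo (inv-r (F g - g) θ≉0)
        (solve 12 (λ p q g g₁ x x₁ o i s s′ t t′ →
          (g₁ :- g) :* q :- (g₁ :- g) :* ((g :* t′ :- t) :* i :* x :+ (g :* s′ :- s) :* i :* x₁) :=
          :1 :* (p :* g :+ q :* g₁ :+ s :* x₁ :+ t :* x :- :0)
          :+ (:- g) :* (p :* :1 :+ q :* o :+ s′ :* x₁ :+ t′ :* x :- :0)
          :+ (g :* q) :* (o :- :1)
          :+ (:- ((g :* t′ :- t) :* x :+ (g :* s′ :- s) :* x₁)) :* ((g₁ :- g) :* i :- :1))
          refl (P x) (Q x) g (F g) x (F x) (F 1#) θ⁻¹ (S g) (S 1#) (T g) (T 1#)))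

    FQ : ∀ x → F (Q x) ≈ F (a (w₁ * w₁ * x)) - (w₄ + w₂) * F (a (w₁ * x)) + w₄ * w₂ * F (a x)
    FQ x = trans (F.+-homo _ _) (+-cong
      (trans (F.sub-homo _ _) (+-congˡ (-‿cong (trans (F.*-homo _ _) (*-congʳ (F.+-homo w₃ w₁))))))
      (trans (F.*-homo _ _) (*-congʳ (F.*-homo w₃ w₁))))

    -- P x - F (Q x) is a multiple of F (a (w₁ x) - w₁ a x), while P and Q take values in the span of x and F x
    commutator-form : ∃ λ k₀ → ∃ λ k₁ → ∃ λ k₂ → ∀ x →
      F (a (w₁ * x) - w₁ * a x) ≈ k₀ * x + k₁ * F x + k₂ * F (F x)
    commutator-form = κ₀ * ρ⁻¹ , (κ₁ - F κ₂) * ρ⁻¹ , - F κ₃ * ρ⁻¹ , λ x → cancel ≉₄₀ (trans (PQ x) (comb₁ (inv-r (w₄ - w) ≉₄₀)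
      (solve 10 (λ w w₄ i k₀ k₁ φ₂ φ₃ x x₁ x₂ →
        k₀ :* x :+ k₁ :* x₁ :- (φ₂ :* x₁ :+ φ₃ :* x₂) :-
        (w₄ :- w) :* (k₀ :* i :* x :+ (k₁ :- φ₂) :* i :* x₁ :+ (:- φ₃) :* i :* x₂) :=
        (:- (k₀ :* x :+ (k₁ :- φ₂) :* x₁ :+ (:- φ₃) :* x₂)) :* ((w₄ :- w) :* i :- :1))
        refl w w₄ ρ⁻¹ κ₀ κ₁ (F κ₂) (F κ₃) x (F x) (F (F x)))))
      where
      PQ : ∀ x → (w₄ - w) * F (a (w₁ * x) - w₁ * a x) ≈ κ₀ * x + κ₁ * F x - (F κ₂ * F x + F κ₃ * F (F x))
      PQ x = comb₄ (P-form x) (trans (sym (F.cong (Q-form x))) (FQ x))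
        (trans (F.+-homo (κ₂ * x) (κ₃ * F x)) (+-cong (F.*-homo _ _) (F.*-homo _ _)))
        (trans (F.sub-homo _ _) (+-congˡ (-‿cong (F.*-homo _ _))))
        (solve 10 (λ w w₂ w₄ p₁ p₂ p₃ κκ φQ φκ φC →
          (w₄ :- w) :* φC :- (κκ :- φκ) :=
          :1 :* (p₁ :- (w₂ :+ w) :* p₂ :+ w₂ :* w :* p₃ :- κκ)
          :+ :1 :* (φQ :- (p₁ :- (w₄ :+ w₂) :* p₂ :+ w₄ :* w₂ :* p₃))
          :+ (:- :1) :* (φQ :- φκ)
          :+ (w₄ :- w) :* (φC :- (p₂ :- w₂ :* p₃)))
          refl w w₂ w₄ (F (a (w₁ * w₁ * x))) (F (a (w₁ * x))) (F (a x)) (κ₀ * x + κ₁ * F x)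
          (F (κ₂ * x + κ₃ * F x)) (F κ₂ * F x + F κ₃ * F (F x)) (F (a (w₁ * x) - w₁ * a x)))

  -- Multiplication by s is itself a derivation, with F s + s in the role of `Z`, and the commutator
  -- of two derivations is a derivation.
  commutator-isDerivation : ∀ {a Z} → IsDerivation a Z → ∀ s →
    IsDerivation (λ x → a (s * x) - s * a x) (λ z → Z ((F s + s) * z) - (F s + s) * Z z)
  commutator-isDerivation {a} {Z} der s = record
    { a-add = +-isAdd (∘-isAdd a-add (scale-isAdd s)) (neg-isAdd (*-isAdd s a-add))
    ; Z-add = +-isAdd (∘-isAdd Z-add (scale-isAdd (F s + s))) (neg-isAdd (*-isAdd (F s + s) Z-add))
    ; leibniz = λ x u → comb₄
        (trans (+-cong (leibniz (s * x) u) (leibniz x (s * u))) (trans (sym (Z.+-homo _ _)) (Z.cong (comb₂ (F.*-homo s x) (F.*-homo s u)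
           (solve 8 (λ s s₁ x x₁ u u₁ sx su →
             sx :* u :+ s :* x :* u₁ :+ (x₁ :* (s :* u) :+ x :* su) :- (s₁ :+ s) :* (x₁ :* u :+ x :* u₁) :=
             u :* (sx :- s₁ :* x₁) :+ x :* (su :- s₁ :* u₁)) refl s (F s) x (F x) u (F u) (F (s * x)) (F (s * u)))))))
        (leibniz x u)
        (+-cong (*-congʳ {u} (twist x)) (*-congˡ {x} (twist u)))
        (+-cong (*-congʳ {a u} (F.*-homo s x)) (*-congˡ {a x} (F.*-homo s u)))
        (solve 20 (λ s s₁ x x₁ u u₁ sx su m φm n φn ax φax au φau z z′ c c′ →
          c :* u :+ (m :- s :* ax) :* u₁ :+ (x₁ :* (n :- s :* au) :+ x :* c′) :- (z′ :- (s₁ :+ s) :* z) :=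
          :1 :* (φm :* u :+ m :* u₁ :+ (sx :* au :+ s :* x :* φau) :+ (φax :* (s :* u) :+ ax :* su :+ (x₁ :* n :+ x :* φn)) :- z′)
          :+ (:- (s₁ :+ s)) :* (φax :* u :+ ax :* u₁ :+ (x₁ :* au :+ x :* φau) :- z)
          :+ :1 :* (c :* u :+ x :* c′ :- ((φm :- s₁ :* φax) :* u :+ x :* (φn :- s₁ :* φau)))
          :+ (:- :1) :* (sx :* au :+ ax :* su :- (s₁ :* x₁ :* au :+ ax :* (s₁ :* u₁))))
          refl s (F s) x (F x) u (F u) (F (s * x)) (F (s * u)) (a (s * x)) (F (a (s * x))) (a (s * u)) (F (a (s * u)))
          (a x) (F (a x)) (a u) (F (a u)) (Z (x ⊛ u)) (Z ((F s + s) * (x ⊛ u)))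
          (F (a (s * x) - s * a x)) (F (a (s * u) - s * a u)))
    }
    where
    open IsDerivation der
    module Z = IsAdd Z-add
    twist : ∀ x → F (a (s * x) - s * a x) ≈ F (a (s * x)) - F s * F (a x)
    twist x = trans (F.sub-homo _ _) (+-congˡ (-‿cong (F.*-homo s (a x))))

  module _ {a Z : Carrier → Carrier} (der : IsDerivation a Z) {k₀ k₁ k₂ : Carrier}
    (form : ∀ x → F (a x) ≈ k₀ * x + k₁ * F x + k₂ * F (F x)) where
    private
      module a = IsAdd (IsDerivation.a-add der)
      open g
      -- Values at w₁ and w₃ of (z - w₂)(z - g), and of its image (z - w₄)(z - w₂) under F². In each
      -- evaluation below the k₁-term meets a root of its quadratic and drops out.
      α β γ δ : Carrier
      α = (w₁ - w₂) * (w₁ - g)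
      β = (w₃ - w₂) * (w₃ - g)
      γ = (w₁ - w₄) * (w₁ - w₂)
      δ = (w₃ - w₄) * (w₃ - w₂)

      form-* : ∀ {s s₁ s₂} → F s ≈ s₁ → F s₁ ≈ s₂ → ∀ x → F (a (s * x)) ≈ k₀ * (s * x) + k₁ * (s₁ * F x) + k₂ * (s₂ * F (F x))
      form-* {s} {s₁} {s₂} p q x = trans (form (s * x)) (+-cong (+-congˡ (*-congˡ e)) (*-congˡ (trans (F.cong e) (trans (F.*-homo s₁ (F x)) (*-congʳ q)))))
        where
        e : F (s * x) ≈ s₁ * F x
        e = trans (F.*-homo s x) (*-congʳ p)

      form-sq : ∀ x → F (a (w₁ * w₁ * x)) ≈ k₀ * (w₁ * w₁ * x) + k₁ * (w₂ * w₂ * F x) + k₂ * (w₃ * w₃ * F (F x))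
      form-sq = form-* (F.*-homo w₁ w₁) (F.*-homo w₂ w₂)
      form-w₁ : ∀ x → F (a (w₁ * x)) ≈ k₀ * (w₁ * x) + k₁ * (w₂ * F x) + k₂ * (w₃ * F (F x))
      form-w₁ = form-* refl refl
      form-sum : ∀ x → F (a ((w₂ + g) * x)) ≈ k₀ * ((w₂ + g) * x) + k₁ * ((w₃ + w₁) * F x) + k₂ * ((w₄ + w₂) * F (F x))
      form-sum = form-* (F.+-homo w₂ g) (F.+-homo w₃ w₁)
      form-prod : ∀ x → F (a (w₂ * g * x)) ≈ k₀ * (w₂ * g * x) + k₁ * (w₃ * w₁ * F x) + k₂ * (w₄ * w₂ * F (F x))
      form-prod = form-* (F.*-homo w₂ g) (F.*-homo w₃ w₁)

      P-eval : ∀ x → P der g-moved x ≈ k₀ * α * x + k₂ * β * F (F x)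
      P-eval x = comb₃ (form-sq x) (form-w₁ x) (form x)
        (solve 13 (λ w w₁ w₂ w₃ x x₁ x₂ k₀ k₁ k₂ f₁ f₂ f₃ →
          f₁ :- (w₂ :+ w) :* f₂ :+ w₂ :* w :* f₃ :-
          (k₀ :* ((w₁ :- w₂) :* (w₁ :- w)) :* x :+ k₂ :* ((w₃ :- w₂) :* (w₃ :- w)) :* x₂) :=
          :1 :* (f₁ :- (k₀ :* (w₁ :* w₁ :* x) :+ k₁ :* (w₂ :* w₂ :* x₁) :+ k₂ :* (w₃ :* w₃ :* x₂)))
          :+ (:- (w₂ :+ w)) :* (f₂ :- (k₀ :* (w₁ :* x) :+ k₁ :* (w₂ :* x₁) :+ k₂ :* (w₃ :* x₂)))
          :+ (w₂ :* w) :* (f₃ :- (k₀ :* x :+ k₁ :* x₁ :+ k₂ :* x₂)))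
          refl g w₁ w₂ w₃ x (F x) (F (F x)) k₀ k₁ k₂ (F (a (w₁ * w₁ * x))) (F (a (w₁ * x))) (F (a x)))

      FQ-eval : ∀ x → F (Q der g-moved x) ≈ k₀ * γ * x + k₂ * δ * F (F x)
      FQ-eval x = trans (FQ der g-moved x) (comb₃ (form-sq x) (form-w₁ x) (form x)
        (solve 13 (λ w₁ w₂ w₃ w₄ x x₁ x₂ k₀ k₁ k₂ f₁ f₂ f₃ →
          f₁ :- (w₄ :+ w₂) :* f₂ :+ w₄ :* w₂ :* f₃ :-
          (k₀ :* ((w₁ :- w₄) :* (w₁ :- w₂)) :* x :+ k₂ :* ((w₃ :- w₄) :* (w₃ :- w₂)) :* x₂) :=
          :1 :* (f₁ :- (k₀ :* (w₁ :* w₁ :* x) :+ k₁ :* (w₂ :* w₂ :* x₁) :+ k₂ :* (w₃ :* w₃ :* x₂)))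
          :+ (:- (w₄ :+ w₂)) :* (f₂ :- (k₀ :* (w₁ :* x) :+ k₁ :* (w₂ :* x₁) :+ k₂ :* (w₃ :* x₂)))
          :+ (w₄ :* w₂) :* (f₃ :- (k₀ :* x :+ k₁ :* x₁ :+ k₂ :* x₂)))
          refl w₁ w₂ w₃ w₄ x (F x) (F (F x)) k₀ k₁ k₂ (F (a (w₁ * w₁ * x))) (F (a (w₁ * x))) (F (a x))))

      T-eval : ∀ t → T der g-moved t ≈ k₀ * α * t + k₂ * γ * F (F t)
      T-eval t = comb₃ (form t) (form-sum t) (form-prod t)
        (solve 14 (λ w w₁ w₂ w₃ w₄ x x₁ x₂ k₀ k₁ k₂ f₁ f₂ f₃ →
          w₁ :* w₁ :* f₁ :- w₁ :* f₂ :+ f₃ :-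
          (k₀ :* ((w₁ :- w₂) :* (w₁ :- w)) :* x :+ k₂ :* ((w₁ :- w₄) :* (w₁ :- w₂)) :* x₂) :=
          (w₁ :* w₁) :* (f₁ :- (k₀ :* x :+ k₁ :* x₁ :+ k₂ :* x₂))
          :+ (:- w₁) :* (f₂ :- (k₀ :* ((w₂ :+ w) :* x) :+ k₁ :* ((w₃ :+ w₁) :* x₁) :+ k₂ :* ((w₄ :+ w₂) :* x₂)))
          :+ :1 :* (f₃ :- (k₀ :* (w₂ :* w :* x) :+ k₁ :* (w₃ :* w₁ :* x₁) :+ k₂ :* (w₄ :* w₂ :* x₂))))
          refl g w₁ w₂ w₃ w₄ t (F t) (F (F t)) k₀ k₁ k₂ (F (a t)) (F (a ((w₂ + g) * t))) (F (a (w₂ * g * t))))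

      FS-eval : ∀ t → F (S der g-moved t) ≈ k₀ * β * t + k₂ * δ * F (F t)
      FS-eval t = comb₄ FS (form t) (form-sum t) (form-prod t)
        (solve 15 (λ w w₁ w₂ w₃ w₄ x x₁ x₂ k₀ k₁ k₂ f₁ f₂ f₃ φS →
          φS :- (k₀ :* ((w₃ :- w₂) :* (w₃ :- w)) :* x :+ k₂ :* ((w₃ :- w₄) :* (w₃ :- w₂)) :* x₂) :=
          :1 :* (φS :- (w₃ :* w₃ :* f₁ :- w₃ :* f₂ :+ f₃))
          :+ (w₃ :* w₃) :* (f₁ :- (k₀ :* x :+ k₁ :* x₁ :+ k₂ :* x₂))
          :+ (:- w₃) :* (f₂ :- (k₀ :* ((w₂ :+ w) :* x) :+ k₁ :* ((w₃ :+ w₁) :* x₁) :+ k₂ :* ((w₄ :+ w₂) :* x₂)))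
          :+ :1 :* (f₃ :- (k₀ :* (w₂ :* w :* x) :+ k₁ :* (w₃ :* w₁ :* x₁) :+ k₂ :* (w₄ :* w₂ :* x₂))))
          refl g w₁ w₂ w₃ w₄ t (F t) (F (F t)) k₀ k₁ k₂ (F (a t)) (F (a ((w₂ + g) * t))) (F (a (w₂ * g * t))) (F (S der g-moved t)))
        where
        FS : F (S der g-moved t) ≈ w₃ * w₃ * F (a t) - w₃ * F (a ((w₂ + g) * t)) + F (a (w₂ * g * t))
        FS = trans (F.+-homo _ _) (+-congʳ (trans (F.sub-homo _ _) (+-cong
          (trans (F.*-homo _ _) (*-congʳ (F.*-homo w₂ w₂))) (-‿cong (F.*-homo _ _)))))

      F-pair : ∀ s t x → F (s * x + t * F (F x)) ≈ F s * F x + F t * F (F (F x))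
      F-pair s t x = trans (F.+-homo _ _) (+-cong (F.*-homo _ _) (F.*-homo _ _))

      -- The identity `bilinear` after applying F, sorted by x, F x, F² x, F³ x. For each fixed t
      -- the two middle coefficients must vanish.
      vanishing : ∀ t x →
        k₀ * γ * F (F t) * x + (F (k₀ * α) * F t + F (k₀ * α) * F t + F (k₂ * γ) * F (F (F t))) * F x
        + (k₂ * δ * F (F t) + k₂ * δ * F (F t) + k₀ * β * t) * F (F x) + F (k₂ * β) * F t * F (F (F x)) ≈ 0#
      vanishing t x = trans
        (solve 14 (λ x x₁ x₂ x₃ t t₁ t₂ t₃ k₀γ φk₀α φk₂γ k₂δ k₀β φk₂β →
          k₀γ :* t₂ :* x :+ (φk₀α :* t₁ :+ φk₀α :* t₁ :+ φk₂γ :* t₃) :* x₁ :+ (k₂δ :* t₂ :+ k₂δ :* t₂ :+ k₀β :* t) :* x₂ :+ φk₂β :* t₁ :* x₃ :=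
          (φk₀α :* x₁ :+ φk₂β :* x₃) :* t₁ :+ (k₀γ :* x :+ k₂δ :* x₂) :* t₂ :+ (k₀β :* t :+ k₂δ :* t₂) :* x₂ :+ (φk₀α :* t₁ :+ φk₂γ :* t₃) :* x₁)
          refl x (F x) (F (F x)) (F (F (F x))) t (F t) (F (F t)) (F (F (F t))) (k₀ * γ) (F (k₀ * α)) (F (k₂ * γ)) (k₂ * δ) (k₀ * β) (F (k₂ * β)))
        (trans (sym eq) (trans (F.cong (bilinear der g-moved x t)) F.0-homo))
        where
        eq : F (P der g-moved x * t + Q der g-moved x * F t + S der g-moved t * F x + T der g-moved t * x) ≈
             (F (k₀ * α) * F x + F (k₂ * β) * F (F (F x))) * F t + (k₀ * γ * x + k₂ * δ * F (F x)) * F (F t)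
             + (k₀ * β * t + k₂ * δ * F (F t)) * F (F x) + (F (k₀ * α) * F t + F (k₂ * γ) * F (F (F t))) * F x
        eq = trans (F.+-homo _ _) (+-cong (trans (F.+-homo _ _) (+-cong (trans (F.+-homo _ _) (+-cong
          (trans (F.*-homo _ _) (*-congʳ (trans (F.cong (P-eval x)) (F-pair _ _ x))))
          (trans (F.*-homo _ _) (*-congʳ (FQ-eval x)))))
          (trans (F.*-homo _ _) (*-congʳ (FS-eval t)))))
          (trans (F.*-homo _ _) (*-congʳ (trans (F.cong (T-eval t)) (F-pair _ _ t)))))

    module _ (2≉0 : ¬ (1# + 1# ≈ 0#)) where
      private
        neg-≉ : ∀ {x y} → ¬ (x - y ≈ 0#) → ¬ (y - x ≈ 0#)
        neg-≉ n e = n (≈⇒-≈0 (sym (-≈0⇒≈ e)))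

        twice : ∀ {x} → x + x ≈ 0# → x ≈ 0#
        twice {x} e = cancel0 2≉0 (trans (solve 1 (λ x → (:1 :+ :1) :* x := x :+ x) refl x) e)

        k₀≈0 : k₀ ≈ 0#
        -- The coefficient of F x vanishes for every t, so independence is applied a second time,
        -- now in t.
        k₀≈0 = cancel0 (*-≉0 (neg-≉ ≉₂₁) ≉₁₀) (trans (*-comm α k₀) (endo-≈0 F-endo (twice
          (proj₁ (four-term-independence 0# (F (k₀ * α) + F (k₀ * α)) 0# (F (k₂ * γ)) λ t → trans
            (solve 6 (λ t t₁ t₂ t₃ a b → :0 :* t :+ (a :+ a) :* t₁ :+ :0 :* t₂ :+ b :* t₃ := a :* t₁ :+ a :* t₁ :+ b :* t₃)
              refl t (F t) (F (F t)) (F (F (F t))) (F (k₀ * α)) (F (k₂ * γ)))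
            (proj₁ (four-term-independence _ _ _ _ (vanishing t))))))))
          where open g

        k₂≈0 : k₂ ≈ 0#
        k₂≈0 = cancel0 (*-≉0 (neg-≉ ≉₄₃) ≉₃₂) (twice (comb₃ (proj₂ (four-term-independence _ _ _ _ (vanishing 1#))) F²1 k₀≈0
          (solve 5 (λ k₀ k₂ b d o → d :* k₂ :+ d :* k₂ :- :0 :=
            :1 :* (k₂ :* d :* o :+ k₂ :* d :* o :+ k₀ :* b :* :1 :- :0) :+ (:- (k₂ :* d :+ k₂ :* d)) :* (o :- :1) :+ (:- b) :* (k₀ :- :0))
            refl k₀ k₂ β δ (F (F 1#)))))
          where
          open g
          F²1 : F (F 1#) ≈ 1#
          F²1 = trans (F.cong F.1-homo) F.1-homo

      form⇒scalar : ∀ x → a x ≈ a 1# * x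
      form⇒scalar x = F-injective (trans (step x) (trans (*-congʳ (sym (trans (step 1#) (trans (*-congˡ F.1-homo) (*-identityʳ k₁))))) (sym (F.*-homo (a 1#) x))))
        where
        step : ∀ x → F (a x) ≈ k₁ * F x
        step x = comb₃ (form x) k₀≈0 k₂≈0
          (solve 7 (λ f k₀ k₁ k₂ x x₁ x₂ → f :- k₁ :* x₁ :=
            :1 :* (f :- (k₀ :* x :+ k₁ :* x₁ :+ k₂ :* x₂)) :+ x :* (k₀ :- :0) :+ x₂ :* (k₂ :- :0))
            refl (F (a x)) k₀ k₁ k₂ x (F x) (F (F x)))

  module _ (2≉0 : ¬ (1# + 1# ≈ 0#)) (F-surjective : ∀ y → ∃ λ x → F x ≈ y)
    (q : ℕ) (F-pow : ∀ x → F x ≈ pow R x q) (q≈0 : times R q 1# ≈ 0#) where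

    private
      moved-≉0 : ∀ {x} → ¬ (F x ≈ x) → ¬ (x ≈ 0#)
      moved-≉0 n e = n (trans (F.cong e) (trans F.0-homo (sym e)))

      module Normalised {a Z} (der : IsDerivation a Z) (a1≈0 : a 1# ≈ 0#) where
        open IsDerivation der
        module a = IsAdd a-add

        -- The commutator of `a` with multiplication by F w is a derivation of three-term form,
        -- hence a scalar; since a 1 = 0, that scalar is a (F w).
        product-rule : ∀ {w} → ¬ (F w ≈ w) → ∀ x → a (F w * x) ≈ F w * a x + a (F w) * x
        product-rule {w} w-moved x = comb₃
          (form⇒scalar (commutator-isDerivation der (F w)) (proj₂ (proj₂ (proj₂ (commutator-form der w-moved)))) 2≉0 x)
          (a.cong (*-identityʳ (F w))) a1≈0
          (solve 7 (λ s x sx ax s1 as a1 → sx :- (s :* ax :+ as :* x) :=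
            :1 :* (sx :- s :* ax :- (s1 :- s :* a1) :* x) :+ x :* (s1 :- as) :+ (:- (s :* x)) :* (a1 :- :0))
            refl (F w) x (a (F w * x)) (a x) (a (F w * 1#)) (a (F w)) (a 1#))

        -- The factor F w on the left replaces the exponent n - 1 of the usual rule.
        power-rule : ∀ {w} → ¬ (F w ≈ w) → ∀ n →
          F w * a (pow R (F w) n) ≈ times R n 1# * (pow R (F w) n * a (F w))
        power-rule w-moved ℕ.zero = trans (*-congˡ a1≈0) (trans (zeroʳ _) (sym (zeroˡ _)))
        power-rule {w} w-moved (ℕ.suc n) = comb₂ (product-rule w-moved (pow R (F w) n)) (power-rule w-moved n)
          (solve 6 (λ s p asp ap as t → s :* asp :- (:1 :+ t) :* (s :* p :* as) :=
            s :* (asp :- (s :* ap :+ as :* p)) :+ s :* (s :* ap :- t :* (p :* as)))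
            refl (F w) (pow R (F w) n) (a (F w * pow R (F w) n)) (a (pow R (F w) n)) (a (F w)) (times R n 1#))

        -- A moved x is F (F w), the q-th power of F w, and the power rule kills it because q is
        -- zero in the field. Two preimages are taken since the product rule is available only for F
        -- w with w moved.
        moved⇒0 : ∀ x → ¬ (F x ≈ x) → a x ≈ 0#
        moved⇒0 x x-moved with F-surjective x
        ... | y , Fy≈x with F-surjective y
        ... | w , Fw≈y = trans (a.cong (sym FFw≈x)) (trans (a.cong (F-pow (F w)))
          (cancel0 (moved-≉0 Fw-moved) (trans (power-rule w-moved q) (trans (*-congʳ q≈0) (zeroˡ _)))))
          where
          FFw≈x : F (F w) ≈ x
          FFw≈x = trans (F.cong Fw≈y) Fy≈x
          Fw-moved : ¬ (F (F w) ≈ F w)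
          Fw-moved e = x-moved (trans (F.cong (sym FFw≈x)) (trans (F.cong e) FFw≈x))
          w-moved : ¬ (F w ≈ w)
          w-moved e = Fw-moved (F.cong e)

        vanishes : ∀ x → a x ≈ 0#
        vanishes x with F x ≟ x | x ≟ 0#
        ... | no x-moved | _ = moved⇒0 x x-moved
        ... | yes _ | yes x≈0 = trans (a.cong x≈0) a.0-homo
        ... | yes Fx≈x | no x≉0 with F-surjective g
        -- For a nonzero fixed x and a moved s, the product s x is moved too; both a s and a (s x)
        -- vanish, and the product rule returns a x = 0.
        ... | w , Fw≈g = cancel0 (moved-≉0 s-moved) (comb₃ (product-rule w-moved x) (moved⇒0 (F w) s-moved) (moved⇒0 (F w * x) sx-moved)
          (solve 5 (λ s x ax as asx → s :* ax :- :0 :=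
            (:- :1) :* (asx :- (s :* ax :+ as :* x)) :+ (:- x) :* (as :- :0) :+ :1 :* (asx :- :0))
            refl (F w) x (a x) (a (F w)) (a (F w * x))))
          where
          s-moved : ¬ (F (F w) ≈ F w)
          s-moved e = g-moved (trans (F.cong (sym Fw≈g)) (trans e Fw≈g))
          w-moved : ¬ (F w ≈ w)
          w-moved e = s-moved (F.cong e)
          sx-moved : ¬ (F (F w * x) ≈ F w * x)
          sx-moved e = s-moved (cancel x≉0 (comb₃ e (F.*-homo (F w) x) Fx≈x
            (solve 5 (λ s t x fx fsx → x :* t :- x :* s := :1 :* (fsx :- s :* x) :+ (:- :1) :* (fsx :- t :* fx) :+ (:- t) :* (fx :- x))
              refl (F w) (F (F w)) x (F x) (F (F w * x)))))

    -- Multiplication by a 1 is a derivation, so subtracting it reduces to the case a 1 = 0.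
    derivation-scalar : ∀ {a Z} → IsDerivation a Z → ∀ x → a x ≈ a 1# * x
    derivation-scalar {a} {Z} der x = -≈0⇒≈ (Normalised.vanishes der₀ (trans (+-congˡ (-‿cong (*-identityʳ (a 1#)))) (-‿inverseʳ (a 1#))) x)
      where
      open IsDerivation der
      m = a 1#
      twist : ∀ x → F (a x - m * x) ≈ F (a x) - F m * F x
      twist x = trans (F.sub-homo _ _) (+-congˡ (-‿cong (F.*-homo m x)))
      der₀ : IsDerivation (λ x → a x - m * x) (λ z → Z z - (F m + m) * z)
      der₀ = record
        { a-add = +-isAdd a-add (neg-isAdd (scale-isAdd m))
        ; Z-add = +-isAdd Z-add (neg-isAdd (scale-isAdd (F m + m)))
        ; leibniz = λ x u → comb₃ (leibniz x u) (twist x) (twist u)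
            (solve 13 (λ m m₁ x x₁ u u₁ ax φax au φau z c c′ →
              c :* u :+ (ax :- m :* x) :* u₁ :+ (x₁ :* (au :- m :* u) :+ x :* c′) :- (z :- (m₁ :+ m) :* (x₁ :* u :+ x :* u₁)) :=
              :1 :* (φax :* u :+ ax :* u₁ :+ (x₁ :* au :+ x :* φau) :- z)
              :+ u :* (c :- (φax :- m₁ :* x₁)) :+ x :* (c′ :- (φau :- m₁ :* u₁)))
              refl m (F m) x (F x) u (F u) (a x) (F (a x)) (a u) (F (a u)) (Z (x ⊛ u)) (F (a x - m * x)) (F (a u - m * u))) }

-- The commutative product on M × M and the properties of F, G, H it rests on

module Presemifield {c ℓ} (R : CommutativeRing c ℓ) where

  open import Algebra.Construct.DirectProduct using () renaming (commutativeRing to _⊗_)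

  -- The properties of the field are separated here from their arithmetic origin in p, m and k.
  -- `F⁴-fixed` is what remains of the odd order of F.
  record Setting : Set (c ⊔ ℓ) where
    open CommutativeRing R
    field
      isField : IsField R
      _≟_ : Decidable _≈_
      2≉0 : ¬ (1# + 1# ≈ 0#)
      F G H : Carrier → Carrier
      F-endo : RingTools.IsEndo R F
      G-endo : RingTools.IsEndo R G
      H≈GF : ∀ x → H x ≈ G (F x)
      FG≈GF : ∀ x → F (G x) ≈ G (F x)
      GG≈id : ∀ x → G (G x) ≈ x
      F⁴-fixed : ∀ x → F (F (F (F x))) ≈ x → F x ≈ x
      F-surjective : ∀ y → ∃ λ x → F x ≈ y
      injective⇒surjective : ∀ f → RingTools.IsAdd R f → (∀ x → f x ≈ 0# → x ≈ 0#) → ∀ y → ∃ λ x → f x ≈ y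
      q Q : ℕ
      F-pow : ∀ x → F x ≈ pow R x q
      G-pow : ∀ x → G x ≈ pow R x Q
      q≈0 : times R q 1# ≈ 0#
      g : Carrier
      g-moved : ¬ (F g ≈ g)
      ι : Carrier
      ι≉0 : ¬ (ι ≈ 0#)
      Fι≈ι : F ι ≈ ι
      Gι≈-ι : G ι ≈ - ι
      A B : Carrier
      A≉0 : ¬ (A ≈ 0#)
      B≉0 : ¬ (B ≈ 0#)
      -- the last two conditions hold because A is a non-square
      A-free : ∀ z → A * H z ≈ z → z ≈ 0#
      AB-free : ¬ (F B ≈ H A * (A * B))

  module Scalars (S : Setting) where
    open Setting S public
    open CommutativeRing R public
    open RingTools R public
    open Field isField _≟_ public
    open Derivations R isField _≟_ F F-endo F⁴-fixed g g-moved public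
      using (IsDerivation; module IsDerivation; _⊛_; derivation-scalar; module g; module F)
    module G = IsEndo G-endo

    H-endo : IsEndo H
    H-endo = record
      { isAdd = record
        { cong = λ e → trans (H≈GF _) (trans (GF.cong e) (sym (H≈GF _)))
        ; +-homo = λ x y → trans (H≈GF _) (trans (GF.+-homo x y) (sym (+-cong (H≈GF x) (H≈GF y)))) }
      ; *-homo = λ x y → trans (H≈GF _) (trans (GF.*-homo x y) (sym (*-cong (H≈GF x) (H≈GF y))))
      ; 1-homo = trans (H≈GF _) GF.1-homo }
      where module GF = IsEndo (∘-isEndo G-endo F-endo)
    module H = IsEndo H-endo

    HH≈FF : ∀ x → H (H x) ≈ F (F x)
    HH≈FF x = trans (H.cong (H≈GF x)) (trans (H≈GF _) (trans (G.cong (FG≈GF (F x))) (GG≈id _)))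

    FFg-moved : ¬ (F (F g) ≈ g)
    FFg-moved e = g.≉₂₀ (≈⇒-≈0 e)

    HHg-moved : ¬ (H (H g) ≈ g)
    HHg-moved e = FFg-moved (trans (sym (HH≈FF g)) e)

    Hι≈-ι : H ι ≈ - ι
    Hι≈-ι = trans (H≈GF ι) (trans (G.cong Fι≈ι) Gι≈-ι)

    -- If F z = - z, then F² z = z, hence F z = z by the odd order of F, and 2 z = 0.
    F+id-injective : ∀ z → 1# * F z + 1# * z ≈ 0# → z ≈ 0#
    F+id-injective z e = cancel0 2≉0 (comb₂ Fz≈z Fz≈-z
      (solve 2 (λ z f → (:1 :+ :1) :* z :- :0 := (:- :1) :* (f :- z) :+ :1 :* (f :- (:- z))) refl z (F z)))
      where
      Fz≈-z : F z ≈ - z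
      Fz≈-z = comb₁ e (solve 2 (λ z f → f :- (:- z) := :1 :* (:1 :* f :+ :1 :* z :- :0)) refl z (F z))
      FFz≈z : F (F z) ≈ z
      FFz≈z = trans (F.cong Fz≈-z) (trans (F.neg-homo z) (trans (-‿cong Fz≈-z) (solve 1 (λ z → :- (:- z) := z) refl z)))
      Fz≈z : F z ≈ z
      Fz≈z = F⁴-fixed z (trans (F.cong (F.cong FFz≈z)) FFz≈z)

    -- Since H ι = - ι, multiplying a solution of A H z = - z by ι absorbs the sign and gives a
    -- solution of A H z = z.
    AH+id-injective : ∀ z → A * H z + 1# * z ≈ 0# → z ≈ 0#
    AH+id-injective z e = cancel0 ι≉0 (A-free (ι * z) (comb₃ e (H.*-homo ι z) Hι≈-ι
      (solve 6 (λ a z h i hi hiz → a :* hiz :- i :* z :=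
        (:- i) :* (a :* h :+ :1 :* z :- :0) :+ a :* (hiz :- hi :* h) :+ (a :* h) :* (hi :- (:- i)))
        refl A z (H z) ι (H ι) (H (ι * z)))))

    -- The inverse of a nonzero solution would solve A H y = y.
    H-eigen : ∀ z → H z ≈ A * z → z ≈ 0#
    H-eigen z e with z ≟ 0#
    ... | yes z≈0 = z≈0
    ... | no z≉0 = contradiction (A-free y AHy≈y) (λ y≈0 → 1≉0 (trans (sym zy≈1) (trans (*-congˡ y≈0) (zeroʳ z))))
      where
      y = inv z z≉0
      zy≈1 = inv-r z z≉0
      AHy≈y : A * H y ≈ y
      AHy≈y = cancel z≉0 (comb₃ e (H.*-homo z y) (trans (trans (H.cong zy≈1) H.1-homo) (sym zy≈1))
        (solve 6 (λ a z y hz hy hzy → z :* (a :* hy) :- z :* y :=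
          (:- hy) :* (hz :- a :* z) :+ (:- :1) :* (hzy :- hz :* hy) :+ :1 :* (hzy :- z :* y)) refl A z y (H z) (H y) (H (z * y))))

    H+A-injective : ∀ z → 1# * H z + A * z ≈ 0# → z ≈ 0#
    H+A-injective z e = cancel0 ι≉0 (H-eigen (ι * z) (comb₃ e (H.*-homo ι z) Hι≈-ι
      (solve 6 (λ a z h i hi hiz → hiz :- a :* (i :* z) :=
        (:- i) :* (:1 :* h :+ a :* z :- :0) :+ :1 :* (hiz :- hi :* h) :+ h :* (hi :- (:- i)))
        refl A z (H z) ι (H ι) (H (ι * z)))))

  module Product (S : Setting) where
    open Scalars S public
    module V = CommutativeRing (R ⊗ R)
    module VT = RingTools (R ⊗ R)

    infixl 7 _⋆_
    _⋆_ : V.Carrier → V.Carrier → V.Carrier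
    (x , y) ⋆ (u , v) = F x * u + x * F u + B * (F y * v + y * F v) , H x * v + A * x * H v + A * H y * u + y * H u

    ⋆-comm : ∀ z w → z ⋆ w V.≈ w ⋆ z
    ⋆-comm (x , y) (u , v) =
      solve 9 (λ b x y u v fx fy fu fv → fx :* u :+ x :* fu :+ b :* (fy :* v :+ y :* fv) :=
        fu :* x :+ u :* fx :+ b :* (fv :* y :+ v :* fy)) refl B x y u v (F x) (F y) (F u) (F v) ,
      solve 9 (λ a x y u v hx hy hu hv → hx :* v :+ a :* x :* hv :+ a :* hy :* u :+ y :* hu :=
        hu :* y :+ a :* u :* hy :+ a :* hv :* x :+ v :* hx) refl A x y u v (H x) (H y) (H u) (H v)

    ⋆-cong : ∀ {z z′ w w′} → z V.≈ z′ → w V.≈ w′ → z ⋆ w V.≈ z′ ⋆ w′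
    ⋆-cong (p , q) (r , s) =
      +-cong (+-cong (*-cong (F.cong p) r) (*-cong p (F.cong r))) (*-congˡ (+-cong (*-cong (F.cong q) s) (*-cong q (F.cong s)))) ,
      +-cong (+-cong (+-cong (*-cong (H.cong p) s) (*-cong (*-congˡ p) (H.cong s))) (*-cong (*-congˡ (H.cong q)) r)) (*-cong q (H.cong r))

    ⋆-distribʳ : ∀ w z z′ → (z V.+ z′) ⋆ w V.≈ z ⋆ w V.+ z′ ⋆ w
    ⋆-distribʳ (u , v) (x , y) (x′ , y′) =
      comb₂ (F.+-homo x x′) (F.+-homo y y′)
        (solve 15 (λ b u v fu fv x y x′ y′ fx fy fx′ fy′ fxx fyy →
          fxx :* u :+ (x :+ x′) :* fu :+ b :* (fyy :* v :+ (y :+ y′) :* fv)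
          :- (fx :* u :+ x :* fu :+ b :* (fy :* v :+ y :* fv) :+ (fx′ :* u :+ x′ :* fu :+ b :* (fy′ :* v :+ y′ :* fv))) :=
          u :* (fxx :- (fx :+ fx′)) :+ (b :* v) :* (fyy :- (fy :+ fy′)))
          refl B u v (F u) (F v) x y x′ y′ (F x) (F y) (F x′) (F y′) (F (x + x′)) (F (y + y′))) ,
      comb₂ (H.+-homo x x′) (H.+-homo y y′)
        (solve 15 (λ a u v hu hv x y x′ y′ hx hy hx′ hy′ hxx hyy →
          hxx :* v :+ a :* (x :+ x′) :* hv :+ a :* hyy :* u :+ (y :+ y′) :* hu
          :- (hx :* v :+ a :* x :* hv :+ a :* hy :* u :+ y :* hu :+ (hx′ :* v :+ a :* x′ :* hv :+ a :* hy′ :* u :+ y′ :* hu)) :=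
          v :* (hxx :- (hx :+ hx′)) :+ (a :* u) :* (hyy :- (hy :+ hy′)))
          refl A u v (H u) (H v) x y x′ y′ (H x) (H y) (H x′) (H y′) (H (x + x′)) (H (y + y′)))

    -- Multiplication by (1, 0) is diagonal, with the injective blocks u ↦ F u + u and v ↦ A H v +
    -- v.
    ⋆-cancel₁ : ∀ {w w′} → (1# , 0#) ⋆ w V.≈ (1# , 0#) ⋆ w′ → w V.≈ w′
    ⋆-cancel₁ {u , v} {u′ , v′} (p , q) =
      -≈0⇒≈ (F+id-injective (u - u′) (comb₄ p F.1-homo F.0-homo (F.sub-homo u u′)
        (solve 12 (λ b u v u′ v′ fu fv fu′ fv′ o z d →
          :1 :* d :+ :1 :* (u :- u′) :- :0 :=
          :1 :* (o :* u :+ :1 :* fu :+ b :* (z :* v :+ :0 :* fv) :- (o :* u′ :+ :1 :* fu′ :+ b :* (z :* v′ :+ :0 :* fv′)))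
          :+ (u′ :- u) :* (o :- :1) :+ (b :* (v′ :- v)) :* (z :- :0) :+ :1 :* (d :- (fu :- fu′)))
          refl B u v u′ v′ (F u) (F v) (F u′) (F v′) (F 1#) (F 0#) (F (u - u′))))) ,
      -≈0⇒≈ (AH+id-injective (v - v′) (comb₄ q H.1-homo H.0-homo (H.sub-homo v v′)
        (solve 12 (λ a u v u′ v′ hu hv hu′ hv′ o z d →
          a :* d :+ :1 :* (v :- v′) :- :0 :=
          :1 :* (o :* v :+ a :* :1 :* hv :+ a :* z :* u :+ :0 :* hu :- (o :* v′ :+ a :* :1 :* hv′ :+ a :* z :* u′ :+ :0 :* hu′))
          :+ (v′ :- v) :* (o :- :1) :+ (a :* (u′ :- u)) :* (z :- :0) :+ a :* (d :- (hv :- hv′)))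
          refl A u v u′ v′ (H u) (H v) (H u′) (H v′) (H 1#) (H 0#) (H (v - v′)))))

-- Classification of self-adjoint operators, and twisted derivations

module SelfAdjointOperators {c ℓ} (R : CommutativeRing c ℓ) (S : Presemifield.Setting R) where

  open Presemifield R
  open Product S public

  Ŵ : Carrier → V.Carrier → V.Carrier
  Ŵ s (x , y) = s * x , H s * y

  split : ∀ {W} → VT.IsAdd W → ∀ x y → W (x , y) V.≈ W (x , 0#) V.+ W (0# , y)
  split W-add x y = V.trans (W.cong (sym (+-identityʳ x) , sym (+-identityˡ y))) (W.+-homo (x , 0#) (0# , y))
    where module W = VT.IsAdd W-add

  -- Moving W across the product turns additivity of W into distributivity of `⋆`, after which the
  -- factor (1, 0) cancels. No additivity has to be assumed of either operator.
  adjoint-isAdd : ∀ {W W′ : V.Carrier → V.Carrier} → (∀ z w → W z ⋆ w V.≈ z ⋆ W′ w) → VT.IsAdd W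
  adjoint-isAdd {W} {W′} adj = record
    { cong = λ {z} {z′} e → ⋆-cancel₁ (flip (W z) (W z′) (λ w → V.trans (adj z w) (V.trans (⋆-cong e (V.refl {W′ w})) (V.sym (adj z′ w)))))
    ; +-homo = λ z z′ → ⋆-cancel₁ (flip (W (z V.+ z′)) (W z V.+ W z′) (λ w → V.trans (adj (z V.+ z′) w) (V.trans (⋆-distribʳ (W′ w) z z′)
        (V.trans (V.+-cong (V.sym (adj z w)) (V.sym (adj z′ w))) (V.sym (⋆-distribʳ w (W z) (W z′))))))) }
    where
    flip : ∀ z z′ → (∀ w → z ⋆ w V.≈ z′ ⋆ w) → (1# , 0#) ⋆ z V.≈ (1# , 0#) ⋆ z′
    flip z z′ e = V.trans (⋆-comm (1# , 0#) z) (V.trans (e (1# , 0#)) (⋆-comm z′ (1# , 0#)))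

  module _ {W W′ : V.Carrier → V.Carrier} (adj : ∀ z w → W z ⋆ w V.≈ z ⋆ W′ w) where
    private
      W-add : VT.IsAdd W
      W-add = adjoint-isAdd {W} {W′} adj

      f k b d f′ k′ b′ d′ : Carrier → Carrier
      f x = proj₁ (W (x , 0#))
      k x = proj₂ (W (x , 0#))
      b y = proj₁ (W (0# , y))
      d y = proj₂ (W (0# , y))
      f′ x = proj₁ (W′ (x , 0#))
      k′ x = proj₂ (W′ (x , 0#))
      b′ y = proj₁ (W′ (0# , y))
      d′ y = proj₂ (W′ (0# , y))

      Hg-moved : ¬ (H g ≈ g)
      Hg-moved e = HHg-moved (trans (H.cong e) e)

      module f = SelfAdjointMaps.SelfAdjoint R isField _≟_ F F-endo 1# 1# 1≉0 1≉0 F+id-injective g FFg-moved f f′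
        (λ x u → comb₂ (proj₁ (adj (x , 0#) (u , 0#))) F.0-homo
          (solve 14 (λ B x u fx kx fu ku Fx Fu Ffx Fkx Ffu Fku F0 →
            :1 :* Ffx :* u :+ :1 :* fx :* Fu :- (:1 :* Fx :* fu :+ :1 :* x :* Ffu) :=
            :1 :* (Ffx :* u :+ fx :* Fu :+ B :* (Fkx :* :0 :+ kx :* F0) :- (Fx :* fu :+ x :* Ffu :+ B :* (F0 :* ku :+ :0 :* Fku)))
            :+ (B :* (ku :- kx)) :* (F0 :- :0))
            refl B x u (f x) (k x) (f′ u) (k′ u) (F x) (F u) (F (f x)) (F (k x)) (F (f′ u)) (F (k′ u)) (F 0#)))

      module k = SelfAdjointMaps.SelfAdjoint R isField _≟_ H H-endo A 1# A≉0 1≉0 AH+id-injective g HHg-moved k k′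
        (λ x u → comb₂ (proj₂ (adj (x , 0#) (u , 0#))) H.0-homo
          (solve 14 (λ A x u fx kx fu ku Hx Hu Hfx Hkx Hfu Hku H0 →
            A :* Hkx :* u :+ :1 :* kx :* Hu :- (:1 :* Hx :* ku :+ A :* x :* Hku) :=
            :1 :* (Hfx :* :0 :+ A :* fx :* H0 :+ A :* Hkx :* u :+ kx :* Hu :- (Hx :* ku :+ A :* x :* Hku :+ A :* H0 :* fu :+ :0 :* Hfu))
            :+ (A :* (fu :- fx)) :* (H0 :- :0))
            refl A x u (f x) (k x) (f′ u) (k′ u) (H x) (H u) (H (f x)) (H (k x)) (H (f′ u)) (H (k′ u)) (H 0#)))

      module b = SelfAdjointMaps.SelfAdjoint R isField _≟_ H H-endo 1# A 1≉0 A≉0 H+A-injective g HHg-moved b b′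
        (λ y v → comb₂ (proj₂ (adj (0# , y) (0# , v))) H.0-homo
          (solve 14 (λ A y v by dy bv dv Hy Hv Hby Hdy Hbv Hdv H0 →
            :1 :* Hby :* v :+ A :* by :* Hv :- (A :* Hy :* bv :+ :1 :* y :* Hbv) :=
            :1 :* (Hby :* v :+ A :* by :* Hv :+ A :* Hdy :* :0 :+ dy :* H0 :- (H0 :* dv :+ A :* :0 :* Hdv :+ A :* Hy :* bv :+ y :* Hbv))
            :+ (dv :- dy) :* (H0 :- :0))
            refl A y v (b y) (d y) (b′ v) (d′ v) (H y) (H v) (H (b y)) (H (d y)) (H (b′ v)) (H (d′ v)) (H 0#)))

      module d = SelfAdjointMaps.SelfAdjoint R isField _≟_ F F-endo 1# 1# 1≉0 1≉0 F+id-injective g FFg-moved d d′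
        (λ y v → cancel B≉0 (comb₂ (proj₁ (adj (0# , y) (0# , v))) F.0-homo
          (solve 14 (λ B y v by dy bv dv Fy Fv Fby Fdy Fbv Fdv F0 →
            B :* (:1 :* Fdy :* v :+ :1 :* dy :* Fv) :- B :* (:1 :* Fy :* dv :+ :1 :* y :* Fdv) :=
            :1 :* (Fby :* :0 :+ by :* F0 :+ B :* (Fdy :* v :+ dy :* Fv) :- (F0 :* bv :+ :0 :* Fbv :+ B :* (Fy :* dv :+ y :* Fdv)))
            :+ (bv :- by) :* (F0 :- :0))
            refl B y v (b y) (d y) (b′ v) (d′ v) (F y) (F v) (F (b y)) (F (d y)) (F (b′ v)) (F (d′ v)) (F 0#))))

      α δ : Carrier
      α = f 1#
      δ = d 1#

      -- The second component on mixed arguments (x, 0) and (0, v), the only place where the two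
      -- diagonal blocks meet.
      cross : ∀ x v → H α * H x * v + A * α * x * H v ≈ H x * δ * v + A * x * (H δ * H v)
      cross x v = trans (sym (+-cong (*-congʳ (Hf x)) (*-congʳ (trans (*-congˡ (f.scalar x)) (sym (*-assoc A α x))))))
        (trans (comb₂ (proj₂ (adj (x , 0#) (0# , v))) H.0-homo
          (solve 14 (λ A x v fx kx bv dv Hx Hv Hfx Hkx Hbv Hdv H0 →
            Hfx :* v :+ A :* fx :* Hv :- (Hx :* dv :+ A :* x :* Hdv) :=
            :1 :* (Hfx :* v :+ A :* fx :* Hv :+ A :* Hkx :* :0 :+ kx :* H0 :- (Hx :* dv :+ A :* x :* Hdv :+ A :* H0 :* bv :+ :0 :* Hbv))
            :+ (A :* bv :- kx) :* (H0 :- :0))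
            refl A x v (f x) (k x) (b′ v) (d′ v) (H x) (H v) (H (f x)) (H (k x)) (H (b′ v)) (H (d′ v)) (H 0#)))
        (+-cong (trans (*-congˡ (d.scalar′ v)) (sym (*-assoc _ _ _))) (*-congˡ (trans (H.cong (d.scalar′ v)) (H.*-homo δ v)))))
        where
        Hf : ∀ x → H (f x) ≈ H α * H x
        Hf x = trans (H.cong (f.scalar x)) (H.*-homo α x)

      -- Since g is moved by H, the cases x = g and x = 1 of `cross` separate the coefficient of H x
      -- from that of x.
      Hα≈δ : H α ≈ δ
      Hα≈δ = cancel (-≉0 Hg-moved) (comb₃ (cross g 1#) (cross 1# 1#) H.1-homo
        (solve 8 (λ A g Hg α Hα δ Hδ o → (Hg :- g) :* Hα :- (Hg :- g) :* δ :=
          :1 :* (Hα :* Hg :* :1 :+ A :* α :* g :* o :- (Hg :* δ :* :1 :+ A :* g :* (Hδ :* o)))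
          :+ (:- g) :* (Hα :* o :* :1 :+ A :* α :* :1 :* o :- (o :* δ :* :1 :+ A :* :1 :* (Hδ :* o)))
          :+ (g :* (Hα :- δ)) :* (o :- :1))
          refl A g (H g) α (H α) δ (H δ) (H 1#)))

      k≈0 : ∀ x → k x ≈ 0#
      k≈0 x = trans (k.scalar x) (trans (*-congʳ (A-free (k 1#) (trans k.eigenvalue (*-identityˡ _)))) (zeroˡ x))
      b≈0 : ∀ y → b y ≈ 0#
      b≈0 y = trans (b.scalar y) (trans (*-congʳ (H-eigen (b 1#) (trans (sym (*-identityˡ _)) b.eigenvalue))) (zeroˡ y))

    abstract
      selfAdjoint⇒Ŵ : ∃ λ s → F s ≈ s × ∀ z → W z V.≈ Ŵ s z
      selfAdjoint⇒Ŵ = α , trans (sym (*-identityˡ _)) (trans f.eigenvalue (*-identityˡ _)) , λ z → V.trans (split W-add (proj₁ z) (proj₂ z))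
        ( trans (+-cong (f.scalar (proj₁ z)) (b≈0 (proj₂ z))) (+-identityʳ _)
        , trans (+-cong (k≈0 (proj₁ z)) (d.scalar (proj₂ z))) (trans (+-identityˡ _) (*-congʳ (sym Hα≈δ))) )

  ⋆-1 : ∀ x y u → (x , y) ⋆ (u , 0#) V.≈ (x ⊛ u , A * H y * u + y * H u)
  ⋆-1 x y u =
    comb₁ F.0-homo (solve 8 (λ B x y u Fx Fy Fu F0 →
      Fx :* u :+ x :* Fu :+ B :* (Fy :* :0 :+ y :* F0) :- (Fx :* u :+ x :* Fu) := (B :* y) :* (F0 :- :0))
      refl B x y u (F x) (F y) (F u) (F 0#)) ,
    comb₁ H.0-homo (solve 8 (λ A x y u Hx Hy Hu H0 →
      Hx :* :0 :+ A :* x :* H0 :+ A :* Hy :* u :+ y :* Hu :- (A :* Hy :* u :+ y :* Hu) := (A :* x) :* (H0 :- :0))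
      refl A x y u (H x) (H y) (H u) (H 0#))

  ⋆-2 : ∀ x y v → (x , y) ⋆ (0# , v) V.≈ (B * (y ⊛ v) , H x * v + A * x * H v)
  ⋆-2 x y v =
    comb₁ F.0-homo (solve 8 (λ B x y v Fx Fy Fv F0 →
      Fx :* :0 :+ x :* F0 :+ B :* (Fy :* v :+ y :* Fv) :- B :* (Fy :* v :+ y :* Fv) := x :* (F0 :- :0))
      refl B x y v (F x) (F y) (F v) (F 0#)) ,
    comb₁ H.0-homo (solve 8 (λ A x y v Hx Hy Hv H0 →
      Hx :* v :+ A :* x :* Hv :+ A :* Hy :* :0 :+ y :* H0 :- (Hx :* v :+ A :* x :* Hv) := y :* (H0 :- :0))
      refl A x y v (H x) (H y) (H v) (H 0#))

  ⊛-comm : ∀ x u → x ⊛ u ≈ u ⊛ x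
  ⊛-comm x u = solve 4 (λ x u Fx Fu → Fx :* u :+ x :* Fu := Fu :* x :+ u :* Fx) refl x u (F x) (F u)

  HG≈F : ∀ x → H (G x) ≈ F x
  HG≈F x = trans (H≈GF (G x)) (trans (G.cong (FG≈GF x)) (GG≈id (F x)))

  GH≈F : ∀ x → G (H x) ≈ F x
  GH≈F x = trans (G.cong (H≈GF x)) (GG≈id (F x))

  FG≈H : ∀ x → F (G x) ≈ H x
  FG≈H x = trans (FG≈GF x) (sym (H≈GF x))

  derivation⇒scalar : ∀ {a Z} → IsDerivation a Z → ∀ x → a x ≈ a 1# * x
  derivation⇒scalar = derivation-scalar 2≉0 F-surjective q F-pow q≈0

  -- Replacing x by κ x separates the a₁- and a₂-parts of the rule, after which x ↦ k (G x) is a derivation of ⊛.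
  module Twisted {κ : Carrier} (κ≉0 : ¬ (κ ≈ 0#)) (Fκ≈κ : F κ ≈ κ) (Gκ≈-κ : G κ ≈ - κ) where

    Hκ≈-κ : H κ ≈ - κ
    Hκ≈-κ = trans (H≈GF κ) (trans (G.cong Fκ≈κ) Gκ≈-κ)

    module _ {a₁ a₂ : Carrier} (a₁≉0 : ¬ (a₁ ≈ 0#)) (a₂≉0 : ¬ (a₂ ≈ 0#))
      {k Z : Carrier → Carrier} (k-add : IsAdd k) (Z-add : IsAdd Z)
      (odd : ∀ x → k (κ * x) ≈ - (κ * k x))
      (leibniz : ∀ x u → a₁ * (H (k x) * u + H (k u) * x) + a₂ * (k x * H u + k u * H x) ≈ Z (x ⊛ u))
      where
      private
        module k = IsAdd k-add
        module Z = IsAdd Z-add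
        L₁ L₂ : Carrier → Carrier → Carrier
        L₁ x u = H (k x) * u + H (k u) * x
        L₂ x u = k x * H u + k u * H x

        -- Under x ↦ κ x the form `L₁` is multiplied by κ and `L₂` by - κ: in H (k (κ x)) the sign
        -- of `odd` cancels against H κ = - κ, whereas k (κ x) and H (κ x) each keep a single sign.
        shifted : ∀ x u → κ * (a₁ * L₁ x u) - κ * (a₂ * L₂ x u) ≈ Z (κ * (x ⊛ u))
        shifted x u = trans (comb₃ (trans (H.cong (odd x)) (trans (H.neg-homo _) (-‿cong (trans (H.*-homo κ (k x)) (*-congʳ Hκ≈-κ))))) (odd x)
          (trans (H.*-homo κ x) (*-congʳ Hκ≈-κ))
          (solve 14 (λ a₁ a₂ κ x u kx ku Hkx Hku Hx Hu Hkκx kκx Hκx →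
            κ :* (a₁ :* (Hkx :* u :+ Hku :* x)) :- κ :* (a₂ :* (kx :* Hu :+ ku :* Hx))
            :- (a₁ :* (Hkκx :* u :+ Hku :* (κ :* x)) :+ a₂ :* (kκx :* Hu :+ ku :* Hκx)) :=
            (:- (a₁ :* u)) :* (Hkκx :- (:- ((:- κ) :* Hkx))) :+ (:- (a₂ :* Hu)) :* (kκx :- (:- (κ :* kx)))
            :+ (:- (a₂ :* ku)) :* (Hκx :- (:- κ) :* Hx))
            refl a₁ a₂ κ x u (k x) (k u) (H (k x)) (H (k u)) (H x) (H u) (H (k (κ * x))) (k (κ * x)) (H (κ * x))))
          (trans (leibniz (κ * x) u) (Z.cong (comb₂ (F.*-homo κ x) Fκ≈κ
            (solve 7 (λ κ Fκ x u Fx Fu Fκx → Fκx :* u :+ κ :* x :* Fu :- κ :* (Fx :* u :+ x :* Fu) :=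
              u :* (Fκx :- Fκ :* Fx) :+ (Fx :* u) :* (Fκ :- κ)) refl κ (F κ) x u (F x) (F u) (F (κ * x))))))

        2κ : Carrier
        2κ = (1# + 1#) * κ
        2κ≉0 : ¬ (2κ ≈ 0#)
        2κ≉0 = *-≉0 2≉0 κ≉0
        n₁ n₂ : Carrier
        n₁ = inv (2κ * a₁) (*-≉0 2κ≉0 a₁≉0)
        n₂ = inv (2κ * a₂) (*-≉0 2κ≉0 a₂≉0)

        Z⁺ Z⁻ : Carrier → Carrier
        Z⁺ z = n₁ * (κ * Z z + Z (κ * z))
        Z⁻ z = n₂ * (κ * Z z + - Z (κ * z))

        L₁≈ : ∀ x u → L₁ x u ≈ Z⁺ (x ⊛ u)
        L₁≈ x u = cancel (*-≉0 2κ≉0 a₁≉0) (comb₃ (leibniz x u) (shifted x u) (inv-r (2κ * a₁) (*-≉0 2κ≉0 a₁≉0))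
          (solve 8 (λ κ a₁ a₂ l₁ l₂ n z z′ →
            (:1 :+ :1) :* κ :* a₁ :* l₁ :- (:1 :+ :1) :* κ :* a₁ :* (n :* (κ :* z :+ z′)) :=
            κ :* (a₁ :* l₁ :+ a₂ :* l₂ :- z) :+ :1 :* (κ :* (a₁ :* l₁) :- κ :* (a₂ :* l₂) :- z′)
            :+ (:- (κ :* z :+ z′)) :* ((:1 :+ :1) :* κ :* a₁ :* n :- :1))
            refl κ a₁ a₂ (L₁ x u) (L₂ x u) n₁ (Z (x ⊛ u)) (Z (κ * (x ⊛ u)))))

        L₂≈ : ∀ x u → L₂ x u ≈ Z⁻ (x ⊛ u)
        L₂≈ x u = cancel (*-≉0 2κ≉0 a₂≉0) (comb₃ (leibniz x u) (shifted x u) (inv-r (2κ * a₂) (*-≉0 2κ≉0 a₂≉0))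
          (solve 8 (λ κ a₁ a₂ l₁ l₂ n z z′ →
            (:1 :+ :1) :* κ :* a₂ :* l₂ :- (:1 :+ :1) :* κ :* a₂ :* (n :* (κ :* z :+ :- z′)) :=
            κ :* (a₁ :* l₁ :+ a₂ :* l₂ :- z) :+ (:- :1) :* (κ :* (a₁ :* l₁) :- κ :* (a₂ :* l₂) :- z′)
            :+ (:- (κ :* z :+ :- z′)) :* ((:1 :+ :1) :* κ :* a₂ :* n :- :1))
            refl κ a₁ a₂ (L₁ x u) (L₂ x u) n₂ (Z (x ⊛ u)) (Z (κ * (x ⊛ u)))))

        Z⁺-add : IsAdd Z⁺
        Z⁺-add = *-isAdd n₁ (+-isAdd (*-isAdd κ Z-add) (∘-isAdd Z-add (scale-isAdd κ)))
        Z⁻-add : IsAdd Z⁻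
        Z⁻-add = *-isAdd n₂ (+-isAdd (*-isAdd κ Z-add) (neg-isAdd (∘-isAdd Z-add (scale-isAdd κ))))

        ⊛-G : ∀ x u → G x ⊛ G u ≈ G (x ⊛ u)
        ⊛-G x u = sym (trans (G.+-homo _ _) (+-cong
          (trans (G.*-homo _ _) (*-congʳ (sym (FG≈GF x)))) (trans (G.*-homo _ _) (*-congˡ (sym (FG≈GF u))))))

        -- Substituting G x and G u, the image of `L₁` under G contributes the terms containing F (k
        -- (G x)), by G H = F, and `L₂` contributes those containing F x and F u, by H G = F.
        -- Together they form the Leibniz rule of `⊛`.
        der : IsDerivation (λ x → k (G x)) (λ z → G (Z⁺ (G z)) + Z⁻ (G z))
        der = record
          { a-add = ∘-isAdd k-add G.isAdd
          ; Z-add = +-isAdd (∘-isAdd G.isAdd (∘-isAdd Z⁺-add G.isAdd)) (∘-isAdd Z⁻-add G.isAdd)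
          ; leibniz = λ x u → trans
              (solve 8 (λ x u Fx Fu kx ku Fkx Fku →
                Fkx :* u :+ kx :* Fu :+ (Fx :* ku :+ x :* Fku) := Fkx :* u :+ Fku :* x :+ (kx :* Fu :+ ku :* Fx))
                refl x u (F x) (F u) (k (G x)) (k (G u)) (F (k (G x))) (F (k (G u))))
              (+-cong
                (trans (sym (trans (G.+-homo _ _) (+-cong (conj x u) (conj u x))))
                  (G.cong (trans (L₁≈ (G x) (G u)) (IsAdd.cong Z⁺-add (⊛-G x u)))))
                (trans (+-cong (*-congˡ (sym (HG≈F u))) (*-congˡ (sym (HG≈F x))))
                  (trans (L₂≈ (G x) (G u)) (IsAdd.cong Z⁻-add (⊛-G x u))))) }
          where
          conj : ∀ x u → G (H (k (G x)) * G u) ≈ F (k (G x)) * u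
          conj x u = trans (G.*-homo _ _) (*-cong (GH≈F _) (GG≈id u))

      twisted-scalar : ∀ x → k x ≈ k 1# * G x
      twisted-scalar x = trans (k.cong (sym (GG≈id x))) (trans (derivation⇒scalar der (G x)) (*-congʳ (k.cong G.1-homo)))

-- Derivations of the product that commute with diag(κ, - κ) are diagonal

module DiagonalDerivations {c ℓ} (R : CommutativeRing c ℓ) (S : Presemifield.Setting R) where

  open SelfAdjointOperators R S
  open import Algebra.Properties.Ring ring using (-‿involutive; -‿injective)

  -- The pairs (x, g) and (x H g, 1) have the same right-hand side, while the arguments of Z differ
  -- by H x (H² g - g). So Z vanishes on all multiples of a nonzero element by values of the
  -- surjective H, hence everywhere; then ε₁ y + ε₂ G y = 0 at y = 1 and y = ι gives both claims.
  ε-vanish : ∀ {ε₁ ε₂} {Z : Carrier → Carrier} → IsAdd Z →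
    (∀ x v → Z (H x * v + A * x * H v) ≈ ε₁ * (x * H v) + ε₂ * (G x * F v)) → ε₁ ≈ 0# × ε₂ ≈ 0#
  ε-vanish {ε₁} {ε₂} {Z} Z-add Z-g = ε₁≈0 , comb₂ N1 ε₁≈0 (solve 2 (λ a b → b :- :0 := :1 :* (a :+ b :- :0) :+ (:- :1) :* (a :- :0)) refl ε₁ ε₂)
    where
    module Z = IsAdd Z-add
    θ : Carrier
    θ = H (H g) - g
    Z-g₁ : ∀ y → Z (H y + A * y) ≈ ε₁ * y + ε₂ * G y
    Z-g₁ y = trans (Z.cong (comb₁ H.1-homo (solve 4 (λ a y Hy o → Hy :+ a :* y :- (Hy :* :1 :+ a :* y :* o) := (:- (a :* y)) :* (o :- :1)) refl A y (H y) (H 1#))))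
      (trans (Z-g y 1#) (comb₂ H.1-homo F.1-homo (solve 6 (λ a b y Gy h f → a :* (y :* h) :+ b :* (Gy :* f) :- (a :* y :+ b :* Gy) :=
        (a :* y) :* (h :- :1) :+ (b :* Gy) :* (f :- :1)) refl ε₁ ε₂ y (G y) (H 1#) (F 1#))))
    Z-image : ∀ x → Z (H x * θ) ≈ 0#
    Z-image x = trans (Z.cong (comb₁ (H.*-homo x (H g))
        (solve 7 (λ a x g Hx Hg HHg h → Hx :* (HHg :- g) :- (h :+ a :* (x :* Hg) :- (Hx :* g :+ a :* x :* Hg)) := (:- :1) :* (h :- Hx :* HHg))
          refl A x g (H x) (H g) (H (H g)) (H (x * H g)))))
      (trans (Z.sub-homo _ _) (≈⇒-≈0 (trans (Z-g₁ (x * H g))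
        (trans (+-congˡ (*-congˡ (trans (G.*-homo _ _) (*-congˡ (GH≈F g))))) (sym (Z-g x g))))))
    H-surjective : ∀ z → ∃ λ x → H x ≈ z
    H-surjective z with F-surjective (G z)
    ... | x , Fx≈Gz = x , trans (H≈GF x) (trans (G.cong Fx≈Gz) (GG≈id z))
    Z≈0 : ∀ z → Z z ≈ 0#
    Z≈0 z with H-surjective (z * inv θ (-≉0 HHg-moved))
    ... | x , Hx≈ = trans (Z.cong (comb₂ Hx≈ (inv-r θ (-≉0 HHg-moved))
      (solve 4 (λ z t i h → z :- h :* t := (:- t) :* (h :- z :* i) :+ (:- z) :* (t :* i :- :1)) refl z θ (inv θ (-≉0 HHg-moved)) (H x)))) (Z-image x)
    N : ∀ y → ε₁ * y + ε₂ * G y ≈ 0#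
    N y = trans (sym (Z-g₁ y)) (Z≈0 _)
    N1 : ε₁ + ε₂ ≈ 0#
    N1 = comb₂ (N 1#) G.1-homo (solve 3 (λ a b o → a :+ b :- :0 := :1 :* (a :* :1 :+ b :* o :- :0) :+ (:- b) :* (o :- :1)) refl ε₁ ε₂ (G 1#))
    ε₁≈0 : ε₁ ≈ 0#
    ε₁≈0 = cancel0 (*-≉0 2≉0 ι≉0) (comb₃ (N ι) Gι≈-ι N1
      (solve 4 (λ a b i Gi → (:1 :+ :1) :* i :* a :- :0 := :1 :* (a :* i :+ b :* Gi :- :0) :+ (:- b) :* (Gi :- (:- i)) :+ i :* (a :+ b :- :0))
        refl ε₁ ε₂ ι (G ι)))

  -- Commuting with `Ŵ κ` makes the off-diagonal blocks anticommute with κ, which is the hypothesis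
  -- `odd` under which they become derivations of `⊛`.
  module _ {P Z : V.Carrier → V.Carrier} (P-add : VT.IsAdd P) (Z-add : VT.IsAdd Z)
    (leibniz : ∀ z w → P z ⋆ w V.+ z ⋆ P w V.≈ Z (z ⋆ w))
    {κ : Carrier} (κ≉0 : ¬ (κ ≈ 0#)) (Fκ≈κ : F κ ≈ κ) (Gκ≈-κ : G κ ≈ - κ)
    (P-Ŵ : ∀ z → P (Ŵ κ z) V.≈ Ŵ κ (P z)) where
    open Twisted κ≉0 Fκ≈κ Gκ≈-κ
    private
      module P = VT.IsAdd P-add
      module Z = VT.IsAdd Z-add
      a k b d Z₁₁ Z₁₂ : Carrier → Carrier
      a x = proj₁ (P (x , 0#))
      k x = proj₂ (P (x , 0#))
      b y = proj₁ (P (0# , y))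
      d y = proj₂ (P (0# , y))
      Z₁₁ z = proj₁ (Z (z , 0#))
      Z₁₂ z = proj₁ (Z (0# , z))

      component : ∀ {T} (f : V.Carrier → Carrier) (h : Carrier → V.Carrier) →
        (∀ {z w} → z V.≈ w → f z ≈ f w) → (∀ z w → f (z V.+ w) ≈ f z + f w) →
        (∀ {x y} → x ≈ y → h x V.≈ h y) → (∀ x y → h (x + y) V.≈ h x V.+ h y) →
        VT.IsAdd T → IsAdd (λ x → f (T (h x)))
      component f h f-cong f-+ h-cong h-+ T-add = record
        { cong = λ e → f-cong (T.cong (h-cong e))
        ; +-homo = λ x y → trans (f-cong (V.trans (T.cong (h-+ x y)) (T.+-homo _ _))) (f-+ _ _) }
        where module T = VT.IsAdd T-add

      inl inr : Carrier → V.Carrier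
      inl x = x , 0#
      inr y = 0# , y

      ₁₁-add : ∀ {T} → VT.IsAdd T → IsAdd (λ x → proj₁ (T (x , 0#)))
      ₁₁-add = component proj₁ inl proj₁ (λ _ _ → refl) (_, refl) (λ _ _ → refl , sym (+-identityˡ 0#))
      ₂₁-add : ∀ {T} → VT.IsAdd T → IsAdd (λ x → proj₂ (T (x , 0#)))
      ₂₁-add = component proj₂ inl proj₂ (λ _ _ → refl) (_, refl) (λ _ _ → refl , sym (+-identityˡ 0#))
      ₁₂-add : ∀ {T} → VT.IsAdd T → IsAdd (λ x → proj₁ (T (0# , x)))
      ₁₂-add = component proj₁ inr proj₁ (λ _ _ → refl) (refl ,_) (λ _ _ → sym (+-identityˡ 0#) , refl)
      ₂₂-add : ∀ {T} → VT.IsAdd T → IsAdd (λ x → proj₂ (T (0# , x)))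
      ₂₂-add = component proj₂ inr proj₂ (λ _ _ → refl) (refl ,_) (λ _ _ → sym (+-identityˡ 0#) , refl)

      leibniz₁₁ : ∀ x u → (a x ⊛ u , A * H (k x) * u + k x * H u) V.+ (a u ⊛ x , A * H (k u) * x + k u * H x) V.≈ Z (x ⊛ u , 0#)
      leibniz₁₁ x u = V.trans
        (V.sym (V.+-cong (⋆-1 (a x) (k x) u) (V.trans (⋆-comm (x , 0#) (P (u , 0#))) (⋆-1 (a u) (k u) x))))
        (V.trans (leibniz (x , 0#) (u , 0#)) (Z.cong (V.trans (⋆-1 x 0# u) (refl ,
          comb₁ H.0-homo (solve 4 (λ A u Hu h → A :* h :* u :+ :0 :* Hu :- :0 := (A :* u) :* (h :- :0)) refl A u (H u) (H 0#))))))

      leibniz₂₂ : ∀ y v → (B * (d y ⊛ v) , H (b y) * v + A * b y * H v) V.+ (B * (d v ⊛ y) , H (b v) * y + A * b v * H y) V.≈ Z (B * (y ⊛ v) , 0#)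
      leibniz₂₂ y v = V.trans
        (V.sym (V.+-cong (⋆-2 (b y) (d y) v) (V.trans (⋆-comm (0# , y) (P (0# , v))) (⋆-2 (b v) (d v) y))))
        (V.trans (leibniz (0# , y) (0# , v)) (Z.cong (V.trans (⋆-2 0# y v) (refl ,
          comb₁ H.0-homo (solve 4 (λ A v Hv h → h :* v :+ A :* :0 :* Hv :- :0 := v :* (h :- :0)) refl A v (H v) (H 0#))))))

      leibniz₁₂ : ∀ x v → B * (k x ⊛ v) + b v ⊛ x ≈ Z₁₂ (H x * v + A * x * H v)
      leibniz₁₂ x v = proj₁ (V.trans
        (V.sym (V.+-cong (⋆-2 (a x) (k x) v) (V.trans (⋆-comm (x , 0#) (P (0# , v))) (⋆-1 (b v) (d v) x))))
        (V.trans (leibniz (x , 0#) (0# , v)) (Z.cong (V.trans (⋆-2 x 0# v) (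
          comb₁ F.0-homo (solve 4 (λ B v Fv f → B :* (f :* v :+ :0 :* Fv) :- :0 := (B :* v) :* (f :- :0)) refl B v (F v) (F 0#)) , refl)))))

      a-scalar : ∀ x → a x ≈ a 1# * x
      a-scalar = derivation⇒scalar record
        { a-add = ₁₁-add P-add ; Z-add = ₁₁-add Z-add
        ; leibniz = λ x u → trans (+-congˡ (⊛-comm x (a u))) (proj₁ (leibniz₁₁ x u)) }

      d-scalar : ∀ y → d y ≈ d 1# * y
      d-scalar = derivation⇒scalar record
        { a-add = ₂₂-add P-add ; Z-add = *-isAdd (inv B B≉0) (∘-isAdd (₁₁-add Z-add) (scale-isAdd B))
        ; leibniz = λ y v → cancel B≉0 (comb₃ (proj₁ (leibniz₂₂ y v)) (⊛-comm y (d v)) (inv-r B B≉0)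
            (solve 6 (λ B i z e f f′ → B :* (e :+ f′) :- B :* (i :* z) :=
              :1 :* (B :* e :+ B :* f :- z) :+ B :* (f′ :- f) :+ (:- z) :* (B :* i :- :1))
              refl B (inv B B≉0) (Z₁₁ (B * (y ⊛ v))) (d y ⊛ v) (d v ⊛ y) (y ⊛ d v))) }

      Ŵ-inl : ∀ x → Ŵ κ (x , 0#) V.≈ (κ * x , 0#)
      Ŵ-inl x = refl , zeroʳ _
      Ŵ-inr : ∀ y → Ŵ κ (0# , y) V.≈ (0# , - (κ * y))
      Ŵ-inr y = zeroʳ _ , comb₁ Hκ≈-κ (solve 3 (λ k h y → h :* y :- (:- (k :* y)) := y :* (h :- (:- k))) refl κ (H κ) y)

      k-scalar : ∀ x → k x ≈ k 1# * G x
      k-scalar = twisted-scalar A≉0 1≉0 (₂₁-add P-add) (₂₁-add Z-add)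
        (λ x → trans (proj₂ (V.trans (P.cong (V.sym (Ŵ-inl x))) (P-Ŵ (x , 0#))))
          (comb₁ Hκ≈-κ (solve 3 (λ k h y → h :* y :- (:- (k :* y)) := y :* (h :- (:- k))) refl κ (H κ) (k x))))
        (λ x u → trans (solve 9 (λ A x u Hx Hu kx ku Hkx Hku →
            A :* (Hkx :* u :+ Hku :* x) :+ :1 :* (kx :* Hu :+ ku :* Hx) := A :* Hkx :* u :+ kx :* Hu :+ (A :* Hku :* x :+ ku :* Hx))
            refl A x u (H x) (H u) (k x) (k u) (H (k x)) (H (k u)))
          (proj₂ (leibniz₁₁ x u)))

      b-scalar : ∀ x → b x ≈ b 1# * G x
      b-scalar = twisted-scalar 1≉0 A≉0 (₁₂-add P-add) (∘-isAdd (₂₁-add Z-add) (scale-isAdd B))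
        (λ y → -‿injective (trans (sym (IsAdd.neg-homo (₁₂-add P-add) (κ * y)))
          (trans (proj₁ (V.trans (P.cong (V.sym (Ŵ-inr y))) (P-Ŵ (0# , y)))) (sym (-‿involutive _)))))
        (λ x u → trans (solve 9 (λ A x u Hx Hu kx ku Hkx Hku →
            :1 :* (Hkx :* u :+ Hku :* x) :+ A :* (kx :* Hu :+ ku :* Hx) := Hkx :* u :+ A :* kx :* Hu :+ (Hku :* x :+ A :* ku :* Hx))
            refl A x u (H x) (H u) (b x) (b u) (H (b x)) (H (b u)))
          (proj₂ (leibniz₂₂ x u)))

      β γ : Carrier
      β = b 1#
      γ = k 1#

      -- On mixed arguments k and b contribute four terms. Subtracting z ↦ B F γ z + β G z absorbs
      -- those in H x v and F x G v, and the rest has the shape required by `ε-vanish`.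
      Z₀ : Carrier → Carrier
      Z₀ z = Z₁₂ z + - (B * F γ * z + β * G z)

      Fscaled : ∀ {f s x} → f ≈ s * G x → F f ≈ F s * H x
      Fscaled {x = x} e = trans (F.cong e) (trans (F.*-homo _ _) (*-congˡ (FG≈H x)))

      G-g : ∀ x v → G (H x * v + A * x * H v) ≈ F x * G v + G A * G x * F v
      G-g x v = trans (G.+-homo _ _) (+-cong (trans (G.*-homo _ _) (*-congʳ (GH≈F x)))
        (trans (G.*-homo _ _) (*-cong (G.*-homo A x) (GH≈F v))))

      ε : F β - A * B * F γ ≈ 0# × B * γ - G A * β ≈ 0#
      ε = ε-vanish {Z = Z₀} (+-isAdd (₁₂-add Z-add) (neg-isAdd (+-isAdd (scale-isAdd (B * F γ)) (*-isAdd β G.isAdd)))) λ x v →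
        comb₄ (leibniz₁₂ x v)
          (+-cong (*-congʳ {v} (Fscaled (k-scalar x))) (*-congʳ {F v} (k-scalar x)))
          (+-cong (*-congʳ {x} (Fscaled (b-scalar v))) (*-congʳ {F x} (b-scalar v)))
          (G-g x v)
          (solve 21 (λ A GA B β Fβ γ Fγ x v Gx Gv Fx Fv Hx Hv z kx bv Fkx Fbv Gg →
            z :+ :- (B :* Fγ :* (Hx :* v :+ A :* x :* Hv) :+ β :* Gg) :- ((Fβ :- A :* B :* Fγ) :* (x :* Hv) :+ (B :* γ :- GA :* β) :* (Gx :* Fv)) :=
            (:- :1) :* (B :* (Fkx :* v :+ kx :* Fv) :+ (Fbv :* x :+ bv :* Fx) :- z)
            :+ B :* (Fkx :* v :+ kx :* Fv :- (Fγ :* Hx :* v :+ γ :* Gx :* Fv))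
            :+ :1 :* (Fbv :* x :+ bv :* Fx :- (Fβ :* Hv :* x :+ β :* Gv :* Fx))
            :+ (:- β) :* (Gg :- (Fx :* Gv :+ GA :* Gx :* Fv)))
            refl A (G A) B β (F β) γ (F γ) x v (G x) (G v) (F x) (F v) (H x) (H v) (Z₁₂ (H x * v + A * x * H v)) (k x) (b v) (F (k x)) (F (b v)) (G (H x * v + A * x * H v)))

      GA≉0 : ¬ (G A ≈ 0#)
      GA≉0 = endo-≉0 G-endo A≉0

      -- Applying F to B γ = G A β and inserting F β = A B F γ gives F B F γ = H A A B F γ, and F γ
      -- would cancel.
      γ≈0 : γ ≈ 0#
      γ≈0 with γ ≟ 0#
      ... | yes e = e
      ... | no γ≉0 = contradiction (cancel (endo-≉0 F-endo γ≉0) (comb₃ (trans (sym (F.*-homo B γ)) (F.cong (-≈0⇒≈ (proj₂ ε))))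
        (trans (F.*-homo (G A) β) (*-congʳ (FG≈H A))) (-≈0⇒≈ (proj₁ ε))
        (solve 7 (λ A B HA FB Fγ Fβ f → Fγ :* FB :- Fγ :* (HA :* (A :* B)) :=
          :1 :* (FB :* Fγ :- f) :+ :1 :* (f :- HA :* Fβ) :+ HA :* (Fβ :- A :* B :* Fγ))
          refl A B (H A) (F B) (F γ) (F β) (F (G A * β))))) AB-free

      β≈0 : β ≈ 0#
      β≈0 = cancel0 GA≉0 (trans (sym (-≈0⇒≈ (proj₂ ε))) (trans (*-congˡ γ≈0) (zeroʳ B)))

    abstract
      derivation⇒diagonal : ∃ λ s → ∃ λ t → ∀ z → P z V.≈ (s * proj₁ z , t * proj₂ z)
      derivation⇒diagonal = a 1# , d 1# , λ { (x , y) → V.trans (split P-add x y)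
        ( trans (+-cong (a-scalar x) (trans (b-scalar y) (trans (*-congʳ β≈0) (zeroˡ _)))) (+-identityʳ _)
        , trans (+-cong (trans (k-scalar x) (trans (*-congʳ γ≈0) (zeroˡ _))) (d-scalar y)) (+-identityˡ _) ) }

-- Conjugation of operators by an autotopism

module Autotopisms {c ℓ} (R : CommutativeRing c ℓ) (S : Presemifield.Setting R) where

  open SelfAdjointOperators R S
  open DiagonalDerivations R S
  open import Algebra.Properties.Ring ring using (-‿distribˡ-*; -‿distribʳ-*)

  infixr 8 _•_
  _•_ : Carrier → V.Carrier → V.Carrier
  s • (x , y) = s * x , s * y

  •-cong : ∀ {s t z w} → s ≈ t → z V.≈ w → s • z V.≈ t • w
  •-cong e (p , q) = *-cong e p , *-cong e q

  •-add : ∀ s → VT.IsAdd (s •_)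
  •-add s = record { cong = •-cong refl ; +-homo = λ _ _ → distribˡ s _ _ , distribˡ s _ _ }

  e₁ e₂ : V.Carrier
  e₁ = 1# , 0#
  e₂ = 0# , 1#

  Ŵ-cong : ∀ {s t z w} → s ≈ t → z V.≈ w → Ŵ s z V.≈ Ŵ t w
  Ŵ-cong e (p , q) = *-cong e p , *-cong (H.cong e) q

  Ŵ-add : ∀ s → VT.IsAdd (Ŵ s)
  Ŵ-add s = record { cong = Ŵ-cong refl ; +-homo = λ _ _ → distribˡ s _ _ , distribˡ (H s) _ _ }

  Ŵ-* : ∀ s t z → Ŵ (s * t) z V.≈ Ŵ s (Ŵ t z)
  Ŵ-* s t z = *-assoc s t _ , trans (*-congʳ (H.*-homo s t)) (*-assoc _ _ _)

  Ŵ-neg : ∀ s z → Ŵ (- s) z V.≈ V.- Ŵ s z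
  Ŵ-neg s z = sym (-‿distribˡ-* s _) , trans (*-congʳ (H.neg-homo s)) (sym (-‿distribˡ-* (H s) _))

  Ŵ-injective : ∀ {s t} → (∀ z → Ŵ s z V.≈ Ŵ t z) → s ≈ t
  Ŵ-injective {s} {t} e = trans (sym (*-identityʳ s)) (trans (proj₁ (e (1# , 0#))) (*-identityʳ t))

  Ŵ-• : ∀ s t z → Ŵ s (t • z) V.≈ t • Ŵ s z
  Ŵ-• s t z = comm s _ , comm (H s) _
    where
    comm : ∀ a x → a * (t * x) ≈ t * (a * x)
    comm a x = solve 3 (λ a t x → a :* (t :* x) := t :* (a :* x)) refl a t x

  -- The scalar s on the first coordinate has to be paired with H s on the second because the second
  -- component of `⋆` mixes the coordinates through H; the pairing is consistent as H² s = F² s = s.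
  Ŵ-adjoint : ∀ {s} → F s ≈ s → ∀ z w → Ŵ s z ⋆ w V.≈ z ⋆ Ŵ s w
  Ŵ-adjoint {s} Fs≈s (x , y) (u , v) =
    comb₄ (Fs* x) (Fs* u) (Ft* y) (Ft* v)
      (solve 15 (λ B s t x y u v Fx Fy Fu Fv Fsx Fsu Fty Ftv →
        Fsx :* u :+ s :* x :* Fu :+ B :* (Fty :* v :+ t :* y :* Fv) :- (Fx :* (s :* u) :+ x :* Fsu :+ B :* (Fy :* (t :* v) :+ y :* Ftv)) :=
        u :* (Fsx :- s :* Fx) :+ (:- x) :* (Fsu :- s :* Fu) :+ (B :* v) :* (Fty :- t :* Fy) :+ (:- (B :* y)) :* (Ftv :- t :* Fv))
        refl B s t x y u v (F x) (F y) (F u) (F v) (F (s * x)) (F (s * u)) (F (t * y)) (F (t * v))) ,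
    comb₄ (H.*-homo s x) (Ht* v) (Ht* y) (H.*-homo s u)
      (solve 15 (λ A s t x y u v Hx Hy Hu Hv Hsx Hsu Hty Htv →
        Hsx :* v :+ A :* (s :* x) :* Hv :+ A :* Hty :* u :+ t :* y :* Hu :- (Hx :* (t :* v) :+ A :* x :* Htv :+ A :* Hy :* (s :* u) :+ y :* Hsu) :=
        v :* (Hsx :- t :* Hx) :+ (:- (A :* x)) :* (Htv :- s :* Hv) :+ (A :* u) :* (Hty :- s :* Hy) :+ (:- y) :* (Hsu :- t :* Hu))
        refl A s t x y u v (H x) (H y) (H u) (H v) (H (s * x)) (H (s * u)) (H (t * y)) (H (t * v)))
    where
    t : Carrier
    t = H s
    Ft≈t : F t ≈ t
    Ft≈t = trans (F.cong (H≈GF s)) (trans (FG≈GF (F s)) (trans (G.cong (F.cong Fs≈s)) (sym (H≈GF s))))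
    Fs* : ∀ x → F (s * x) ≈ s * F x
    Fs* x = trans (F.*-homo s x) (*-congʳ Fs≈s)
    Ft* : ∀ x → F (t * x) ≈ t * F x
    Ft* x = trans (F.*-homo t x) (*-congʳ Ft≈t)
    Ht* : ∀ x → H (t * x) ≈ s * H x
    Ht* x = trans (H.*-homo t x) (*-congʳ (trans (HH≈FF s) (trans (F.cong Fs≈s) Fs≈s)))

  •-⋆ : ∀ {s} → F s ≈ s → H s ≈ s → ∀ z w → (s • z) ⋆ w V.≈ s • (z ⋆ w)
  •-⋆ {s} Fs≈s Hs≈s (x , y) (u , v) =
    comb₂ (trans (F.*-homo s x) (*-congʳ Fs≈s)) (trans (F.*-homo s y) (*-congʳ Fs≈s))
      (solve 12 (λ B s x y u v Fx Fy Fu Fv Fsx Fsy →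
        Fsx :* u :+ s :* x :* Fu :+ B :* (Fsy :* v :+ s :* y :* Fv) :- s :* (Fx :* u :+ x :* Fu :+ B :* (Fy :* v :+ y :* Fv)) :=
        u :* (Fsx :- s :* Fx) :+ (B :* v) :* (Fsy :- s :* Fy))
        refl B s x y u v (F x) (F y) (F u) (F v) (F (s * x)) (F (s * y))) ,
    comb₂ (trans (H.*-homo s x) (*-congʳ Hs≈s)) (trans (H.*-homo s y) (*-congʳ Hs≈s))
      (solve 12 (λ A s x y u v Hx Hy Hu Hv Hsx Hsy →
        Hsx :* v :+ A :* (s :* x) :* Hv :+ A :* Hsy :* u :+ s :* y :* Hu :- s :* (Hx :* v :+ A :* x :* Hv :+ A :* Hy :* u :+ y :* Hu) :=
        v :* (Hsx :- s :* Hx) :+ (A :* u) :* (Hsy :- s :* Hy))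
        refl A s x y u v (H x) (H y) (H u) (H v) (H (s * x)) (H (s * y)))

  Zι : V.Carrier → V.Carrier
  Zι z = (1# + 1#) * ι * proj₁ z , 0#

  Zι-add : VT.IsAdd Zι
  Zι-add = record
    { cong = λ e → *-congˡ (proj₁ e) , refl
    ; +-homo = λ _ _ → distribˡ _ _ _ , sym (+-identityˡ 0#) }

  -- In the second component the multiplier is H ι + ι = 0, so that component of the sum cancels.
  ι-leibniz : ∀ z w → (ι • z) ⋆ w V.+ z ⋆ (ι • w) V.≈ Zι (z ⋆ w)
  ι-leibniz (x , y) (u , v) =
    comb₄ (Fι* x) (Fι* u) (Fι* y) (Fι* v)
      (solve 14 (λ B s x y u v Fx Fy Fu Fv Fsx Fsu Fsy Fsv →
        Fsx :* u :+ s :* x :* Fu :+ B :* (Fsy :* v :+ s :* y :* Fv) :+ (Fx :* (s :* u) :+ x :* Fsu :+ B :* (Fy :* (s :* v) :+ y :* Fsv))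
        :- (:1 :+ :1) :* s :* (Fx :* u :+ x :* Fu :+ B :* (Fy :* v :+ y :* Fv)) :=
        u :* (Fsx :- s :* Fx) :+ x :* (Fsu :- s :* Fu) :+ (B :* v) :* (Fsy :- s :* Fy) :+ (B :* y) :* (Fsv :- s :* Fv))
        refl B ι x y u v (F x) (F y) (F u) (F v) (F (ι * x)) (F (ι * u)) (F (ι * y)) (F (ι * v))) ,
    comb₄ (Hι* x) (Hι* u) (Hι* y) (Hι* v)
      (solve 14 (λ A s x y u v Hx Hy Hu Hv Hsx Hsu Hsy Hsv →
        Hsx :* v :+ A :* (s :* x) :* Hv :+ A :* Hsy :* u :+ s :* y :* Hu :+ (Hx :* (s :* v) :+ A :* x :* Hsv :+ A :* Hy :* (s :* u) :+ y :* Hsu) :- :0 :=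
        v :* (Hsx :- (:- s) :* Hx) :+ y :* (Hsu :- (:- s) :* Hu) :+ (A :* u) :* (Hsy :- (:- s) :* Hy) :+ (A :* x) :* (Hsv :- (:- s) :* Hv))
        refl A ι x y u v (H x) (H y) (H u) (H v) (H (ι * x)) (H (ι * u)) (H (ι * y)) (H (ι * v)))
    where
    Fι* : ∀ x → F (ι * x) ≈ ι * F x
    Fι* x = trans (F.*-homo ι x) (*-congʳ Fι≈ι)
    Hι* : ∀ x → H (ι * x) ≈ (- ι) * H x
    Hι* x = trans (H.*-homo ι x) (*-congʳ Hι≈-ι)

  ⋆-distribˡ : ∀ z w w′ → z ⋆ (w V.+ w′) V.≈ z ⋆ w V.+ z ⋆ w′
  ⋆-distribˡ z w w′ = V.trans (⋆-comm z _) (V.trans (⋆-distribʳ z w w′) (V.+-cong (⋆-comm w z) (⋆-comm w′ z)))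

  -- `X` and `Y` carry right multiplications of `⋆` to right multiplications. `onto` and `from` are
  -- the two inclusions of the invariance of the spread set.
  record Autotopism (X Y X′ Y′ : V.Carrier → V.Carrier) : Set (c ⊔ ℓ) where
    field
      X-add : VT.IsAdd X
      Y-add : VT.IsAdd Y
      X′-add : VT.IsAdd X′
      Y′-add : VT.IsAdd Y′
      XX′ : ∀ z → X (X′ z) V.≈ z
      X′X : ∀ z → X′ (X z) V.≈ z
      YY′ : ∀ z → Y (Y′ z) V.≈ z
      Y′Y : ∀ z → Y′ (Y z) V.≈ z
      onto : ∀ w → ∃ λ w′ → ∀ z → X (Y′ z ⋆ w) V.≈ z ⋆ w′
      from : ∀ w′ → ∃ λ w → ∀ z → X (Y′ z ⋆ w) V.≈ z ⋆ w′
    module X = VT.IsAdd X-add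
    module Y = VT.IsAdd Y-add
    module X′ = VT.IsAdd X′-add
    module Y′ = VT.IsAdd Y′-add

  inverse : ∀ {X Y X′ Y′} → Autotopism X Y X′ Y′ → Autotopism X′ Y′ X Y
  inverse {X} {Y} {X′} {Y′} a = record
    { X-add = X′-add ; Y-add = Y′-add ; X′-add = X-add ; Y′-add = Y-add
    ; XX′ = X′X ; X′X = XX′ ; YY′ = Y′Y ; Y′Y = YY′
    ; onto = λ w → proj₁ (from w) , swap (proj₂ (from w))
    ; from = λ w′ → proj₁ (onto w′) , swap (proj₂ (onto w′)) }
    where
    open Autotopism a
    swap : ∀ {w w′} → (∀ z → X (Y′ z ⋆ w) V.≈ z ⋆ w′) → ∀ z → X′ (Y z ⋆ w′) V.≈ z ⋆ w
    swap e z = V.trans (X′.cong (V.sym (e (Y z)))) (V.trans (X′X _) (⋆-cong (Y′Y z) V.refl))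

  module Conjugation {X Y X′ Y′ : V.Carrier → V.Carrier} (autotopism : Autotopism X Y X′ Y′) where
    open Autotopism autotopism

    -- Mere choices: nothing beyond the intertwining identities is known of them. Additivity of the
    -- operators built from them is recovered through `adjoint-isAdd`.
    τ τ′ : V.Carrier → V.Carrier
    τ w = proj₁ (onto w)
    τ′ w = proj₁ (from w)

    intertwine : ∀ z w → X (Y′ z ⋆ w) V.≈ z ⋆ τ w
    intertwine z w = proj₂ (onto w) z

    intertwine′ : ∀ z w → X (Y′ z ⋆ τ′ w) V.≈ z ⋆ w
    intertwine′ z w = proj₂ (from w) z

    Y-intertwine : ∀ z w → X (z ⋆ w) V.≈ Y z ⋆ τ w
    Y-intertwine z w = V.trans (X.cong (⋆-cong (V.sym (Y′Y z)) V.refl)) (intertwine (Y z) w)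

    Y-intertwine′ : ∀ z w → X (z ⋆ τ′ w) V.≈ Y z ⋆ w
    Y-intertwine′ z w = V.trans (X.cong (⋆-cong (V.sym (Y′Y z)) V.refl)) (intertwine′ (Y z) w)

    abstract
      conj-Ŵ : ∀ s → F s ≈ s → ∃ λ ρ → F ρ ≈ ρ × ∀ z → Y (Ŵ s z) V.≈ Ŵ ρ (Y z)
      conj-Ŵ s Fs≈s = proj₁ classified , proj₁ (proj₂ classified) ,
        λ z → V.trans (Y.cong (Ŵ-cong refl (V.sym (Y′Y z)))) (proj₂ (proj₂ classified) (Y z))
        where
        adj : ∀ z w → Y (Ŵ s (Y′ z)) ⋆ w V.≈ z ⋆ τ (Ŵ s (τ′ w))
        adj z w = V.trans (V.sym (Y-intertwine′ (Ŵ s (Y′ z)) w))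
          (V.trans (X.cong (Ŵ-adjoint Fs≈s (Y′ z) (τ′ w))) (intertwine z (Ŵ s (τ′ w))))
        classified : ∃ λ ρ → F ρ ≈ ρ × ∀ z → Y (Ŵ s (Y′ z)) V.≈ Ŵ ρ z
        classified = selfAdjoint⇒Ŵ {λ z → Y (Ŵ s (Y′ z))} {λ w → τ (Ŵ s (τ′ w))} adj

    conj-Ŵ-pow : ∀ {s ρ} → (∀ z → Y (Ŵ s z) V.≈ Ŵ ρ (Y z)) → ∀ n z → Y (Ŵ (pow R s n) z) V.≈ Ŵ (pow R ρ n) (Y z)
    conj-Ŵ-pow e ℕ.zero z = V.trans (Y.cong (Ŵ-1 z)) (V.sym (Ŵ-1 (Y z)))
      where
      Ŵ-1 : ∀ z → Ŵ 1# z V.≈ z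
      Ŵ-1 z = *-identityˡ _ , trans (*-congʳ H.1-homo) (*-identityˡ _)
    conj-Ŵ-pow {s} {ρ} e (ℕ.suc n) z = V.trans (Y.cong (Ŵ-* s _ z)) (V.trans (e _)
      (V.trans (Ŵ-cong refl (conj-Ŵ-pow e n z)) (V.sym (Ŵ-* ρ _ (Y z)))))

    -- Conjugation is compatible with powers of operators, and G is a power map; hence it commutes
    -- with passing from s to ρ.
    conj-Ŵ-G : ∀ {s ρ} → (∀ z → Y (Ŵ s z) V.≈ Ŵ ρ (Y z)) → ∀ z → Y (Ŵ (G s) z) V.≈ Ŵ (G ρ) (Y z)
    conj-Ŵ-G e z = V.trans (Y.cong (Ŵ-cong (G-pow _) V.refl)) (V.trans (conj-Ŵ-pow e Q z) (Ŵ-cong (sym (G-pow _)) V.refl))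

    conj-Ŵ-unique : ∀ {s t ρ σ} → s ≈ t → (∀ z → Y (Ŵ s z) V.≈ Ŵ ρ (Y z)) → (∀ z → Y (Ŵ t z) V.≈ Ŵ σ (Y z)) → ρ ≈ σ
    conj-Ŵ-unique {ρ = ρ} {σ} s≈t e e′ = Ŵ-injective λ z → V.trans (Ŵ-cong refl (V.sym (YY′ z)))
      (V.trans (V.sym (e (Y′ z))) (V.trans (Y.cong (Ŵ-cong s≈t V.refl)) (V.trans (e′ (Y′ z)) (Ŵ-cong refl (YY′ z)))))

    Y-injective : ∀ {z w} → Y z V.≈ Y w → z V.≈ w
    Y-injective {z} {w} e = V.trans (V.sym (Y′Y z)) (V.trans (Y′.cong e) (Y′Y w))

    private
      κ : Carrier
      κ = proj₁ (conj-Ŵ ι Fι≈ι)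
      Fκ≈κ : F κ ≈ κ
      Fκ≈κ = proj₁ (proj₂ (conj-Ŵ ι Fι≈ι))
      Y-Ŵι : ∀ z → Y (Ŵ ι z) V.≈ Ŵ κ (Y z)
      Y-Ŵι = proj₂ (proj₂ (conj-Ŵ ι Fι≈ι))

      Gκ≈-κ : G κ ≈ - κ
      Gκ≈-κ = conj-Ŵ-unique Gι≈-ι (conj-Ŵ-G Y-Ŵι) λ z →
        V.trans (Y.cong (Ŵ-neg ι z)) (V.trans (Y.neg-homo (Ŵ ι z)) (V.trans (V.-‿cong (Y-Ŵι z)) (V.sym (Ŵ-neg κ (Y z)))))

      κ≉0 : ¬ (κ ≈ 0#)
      κ≉0 κ≈0 = ι≉0 (trans (sym (*-identityʳ ι)) (trans (proj₁ (Y-injective {Ŵ ι e₁} {Ŵ 0# e₁}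
        (V.trans (Y-Ŵι e₁) (V.trans (Ŵ-cong κ≈0 (V.refl {Y e₁})) (V.sym (Y-Ŵ0 e₁)))))) (zeroˡ 1#)))
        where
        Ŵ0 : ∀ z → Ŵ 0# z V.≈ V.0#
        Ŵ0 z = zeroˡ _ , trans (*-congʳ H.0-homo) (zeroˡ _)
        Y-Ŵ0 : ∀ z → Y (Ŵ 0# z) V.≈ Ŵ 0# (Y z)
        Y-Ŵ0 z = V.trans (Y.cong (Ŵ0 z)) (V.trans Y.0-homo (V.sym (Ŵ0 (Y z))))

      Hκ≈-κ : H κ ≈ - κ
      Hκ≈-κ = Twisted.Hκ≈-κ κ≉0 Fκ≈κ Gκ≈-κ

      D D′ Z : V.Carrier → V.Carrier
      D z = Y (ι • Y′ z)
      D′ w = τ (ι • τ′ w)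
      Z z = X (Zι (X′ z))

      D-add : VT.IsAdd D
      D-add = VT.∘-isAdd (VT.∘-isAdd Y-add (•-add ι)) Y′-add
      Z-add : VT.IsAdd Z
      Z-add = VT.∘-isAdd (VT.∘-isAdd X-add Zι-add) X′-add

      D-leibniz : ∀ z w → D z ⋆ w V.+ z ⋆ D′ w V.≈ Z (z ⋆ w)
      D-leibniz z w = V.trans
        (V.+-cong (V.sym (Y-intertwine′ (ι • Y′ z) w)) (V.sym (intertwine z (ι • τ′ w))))
        (V.trans (V.sym (X.+-homo _ _)) (X.cong (V.trans (ι-leibniz (Y′ z) (τ′ w))
          (VT.IsAdd.cong Zι-add (V.trans (V.sym (X′X _)) (X′.cong (intertwine′ z w)))))))

      D-leibniz′ : ∀ z w → D′ z ⋆ w V.+ z ⋆ D w V.≈ Z (z ⋆ w)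
      D-leibniz′ z w = V.trans (V.+-cong (⋆-comm (D′ z) w) (⋆-comm z (D w))) (V.trans (V.+-comm (w ⋆ D′ z) (D w ⋆ z))
        (V.trans (D-leibniz w z) (VT.IsAdd.cong Z-add (⋆-comm w z))))

      ⋆-sub : ∀ z z′ w → (z V.- z′) ⋆ w V.≈ z ⋆ w V.- z′ ⋆ w
      ⋆-sub z z′ w = V.trans (⋆-distribʳ w z (V.- z′)) (V.+-congˡ {z ⋆ w} (VT.IsAdd.neg-homo ⋆w-add z′))
        where
        ⋆w-add : VT.IsAdd (_⋆ w)
        ⋆w-add = record { cong = λ e → ⋆-cong e (V.refl {w}) ; +-homo = ⋆-distribʳ w }

      -- The difference of the two Leibniz rules, one with D on the left factor and one with D on
      -- the right, which commutativity provides.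
      E-adjoint : ∀ z w → (D z V.- D′ z) ⋆ w V.≈ z ⋆ (D w V.- D′ w)
      E-adjoint z w = V.trans (⋆-sub (D z) (D′ z) w) (V.trans (VT.comb₂ (D-leibniz z w) (D-leibniz′ z w)
        (VT.solve 5 (λ a b c d e → a VT.:- b VT.:- (d VT.:- c) VT.:= VT.:1 VT.:* (a VT.:+ c VT.:- e) VT.:+ (VT.:- VT.:1) VT.:* (b VT.:+ d VT.:- e))
          V.refl (D z ⋆ w) (D′ z ⋆ w) (z ⋆ D′ w) (z ⋆ D w) (Z (z ⋆ w))))
        (V.trans (V.+-cong (⋆-comm z (D w)) (V.-‿cong (⋆-comm z (D′ w)))) (V.trans (V.sym (⋆-sub (D w) (D′ w) z)) (⋆-comm (D w V.- D′ w) z))))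

      classified : ∃ λ s → F s ≈ s × ∀ z → D z V.- D′ z V.≈ Ŵ s z
      classified = selfAdjoint⇒Ŵ {λ z → D z V.- D′ z} {λ z → D z V.- D′ z} E-adjoint
      μ : Carrier
      μ = proj₁ classified

      -- This is D + D′ rewritten as 2 D - `Ŵ μ`. The second form is visibly additive and commutes
      -- with `Ŵ κ`, the first satisfies the Leibniz rule; halving recovers D.
      P : V.Carrier → V.Carrier
      P z = D z V.+ (D z V.+ V.- Ŵ μ z)

      P-add : VT.IsAdd P
      P-add = VT.+-isAdd D-add (VT.+-isAdd D-add (VT.neg-isAdd (Ŵ-add μ)))

      P≈ : ∀ z → P z V.≈ D z V.+ D′ z
      P≈ z = V.+-congˡ {D z} (VT.comb₁ (proj₂ (proj₂ classified) z)
        (VT.solve 3 (λ a b c → a VT.:+ VT.:- c VT.:- b VT.:= VT.:1 VT.:* (a VT.:- b VT.:- c)) V.refl (D z) (D′ z) (Ŵ μ z)))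

      P-leibniz : ∀ z w → P z ⋆ w V.+ z ⋆ P w V.≈ Z (z ⋆ w) V.+ Z (z ⋆ w)
      P-leibniz z w = V.trans
        (V.+-cong (V.trans (⋆-cong (P≈ z) (V.refl {w})) (⋆-distribʳ w (D z) (D′ z)))
                  (V.trans (⋆-cong (V.refl {z}) (P≈ w)) (⋆-distribˡ z (D w) (D′ w))))
        (VT.comb₂ (D-leibniz z w) (D-leibniz′ z w)
          (VT.solve 5 (λ a b c d e → a VT.:+ b VT.:+ (d VT.:+ c) VT.:- (e VT.:+ e) VT.:= VT.:1 VT.:* (a VT.:+ c VT.:- e) VT.:+ VT.:1 VT.:* (b VT.:+ d VT.:- e))
            V.refl (D z ⋆ w) (D′ z ⋆ w) (z ⋆ D′ w) (z ⋆ D w) (Z (z ⋆ w))))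

      D-Ŵ : ∀ z → D (Ŵ κ z) V.≈ Ŵ κ (D z)
      D-Ŵ z = V.trans (Y.cong (V.trans (•-cong refl Y′-Ŵ) (V.sym (Ŵ-• ι ι (Y′ z))))) (Y-Ŵι (ι • Y′ z))
        where
        Y′-Ŵ : Y′ (Ŵ κ z) V.≈ Ŵ ι (Y′ z)
        Y′-Ŵ = V.trans (Y′.cong (V.trans (Ŵ-cong refl (V.sym (YY′ z))) (V.sym (Y-Ŵι (Y′ z))))) (Y′Y (Ŵ ι (Y′ z)))

      P-Ŵ : ∀ z → P (Ŵ κ z) V.≈ Ŵ κ (P z)
      P-Ŵ z = V.trans (V.+-cong (D-Ŵ z) (V.+-cong (D-Ŵ z) (V.-‿cong μκ)))
        (V.sym (V.trans (Ŵκ.+-homo (D z) (D z V.+ V.- Ŵ μ z)) (V.+-congˡ {Ŵ κ (D z)} (Ŵκ.sub-homo (D z) (Ŵ μ z)))))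
        where
        module Ŵκ = VT.IsAdd (Ŵ-add κ)
        μκ : Ŵ μ (Ŵ κ z) V.≈ Ŵ κ (Ŵ μ z)
        μκ = V.trans (V.sym (Ŵ-* μ κ z)) (V.trans (Ŵ-cong (*-comm μ κ) (V.refl {z})) (Ŵ-* κ μ z))

      P-diagonal : ∃ λ s → ∃ λ t → ∀ z → P z V.≈ (s * proj₁ z , t * proj₂ z)
      P-diagonal = derivation⇒diagonal P-add (VT.+-isAdd Z-add Z-add) P-leibniz κ≉0 Fκ≈κ Gκ≈-κ P-Ŵ

      ½ : Carrier
      ½ = inv (1# + 1#) 2≉0
      s t : Carrier
      s = ½ * (proj₁ P-diagonal + μ)
      t = ½ * (proj₁ (proj₂ P-diagonal) + H μ)

      D-diagonal : ∀ z → D z V.≈ (s * proj₁ z , t * proj₂ z)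
      D-diagonal z = half (proj₁ P-diagonal) μ (proj₁ (proj₂ (proj₂ P-diagonal) z)) , half _ (H μ) (proj₂ (proj₂ (proj₂ P-diagonal) z))
        where
        half : ∀ p m {d x} → d + (d + - (m * x)) ≈ p * x → d ≈ ½ * (p + m) * x
        half p m {d} {x} e = cancel 2≉0 (comb₂ e (inv-r (1# + 1#) 2≉0)
          (solve 5 (λ p m d x h → (:1 :+ :1) :* d :- (:1 :+ :1) :* (h :* (p :+ m) :* x) :=
            :1 :* (d :+ (d :+ :- (m :* x)) :- p :* x) :+ (:- ((p :+ m) :* x)) :* ((:1 :+ :1) :* h :- :1)) refl p m d x ½))

      -- The squares of ι and of H ι = - ι agree, so the scalar ι and `Ŵ ι` have the same square,
      -- and this survives conjugation.
      D-square : ∀ z → D (D z) V.≈ Ŵ κ (Ŵ κ z)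
      D-square z = V.trans (Y.cong (V.trans (•-cong refl (Y′Y (ι • Y′ z))) (square (Y′ z))))
        (V.trans (Y-Ŵι (Ŵ ι (Y′ z))) (Ŵ-cong refl (V.trans (Y-Ŵι (Y′ z)) (Ŵ-cong refl (YY′ z)))))
        where
        square : ∀ z → ι • ι • z V.≈ Ŵ ι (Ŵ ι z)
        square (x , y) = refl , comb₁ Hι≈-ι
          (solve 3 (λ i h y → i :* (i :* y) :- h :* (h :* y) := (:- ((h :- i) :* y)) :* (h :- (:- i))) refl ι (H ι) y)

      s-sign : s ≈ κ ⊎ s ≈ - κ
      s-sign = sign (trans (sym (trans (proj₁ (V.trans (D-diagonal (D e₁)) (*-congˡ (proj₁ (D-diagonal e₁)) , refl))) (*-congˡ (*-identityʳ s))))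
          (trans (proj₁ (D-square e₁)) (*-congˡ (*-identityʳ κ))))
      t-sign : t ≈ κ ⊎ t ≈ - κ
      t-sign = sign (trans (sym (trans (proj₂ (V.trans (D-diagonal (D e₂)) (refl , *-congˡ (proj₂ (D-diagonal e₂))))) (*-congˡ (*-identityʳ t))))
          (trans (proj₂ (D-square e₂)) (comb₁ Hκ≈-κ
            (solve 2 (λ k h → h :* (h :* :1) :- k :* k := (h :- k) :* (h :- (:- k))) refl κ (H κ)))))

      Y-ι : ∀ z → Y (ι • z) V.≈ (s * proj₁ (Y z) , t * proj₂ (Y z))
      Y-ι z = V.trans (Y.cong (•-cong refl (V.sym (Y′Y z)))) (D-diagonal (Y z))

      2ι≉0 : ¬ (ι + ι ≈ 0#)
      2ι≉0 e = *-≉0 2≉0 ι≉0 (trans (solve 1 (λ i → (:1 :+ :1) :* i := i :+ i) refl ι) e)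

    private
      -- With opposite signs D would equal plus or minus Y `Ŵ ι` Y′, and injectivity of Y would
      -- identify the scalar ι with plus or minus `Ŵ ι`, contradicting 2 ι ≠ 0 on one of the
      -- coordinates.
      signs-differ₁ : s ≈ κ → ¬ (t ≈ - κ)
      signs-differ₁ p q = 2ι≉0 (comb₂ (proj₂ (Y-injective {ι • e₂} {Ŵ ι e₂} Y-e₂)) Hι≈-ι
        (solve 2 (λ i h → i :+ i :- :0 := :1 :* (i :* :1 :- h :* :1) :+ :1 :* (h :- (:- i))) refl ι (H ι)))
        where
        Y-e₂ : Y (ι • e₂) V.≈ Y (Ŵ ι e₂)
        Y-e₂ = V.trans (Y-ι e₂) (V.trans (*-congʳ p , *-congʳ (trans q (sym Hκ≈-κ))) (V.sym (Y-Ŵι e₂)))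

      signs-differ₂ : s ≈ - κ → ¬ (t ≈ κ)
      signs-differ₂ p q = 2ι≉0 (comb₁ (proj₁ (Y-injective {ι • e₁} {V.- Ŵ ι e₁} Y-e₁))
        (solve 1 (λ i → i :+ i :- :0 := :1 :* (i :* :1 :- (:- (i :* :1)))) refl ι))
        where
        Y-e₁ : Y (ι • e₁) V.≈ Y (V.- Ŵ ι e₁)
        Y-e₁ = V.trans (Y-ι e₁) (V.trans
          ( comb₁ p (solve 3 (λ s k x → s :* x :- (:- (k :* x)) := x :* (s :- (:- k))) refl s κ (proj₁ (Y e₁)))
          , comb₂ q Hκ≈-κ (solve 4 (λ t k h x → t :* x :- (:- (h :* x)) := x :* (t :- k) :+ x :* (h :- (:- k))) refl t κ (H κ) (proj₂ (Y e₁))))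
          (V.trans (V.-‿cong (V.sym (Y-Ŵι e₁))) (V.sym (Y.neg-homo (Ŵ ι e₁)))))

      equal-signs : s ≈ κ ⊎ s ≈ - κ → t ≈ κ ⊎ t ≈ - κ → ∃ λ σ → F σ ≈ σ × s ≈ σ × t ≈ σ
      equal-signs (inj₁ p) (inj₁ q) = κ , Fκ≈κ , p , q
      equal-signs (inj₁ p) (inj₂ q) = contradiction q (signs-differ₁ p)
      equal-signs (inj₂ p) (inj₁ q) = contradiction q (signs-differ₂ p)
      equal-signs (inj₂ p) (inj₂ q) = - κ , trans (F.neg-homo κ) (-‿cong Fκ≈κ) , p , q

    conj-ι : ∃ λ σ → F σ ≈ σ × ∀ z → Y (ι • z) V.≈ σ • Y z
    conj-ι = let σ , Fσ≈σ , p , q = equal-signs s-sign t-sign in σ , Fσ≈σ , λ z → V.trans (Y-ι z) (*-congʳ p , *-congʳ q)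

    -- On common fixed points of F and G the operator `Ŵ s` is the scalar s, so the classification
    -- of self-adjoint operators applies directly.
    conj-F∩G : ∀ s → F s ≈ s → G s ≈ s → ∃ λ ρ → F ρ ≈ ρ × G ρ ≈ ρ × ∀ z → Y (s • z) V.≈ ρ • Y z
    conj-F∩G s Fs≈s Gs≈s = ρ , Fρ≈ρ , Gρ≈ρ , λ z → V.trans (Y.cong (V.sym (Ŵ-fixed Fs≈s Gs≈s z))) (V.trans (Y-Ŵ z) (Ŵ-fixed Fρ≈ρ Gρ≈ρ (Y z)))
      where
      ρ : Carrier
      ρ = proj₁ (conj-Ŵ s Fs≈s)
      Fρ≈ρ : F ρ ≈ ρ
      Fρ≈ρ = proj₁ (proj₂ (conj-Ŵ s Fs≈s))
      Y-Ŵ : ∀ z → Y (Ŵ s z) V.≈ Ŵ ρ (Y z)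
      Y-Ŵ = proj₂ (proj₂ (conj-Ŵ s Fs≈s))
      Gρ≈ρ : G ρ ≈ ρ
      Gρ≈ρ = conj-Ŵ-unique Gs≈s (conj-Ŵ-G Y-Ŵ) Y-Ŵ
      Ŵ-fixed : ∀ {s} → F s ≈ s → G s ≈ s → ∀ z → Ŵ s z V.≈ s • z
      Ŵ-fixed Fs≈s Gs≈s z = refl , *-congʳ (trans (H≈GF _) (trans (G.cong Fs≈s) Gs≈s))

    -- s is split as half of (s + G s) + r ι, where s + G s and r are fixed by both F and G
    conj-F : ∀ s → F s ≈ s → ∃ λ ρ → F ρ ≈ ρ × ∀ z → Y (s • z) V.≈ ρ • Y z
    conj-F s Fs≈s = h * η , cancel 2≉0 (trans 2Fξ (sym 2ξ)) , Y-s
      where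
      p r h : Carrier
      p = s + G s
      r = inv ι ι≉0 * (s - G s)
      h = inv (1# + 1#) 2≉0
      ιr : ι * r ≈ s - G s
      ιr = comb₁ (inv-r ι ι≉0) (solve 3 (λ i j x → i :* (j :* x) :- x := x :* (i :* j :- :1)) refl ι (inv ι ι≉0) (s - G s))
      FGs : F (G s) ≈ G s
      FGs = trans (FG≈GF s) (G.cong Fs≈s)
      Fp≈p : F p ≈ p
      Fp≈p = trans (F.+-homo s (G s)) (+-cong Fs≈s FGs)
      Gp≈p : G p ≈ p
      Gp≈p = trans (G.+-homo s (G s)) (trans (+-congˡ (GG≈id s)) (+-comm (G s) s))
      Fr≈r : F r ≈ r
      Fr≈r = cancel ι≉0 (trans (*-congʳ (sym Fι≈ι)) (trans (sym (F.*-homo ι r)) (trans (F.cong ιr)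
        (trans (F.sub-homo s (G s)) (trans (+-cong Fs≈s (-‿cong FGs)) (sym ιr))))))
      Gr≈r : G r ≈ r
      Gr≈r = cancel ι≉0 (comb₄ (trans (sym (G.*-homo ι r)) (trans (G.cong ιr) (G.sub-homo s (G s)))) Gι≈-ι (GG≈id s) ιr
        (solve 7 (λ i r Gi Gr s Gs GGs → i :* Gr :- i :* r :=
          (:- :1) :* (Gi :* Gr :- (Gs :- GGs)) :+ Gr :* (Gi :- (:- i)) :+ :1 :* (GGs :- s) :+ (:- :1) :* (i :* r :- (s :- Gs)))
          refl ι r (G ι) (G r) s (G s) (G (G s))))
      cp : ∃ λ ρ → F ρ ≈ ρ × G ρ ≈ ρ × ∀ z → Y (p • z) V.≈ ρ • Y z
      cp = conj-F∩G p Fp≈p Gp≈p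
      cr : ∃ λ ρ → F ρ ≈ ρ × G ρ ≈ ρ × ∀ z → Y (r • z) V.≈ ρ • Y z
      cr = conj-F∩G r Fr≈r Gr≈r
      η : Carrier
      η = proj₁ cp + proj₁ cr * proj₁ conj-ι
      Fη≈η : F η ≈ η
      Fη≈η = trans (F.+-homo _ _) (+-cong (proj₁ (proj₂ cp)) (trans (F.*-homo _ _) (*-cong (proj₁ (proj₂ cr)) (proj₁ (proj₂ conj-ι)))))
      2ξ : (1# + 1#) * (h * η) ≈ η
      2ξ = comb₁ (inv-r (1# + 1#) 2≉0) (solve 2 (λ h x → (:1 :+ :1) :* (h :* x) :- x := x :* ((:1 :+ :1) :* h :- :1)) refl h η)
      2Fξ : (1# + 1#) * F (h * η) ≈ η
      2Fξ = trans (*-congʳ (sym (trans (F.+-homo 1# 1#) (+-cong F.1-homo F.1-homo)))) (trans (sym (F.*-homo (1# + 1#) (h * η))) (trans (F.cong 2ξ) Fη≈η))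
      2s : ∀ z → (s • z) V.+ (s • z) V.≈ (p • z) V.+ (r • ι • z)
      2s (x , y) = eq x , eq y
        where
        eq : ∀ x → s * x + s * x ≈ p * x + r * (ι * x)
        eq x = comb₁ ιr (solve 5 (λ s Gs i r x → s :* x :+ s :* x :- ((s :+ Gs) :* x :+ r :* (i :* x)) := (:- x) :* (i :* r :- (s :- Gs))) refl s (G s) ι r x)
      2Y : ∀ z → Y (s • z) V.+ Y (s • z) V.≈ η • Y z
      2Y z = V.trans (V.sym (Y.+-homo (s • z) (s • z))) (V.trans (Y.cong (2s z)) (V.trans (Y.+-homo (p • z) (r • ι • z))
        (V.trans (V.+-cong (proj₂ (proj₂ (proj₂ cp)) z) (V.trans (proj₂ (proj₂ (proj₂ cr)) (ι • z)) (•-cong refl (proj₂ (proj₂ conj-ι) z))))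
          (dist (proj₁ (Y z)) , dist (proj₂ (Y z))))))
        where
        dist : ∀ x → proj₁ cp * x + proj₁ cr * (proj₁ conj-ι * x) ≈ η * x
        dist x = solve 4 (λ a b c x → a :* x :+ b :* (c :* x) := (a :+ b :* c) :* x) refl (proj₁ cp) (proj₁ cr) (proj₁ conj-ι) x
      Y-s : ∀ z → Y (s • z) V.≈ (h * η) • Y z
      Y-s z = half (proj₁ (2Y z)) , half (proj₂ (2Y z))
        where
        half : ∀ {d x} → d + d ≈ η * x → d ≈ h * η * x
        half {d} {x} e = cancel 2≉0 (comb₂ e (inv-r (1# + 1#) 2≉0)
          (solve 4 (λ d x h n → (:1 :+ :1) :* d :- (:1 :+ :1) :* (h :* n :* x) :=
            :1 :* (d :+ d :- n :* x) :+ (:- (n :* x)) :* ((:1 :+ :1) :* h :- :1)) refl d x h η))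

    -- This is 𝔻 ⊆ 𝔼: from H² = F² one gets F² s = s, and the odd order of F does the rest.
    H-fixed⇒F-fixed : ∀ {s} → H s ≈ s → F s ≈ s
    H-fixed⇒F-fixed {s} Hs≈s = F⁴-fixed s (trans (F.cong (F.cong FFs≈s)) FFs≈s)
      where
      FFs≈s : F (F s) ≈ s
      FFs≈s = trans (sym (HH≈FF s)) (trans (H.cong Hs≈s) Hs≈s)

    -- X is controlled only on products. An injective additive map of a finite field is onto, so
    -- every pair is a product with `e₁`.
    ⋆e₁-surjective : ∀ z → ∃ λ w → w ⋆ e₁ V.≈ z
    ⋆e₁-surjective (x , y) = (proj₁ sx , proj₁ sy) , V.trans (⋆-1 (proj₁ sx) (proj₁ sy) 1#)
      ( trans (comb₁ F.1-homo (solve 3 (λ f x o → f :* :1 :+ x :* o :- (:1 :* f :+ :1 :* x) := x :* (o :- :1)) refl (F (proj₁ sx)) (proj₁ sx) (F 1#))) (proj₂ sx)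
      , trans (comb₁ H.1-homo (solve 4 (λ a h y o → a :* h :* :1 :+ y :* o :- (a :* h :+ :1 :* y) := y :* (o :- :1)) refl A (H (proj₁ sy)) (proj₁ sy) (H 1#))) (proj₂ sy) )
      where
      sx : ∃ λ t → 1# * F t + 1# * t ≈ x
      sx = injective⇒surjective (λ t → 1# * F t + 1# * t) (+-isAdd (*-isAdd 1# F.isAdd) (scale-isAdd 1#)) F+id-injective x
      sy : ∃ λ t → A * H t + 1# * t ≈ y
      sy = injective⇒surjective (λ t → A * H t + 1# * t) (+-isAdd (*-isAdd A H.isAdd) (scale-isAdd 1#)) AH+id-injective y

    conj-X : ∀ s → H s ≈ s → ∃ λ ρ → H ρ ≈ ρ × ∀ z → X (s • z) V.≈ ρ • X z
    conj-X s Hs≈s = ρ , Hρ≈ρ , λ z → X-s z (⋆e₁-surjective z)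
      where
      Fs≈s : F s ≈ s
      Fs≈s = H-fixed⇒F-fixed Hs≈s
      Gs≈s : G s ≈ s
      Gs≈s = trans (G.cong (sym Fs≈s)) (trans (sym (H≈GF s)) Hs≈s)
      cs : ∃ λ ρ → F ρ ≈ ρ × G ρ ≈ ρ × ∀ z → Y (s • z) V.≈ ρ • Y z
      cs = conj-F∩G s Fs≈s Gs≈s
      ρ : Carrier
      ρ = proj₁ cs
      Fρ≈ρ : F ρ ≈ ρ
      Fρ≈ρ = proj₁ (proj₂ cs)
      Hρ≈ρ : H ρ ≈ ρ
      Hρ≈ρ = trans (H≈GF ρ) (trans (G.cong Fρ≈ρ) (proj₁ (proj₂ (proj₂ cs))))
      X-s : ∀ z → (∃ λ w → w ⋆ e₁ V.≈ z) → X (s • z) V.≈ ρ • X z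
      X-s z (w , w⋆e₁≈z) = V.trans (X.cong (V.trans (•-cong refl (V.sym w⋆e₁≈z)) (V.sym (•-⋆ Fs≈s Hs≈s w e₁))))
        (V.trans (Y-intertwine (s • w) e₁) (V.trans (⋆-cong (proj₂ (proj₂ (proj₂ cs)) w) (V.refl {τ e₁}))
        (V.trans (•-⋆ Fρ≈ρ Hρ≈ρ (Y w) (τ e₁)) (•-cong refl (V.trans (V.sym (Y-intertwine w e₁)) (X.cong w⋆e₁≈z))))))

-- Powers and the Frobenius endomorphism

module Powers {c ℓ} (R : CommutativeRing c ℓ) where

  open CommutativeRing R
  open RingTools R
  import Algebra.Properties.Semiring.Exp semiring as Exp
  import Algebra.Properties.CommutativeSemiring.Exp commutativeSemiring as CExp
  import Algebra.Properties.Semiring.Mult semiring as Mult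
  import Algebra.Properties.CommutativeSemiring.Binomial commutativeSemiring as Binomial
  import Algebra.Properties.CommutativeMonoid.Sum +-commutativeMonoid as Sum
  open import Relation.Binary.Reasoning.Setoid setoid

  pow≡^ : ∀ x n → pow R x n ≡.≡ x Exp.^ n
  pow≡^ x ℕ.zero = ≡.refl
  pow≡^ x (ℕ.suc n) = ≡.cong (x *_) (pow≡^ x n)

  times≡× : ∀ n x → times R n x ≡.≡ n Mult.× x
  times≡× ℕ.zero x = ≡.refl
  times≡× (ℕ.suc n) x = ≡.cong (x +_) (times≡× n x)

  pow-cong : ∀ {x y} n → x ≈ y → pow R x n ≈ pow R y n
  pow-cong ℕ.zero e = refl
  pow-cong (ℕ.suc n) e = *-cong e (pow-cong n e)

  pow-+ : ∀ x m n → pow R x (m ℕ.+ n) ≈ pow R x m * pow R x n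
  pow-+ x ℕ.zero n = sym (*-identityˡ _)
  pow-+ x (ℕ.suc m) n = trans (*-congˡ (pow-+ x m n)) (sym (*-assoc _ _ _))

  pow-* : ∀ x m n → pow R (pow R x m) n ≈ pow R x (m ℕ.* n)
  pow-* x m n rewrite pow≡^ x (m ℕ.* n) | pow≡^ x m | pow≡^ (x Exp.^ m) n = Exp.^-assocʳ x m n

  pow-distrib : ∀ x y n → pow R (x * y) n ≈ pow R x n * pow R y n
  pow-distrib x y n rewrite pow≡^ (x * y) n | pow≡^ x n | pow≡^ y n = CExp.^-distrib-* x y n

  pow-1# : ∀ n → pow R 1# n ≈ 1#
  pow-1# ℕ.zero = refl
  pow-1# (ℕ.suc n) = trans (*-identityˡ _) (pow-1# n)

  pow-swap : ∀ x m n → pow R (pow R x m) n ≈ pow R (pow R x n) m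
  pow-swap x m n = trans (pow-* x m n) (trans (reflexive (≡.cong (pow R x) (ℕ.*-comm m n))) (sym (pow-* x n m)))

  times-* : ∀ m n → times R (m ℕ.* n) 1# ≈ times R m 1# * times R n 1#
  times-* m n rewrite times≡× (m ℕ.* n) 1# | times≡× m 1# | times≡× n 1# = Mult.×1-homo-* m n

  pow-neg-even : ∀ n → pow R (- 1#) (2 ℕ.* n) ≈ 1#
  pow-neg-even n = trans (sym (pow-* (- 1#) 2 n)) (trans (pow-cong n
    (solve 0 ((:- :1) :* ((:- :1) :* :1) := :1) refl)) (pow-1# n))

  pow-neg-odd : ∀ n → pow R (- 1#) (ℕ.suc (2 ℕ.* n)) ≈ - 1#
  pow-neg-odd n = trans (*-congˡ (pow-neg-even n)) (*-identityʳ _)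

  module Frobenius (p : ℕ) (prime : Prime p) (p≈0 : times R p 1# ≈ 0#) where
    private
      p∤k! : ∀ {k} → k ℕ.< p → ¬ (p ∣ k !)
      p∤k! {ℕ.zero} 0<p p∣1 = contradiction (∣1⇒≡1 p∣1) λ { ≡.refl → ¬prime[1] prime }
      p∤k! {ℕ.suc k} k<p p∣ with euclidsLemma (ℕ.suc k) (k !) prime p∣
      ... | inj₁ p∣k = ℕ.<⇒≱ k<p (∣⇒≤ p∣k)
      ... | inj₂ p∣k! = p∤k! (ℕ.<⇒≤ k<p) p∣k!

      -- p divides p! = (p C k) k! (p - k)!, but neither factorial, since both are products of
      -- numbers below p.
      p∣pCk : ∀ k → 0 ℕ.< k → k ℕ.< p → p ∣ p C k
      p∣pCk k 0<k k<p with euclidsLemma (p C k) (k ! ℕ.* (p ℕ.∸ k) !) prime p∣product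
        where
        instance _ = k ℕ.!* (p ℕ.∸ k) !≢0
        product : (p C k) ℕ.* (k ! ℕ.* (p ℕ.∸ k) !) ≡.≡ p !
        product = ≡.trans (≡.cong (ℕ._* (k ! ℕ.* (p ℕ.∸ k) !)) (nCk≡n!/k![n-k]! (ℕ.<⇒≤ k<p))) (m/n*n≡m (k![n∸k]!∣n! (ℕ.<⇒≤ k<p)))
        p∣p! : ∀ {n} → 0 ℕ.< n → n ∣ n !
        p∣p! {ℕ.suc n} _ = m∣m*n (n !)
        p∣product : p ∣ (p C k) ℕ.* (k ! ℕ.* (p ℕ.∸ k) !)
        p∣product = ≡.subst (p ∣_) (≡.sym product) (p∣p! (ℕ.≤-<-trans ℕ.z≤n k<p))
      ... | inj₁ r = r
      ... | inj₂ r with euclidsLemma (k !) ((p ℕ.∸ k) !) prime r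
      ... | inj₁ r = contradiction r (p∤k! k<p)
      ... | inj₂ r = contradiction r (p∤k! (ℕ.∸-monoʳ-< 0<k (ℕ.<⇒≤ k<p)))

      multiple≈0 : ∀ {n} z → p ∣ n → n Mult.× z ≈ 0#
      multiple≈0 z (divides q ≡.refl) = begin
        (q ℕ.* p) Mult.× z           ≈⟨ Mult.×-assocˡ z q p ⟨
        q Mult.× (p Mult.× z)        ≈⟨ Mult.×-congʳ q (trans (Mult.×-congʳ p (sym (*-identityˡ z))) (sym (Mult.×-assoc-* p 1# z))) ⟩
        q Mult.× (p Mult.× 1# * z)   ≈⟨ Mult.×-congʳ q (*-congʳ (trans (reflexive (≡.sym (times≡× p 1#))) p≈0)) ⟩
        q Mult.× (0# * z)            ≈⟨ Mult.×-congʳ q (zeroˡ z) ⟩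
        q Mult.× 0#                  ≈⟨ Sum.sum-replicate q ⟨
        Sum.sum (replicate q 0#)     ≈⟨ Sum.sum-replicate-zero q ⟩
        0#                           ∎

      -- Writing p as a successor exposes the first and last summands; all others carry a multiple
      -- of p.
      expansion : ∀ {n} x y → p ≡.≡ ℕ.suc n → Binomial.binomialExpansion x y (ℕ.suc n) ≈ x Exp.^ ℕ.suc n + y Exp.^ ℕ.suc n
      expansion {n} x y ≡.refl = begin
        t Fin.zero + Sum.sum (λ i → t (Fin.suc i))  ≈⟨ +-cong first (Sum.sum-init-last (λ i → t (Fin.suc i))) ⟩
        y Exp.^ p + (Sum.sum (λ i → t (Fin.suc (Fin.inject₁ i))) + t (Fin.suc (Fin.fromℕ n)))
          ≈⟨ +-congˡ (+-cong (trans (Sum.sum-cong-≋ middle) (Sum.sum-replicate-zero n)) last) ⟩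
        y Exp.^ p + (0# + x Exp.^ p)                ≈⟨ solve 2 (λ a b → a :+ (:0 :+ b) := b :+ a) refl _ _ ⟩
        x Exp.^ p + y Exp.^ p                       ∎
        where
        t : Fin (ℕ.suc p) → Carrier
        t = Binomial.binomialTerm x y p
        first : t Fin.zero ≈ y Exp.^ p
        first = trans (reflexive (≡.cong (Mult._× (1# * y Exp.^ p)) (≡.trans (nCk≡nC[n∸k] {k = 0} {p} ℕ.z≤n) (nCn≡1 p)))) (trans (+-identityʳ _) (*-identityˡ _))
        last : t (Fin.suc (Fin.fromℕ n)) ≈ x Exp.^ p
        last = begin
          (p C ℕ.suc (Fin.toℕ (Fin.fromℕ n))) Mult.× (x Exp.^ ℕ.suc (Fin.toℕ (Fin.fromℕ n)) * y Exp.^ (n ℕ.∸ Fin.toℕ (Fin.fromℕ n)))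
            ≡⟨ ≡.cong (λ k → (p C ℕ.suc k) Mult.× (x Exp.^ ℕ.suc k * y Exp.^ (n ℕ.∸ k))) (Fin.toℕ-fromℕ n) ⟩
          (p C p) Mult.× (x Exp.^ p * y Exp.^ (n ℕ.∸ n))
            ≡⟨ ≡.cong₂ (λ k l → k Mult.× (x Exp.^ p * y Exp.^ l)) (nCn≡1 p) (ℕ.n∸n≡0 n) ⟩
          1 Mult.× (x Exp.^ p * 1#)
            ≈⟨ trans (+-identityʳ _) (*-identityʳ _) ⟩
          x Exp.^ p ∎
        middle : ∀ i → t (Fin.suc (Fin.inject₁ i)) ≈ 0#
        middle i = multiple≈0 _ (p∣pCk _ ℕ.z<s (ℕ.s<s (≡.subst (ℕ._< n) (≡.sym (Fin.toℕ-inject₁ i)) (Fin.toℕ<n i))))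

    pow-p-+ : ∀ x y → pow R (x + y) p ≈ pow R x p + pow R y p
    pow-p-+ x y rewrite pow≡^ (x + y) p | pow≡^ x p | pow≡^ y p = go p ≡.refl
      where
      go : ∀ n → p ≡.≡ n → (x + y) Exp.^ p ≈ x Exp.^ p + y Exp.^ p
      go ℕ.zero ≡.refl = contradiction prime ¬prime[0]
      go (ℕ.suc n) ≡.refl = trans (Binomial.theorem p x y) (expansion x y ≡.refl)

    frobenius : ∀ j → IsEndo (λ x → pow R x (p ℕ.^ j))
    frobenius j = record
      { isAdd = record { cong = pow-cong (p ℕ.^ j) ; +-homo = additive j }
      ; *-homo = λ x y → pow-distrib x y (p ℕ.^ j)
      ; 1-homo = pow-1# (p ℕ.^ j) }
      where
      additive : ∀ j x y → pow R (x + y) (p ℕ.^ j) ≈ pow R x (p ℕ.^ j) + pow R y (p ℕ.^ j)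
      additive ℕ.zero x y = trans (*-identityʳ _) (sym (+-cong (*-identityʳ x) (*-identityʳ y)))
      additive (ℕ.suc j) x y = begin
        pow R (x + y) (p ℕ.* p ℕ.^ j)                             ≈⟨ pow-* (x + y) p (p ℕ.^ j) ⟨
        pow R (pow R (x + y) p) (p ℕ.^ j)                         ≈⟨ pow-cong (p ℕ.^ j) (pow-p-+ x y) ⟩
        pow R (pow R x p + pow R y p) (p ℕ.^ j)                   ≈⟨ additive j _ _ ⟩
        pow R (pow R x p) (p ℕ.^ j) + pow R (pow R y p) (p ℕ.^ j) ≈⟨ +-cong (pow-* x p (p ℕ.^ j)) (pow-* y p (p ℕ.^ j)) ⟩
        pow R x (p ℕ.* p ℕ.^ j) + pow R y (p ℕ.* p ℕ.^ j)         ∎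

    frobenius-∘ : ∀ x i j → pow R (pow R x (p ℕ.^ i)) (p ℕ.^ j) ≈ pow R x (p ℕ.^ (i ℕ.+ j))
    frobenius-∘ x i j = trans (pow-* x (p ℕ.^ i) (p ℕ.^ j)) (reflexive (≡.cong (pow R x) (≡.sym (ℕ.^-distribˡ-+-* p i j))))

-- Finite fields: sums and products over all elements, roots of polynomials

module FiniteField {c ℓ} (R : CommutativeRing c ℓ) where

  open CommutativeRing R hiding (zero)
  open RingTools R
  open Powers R
  open import Relation.Binary.Reasoning.Setoid setoid

  finInjective⇒surjective : ∀ {n} (f : Fin n → Fin n) → Injective ≡._≡_ ≡._≡_ f → ∀ y → ∃ λ x → f x ≡.≡ y
  finInjective⇒surjective {ℕ.suc n} f f-inj y with Fin.any? (λ x → f x Fin.≟ y)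
  ... | yes found = found
  ... | no missed = contradiction (Fin.injective⇒≤ {f = λ x → Fin.punchOut (y≢f x)} (λ e → f-inj (Fin.punchOut-injective (y≢f _) (y≢f _) e))) ℕ.1+n≰n
    where
    y≢f : ∀ x → ¬ (y ≡.≡ f x)
    y≢f x e = missed (x , ≡.sym e)

  -- a vector holds the lower coefficients of a monic polynomial, constant term first
  evaluate : ∀ {n} → Vec Carrier n → Carrier → Carrier
  evaluate [] x = 1#
  evaluate (a ∷ as) x = a + x * evaluate as x

  divide : ∀ {n} → Vec Carrier (ℕ.suc n) → Carrier → Vec Carrier n
  divide (a ∷ []) r = []
  divide (a ∷ b ∷ as) r = evaluate (b ∷ as) r ∷ divide (b ∷ as) r

  divide-correct : ∀ {n} (as : Vec Carrier (ℕ.suc n)) r x → evaluate as x - evaluate as r ≈ (x - r) * evaluate (divide as r) x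
  divide-correct (a ∷ []) r x = solve 3 (λ a r x → a :+ x :* :1 :- (a :+ r :* :1) := (x :- r) :* :1) refl a r x
  divide-correct (a ∷ b ∷ as) r x = comb₁ (divide-correct (b ∷ as) r x)
    (solve 6 (λ a r x p q d → a :+ x :* p :- (a :+ r :* q) :- (x :- r) :* (q :+ x :* d) := x :* (p :- q :- (x :- r) :* d))
      refl a r x (evaluate (b ∷ as) x) (evaluate (b ∷ as) r) (evaluate (divide (b ∷ as) r) x))

  monomial : ∀ n → Vec Carrier n
  monomial n = Vec.replicate n 0#

  evaluate-monomial : ∀ n x → evaluate (monomial n) x ≈ pow R x n
  evaluate-monomial ℕ.zero x = refl
  evaluate-monomial (ℕ.suc n) x = trans (+-identityˡ _) (*-congˡ (evaluate-monomial n x))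

  module Finite (N : ℕ) (isFinite : IsFiniteFieldOfOrder R N) where
    open Inverse (proj₂ isFinite) using (to; from; to-cong; strictlyInverseˡ; strictlyInverseʳ)

    isField = proj₁ isFinite

    to-injective : ∀ {x y} → to x ≡.≡ to y → x ≈ y
    to-injective {x} {y} e = trans (sym (strictlyInverseʳ x)) (trans (reflexive (≡.cong from e)) (strictlyInverseʳ y))

    from-injective : ∀ {i j} → from i ≈ from j → i ≡.≡ j
    from-injective {i} {j} e = ≡.trans (≡.sym (strictlyInverseˡ i)) (≡.trans (to-cong e) (strictlyInverseˡ j))

    _≟_ : Decidable _≈_
    x ≟ y with to x Fin.≟ to y
    ... | yes e = yes (to-injective e)
    ... | no n = no λ e → n (to-cong e)

    open Field isField _≟_

    injective⇒surjective : ∀ f → IsAdd f → (∀ x → f x ≈ 0# → x ≈ 0#) → ∀ y → ∃ λ x → f x ≈ y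
    injective⇒surjective f f-add kernel y = let i , e = preimage in from i , to-injective e
      where
      module f = IsAdd f-add
      preimage : ∃ λ i → to (f (from i)) ≡.≡ to y
      preimage = finInjective⇒surjective (λ i → to (f (from i)))
        (λ e → from-injective (-≈0⇒≈ (kernel _ (trans (f.sub-homo _ _) (≈⇒-≈0 (to-injective e)))))) (to y)

    all? : ∀ {p} {P : Carrier → Set p} → (∀ x → Dec (P x)) → (∀ {x y} → x ≈ y → P x → P y) → (∀ x → P x) ⊎ (∃ λ x → ¬ P x)
    all? P? resp with Fin.all? (λ i → P? (from i))
    ... | yes p = inj₁ λ x → resp (strictlyInverseʳ x) (p (to x))
    ... | no n = let i , ¬p = Fin.¬∀⟶∃¬ N _ (λ i → P? (from i)) n in inj₂ (from i , ¬p)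

    bijection : (f f⁻¹ : Carrier → Carrier) → (∀ {x y} → x ≈ y → f x ≈ f y) → (∀ {x y} → x ≈ y → f⁻¹ x ≈ f⁻¹ y) →
      (∀ x → f (f⁻¹ x) ≈ x) → (∀ x → f⁻¹ (f x) ≈ x) → Permutation N N
    bijection f f⁻¹ f-cong f⁻¹-cong ff⁻¹ f⁻¹f = permutation (λ i → to (f (from i))) (λ i → to (f⁻¹ (from i)))
      (λ i → ≡.trans (to-cong (trans (f-cong (strictlyInverseʳ _)) (ff⁻¹ _))) (strictlyInverseˡ i))
      (λ i → ≡.trans (to-cong (trans (f⁻¹-cong (strictlyInverseʳ _)) (f⁻¹f _))) (strictlyInverseˡ i))

    -- The sum S of all elements is unchanged by the translation x ↦ x + 1, yet each of the N
    -- summands grows by 1.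
    N≈0 : times R N 1# ≈ 0#
    N≈0 = trans (reflexive (times≡× N 1#)) (trans (sym (Sum.sum-replicate N)) (begin
      Sum.sum (replicate N 1#)                                      ≈⟨ solve 2 (λ a b → b := :- a :+ (a :+ b)) refl S _ ⟩
      - S + (S + Sum.sum (replicate N 1#))                          ≈⟨ +-congˡ (Sum.∑-distrib-+ from (replicate N 1#)) ⟨
      - S + Sum.sum (λ i → from i + 1#)                             ≈⟨ +-congˡ (Sum.sum-cong-≋ λ i → strictlyInverseʳ (from i + 1#)) ⟨
      - S + Sum.sum (λ i → from (to (from i + 1#)))                 ≈⟨ +-congˡ (Sum.sum-permute from shift) ⟨
      - S + S                                                       ≈⟨ -‿inverseˡ S ⟩
      0#                                                            ∎))
      where
      import Algebra.Properties.CommutativeMonoid.Sum +-commutativeMonoid as Sum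
      S : Carrier
      S = Sum.sum from
      shift : Permutation N N
      shift = bijection (_+ 1#) (_- 1#) +-congʳ +-congʳ
        (solve 1 (λ x → x :- :1 :+ :1 := x) refl) (solve 1 (λ x → x :+ :1 :- :1 := x) refl)

  module Fermat (N : ℕ) (isFinite : IsFiniteFieldOfOrder R N) where
    open Finite N isFinite
    open Inverse (proj₂ isFinite) using (to; from; to-cong; strictlyInverseˡ; strictlyInverseʳ)
    open Field isField _≟_
    private
      import Algebra.Properties.CommutativeMonoid.Sum *-commutativeMonoid as Product

      -- replacing 0 by 1 lets the product of the nonzero elements run over the whole field
      unit : Carrier → Carrier → Carrier
      unit a x with x ≟ 0#
      ... | yes _ = 1#
      ... | no _ = a

      unit-≈0 : ∀ a {x} → x ≈ 0# → unit a x ≈ 1#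
      unit-≈0 a {x} e with x ≟ 0#
      ... | yes _ = refl
      ... | no n = contradiction e n

      unit-≉0 : ∀ a {x} → ¬ (x ≈ 0#) → unit a x ≈ a
      unit-≉0 a {x} n with x ≟ 0#
      ... | yes e = contradiction e n
      ... | no _ = refl

      unit-cong : ∀ {x y} → x ≈ y → unit x x ≈ unit y y
      unit-cong {x} {y} e with x ≟ 0#
      ... | yes x≈0 = sym (unit-≈0 y (trans (sym e) x≈0))
      ... | no x≉0 = trans e (sym (unit-≉0 y (λ y≈0 → x≉0 (trans e y≈0))))

      unit-nonzero : ∀ x → ¬ (unit x x ≈ 0#)
      unit-nonzero x with x ≟ 0#
      ... | yes _ = 1≉0
      ... | no x≉0 = x≉0

      unit-* : ∀ {a} → ¬ (a ≈ 0#) → ∀ x → unit (a * x) (a * x) ≈ unit a x * unit x x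
      unit-* {a} a≉0 x with x ≟ 0#
      ... | yes x≈0 = trans (unit-≈0 (a * x) (trans (*-congˡ x≈0) (zeroʳ a))) (sym (*-identityˡ 1#))
      ... | no x≉0 = unit-≉0 (a * x) (*-≉0 a≉0 x≉0)

      product-≉0 : ∀ {n} (t : Fin n → Carrier) → (∀ i → ¬ (t i ≈ 0#)) → ¬ (Product.sum t ≈ 0#)
      product-≉0 {ℕ.zero} t n = 1≉0
      product-≉0 {ℕ.suc _} t n = *-≉0 (n Fin.zero) (product-≉0 (λ i → t (Fin.suc i)) (λ i → n (Fin.suc i)))

      P : Carrier
      P = Product.sum (λ i → unit (from i) (from i))

      -- Multiplication by `a` permutes the nonzero elements, so their product is multiplied by this
      -- factor without changing.
      product-units : ∀ {a} → ¬ (a ≈ 0#) → Product.sum (λ i → unit a (from i)) ≈ 1#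
      product-units {a} a≉0 = cancel (product-≉0 (λ i → unit (from i) (from i)) (λ i → unit-nonzero (from i))) (begin
        P * Product.sum (λ i → unit a (from i))                       ≈⟨ *-comm P _ ⟩
        Product.sum (λ i → unit a (from i)) * P                       ≈⟨ Product.∑-distrib-+ (λ i → unit a (from i)) (λ i → unit (from i) (from i)) ⟨
        Product.sum (λ i → unit a (from i) * unit (from i) (from i))  ≈⟨ Product.sum-cong-≋ (λ i → trans (unit-cong (strictlyInverseʳ (a * from i))) (unit-* a≉0 (from i))) ⟨
        Product.sum (λ i → unit (from (to (a * from i))) (from (to (a * from i)))) ≈⟨ Product.sum-permute (λ i → unit (from i) (from i)) scaling ⟨
        P                                                             ≈⟨ *-identityʳ P ⟨
        P * 1#                                                        ∎)
        where
        a⁻¹ : Carrier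
        a⁻¹ = inv a a≉0
        scaling : Permutation N N
        scaling = bijection (a *_) (a⁻¹ *_) *-congˡ *-congˡ
          (λ x → comb₁ (inv-r a a≉0) (solve 3 (λ a i x → a :* (i :* x) :- x := x :* (a :* i :- :1)) refl a a⁻¹ x))
          (λ x → comb₁ (inv-r a a≉0) (solve 3 (λ a i x → i :* (a :* x) :- x := x :* (a :* i :- :1)) refl a a⁻¹ x))

      product-remove : ∀ {n a} (e : Fin (ℕ.suc n) → Carrier) (i : Fin (ℕ.suc n)) → e i ≈ 0# →
        (∀ j → ¬ (e (Fin.punchIn i j) ≈ 0#)) → Product.sum (λ j → unit a (e j)) ≈ pow R a n
      product-remove {n} {a} e i e≈0 e≉0 = begin
        Product.sum (λ j → unit a (e j))                                  ≈⟨ Product.sum-remove {i = i} (λ j → unit a (e j)) ⟩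
        unit a (e i) * Product.sum (λ j → unit a (e (Fin.punchIn i j)))   ≈⟨ *-cong (unit-≈0 a e≈0) (Product.sum-cong-≋ (λ j → unit-≉0 a (e≉0 j))) ⟩
        1# * Product.sum (replicate n a)                                  ≈⟨ *-identityˡ _ ⟩
        Product.sum (replicate n a)                                       ≈⟨ Product.sum-replicate n ⟩
        a Exp.^ n                                                         ≡⟨ pow≡^ a n ⟨
        pow R a n                                                         ∎
        where import Algebra.Properties.Semiring.Exp semiring as Exp

    pow-order : ∀ {n} → N ≡.≡ ℕ.suc n → ∀ {a} → ¬ (a ≈ 0#) → pow R a n ≈ 1#
    pow-order ≡.refl a≉0 = trans (sym (product-remove from (to 0#) (strictlyInverseʳ 0#)
      (λ j e → Fin.punchInᵢ≢i (to 0#) j (≡.trans (≡.sym (strictlyInverseˡ _)) (to-cong e))))) (product-units a≉0)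

    -- Dividing by x - r₀ lowers the degree by one and keeps all other roots; the constant monic
    -- polynomial 1 has none.
    too-many-roots : ∀ {n} (as : Vec Carrier n) (r : Fin (ℕ.suc n) → Carrier) →
      (∀ {i j} → r i ≈ r j → i ≡.≡ j) → ¬ (∀ i → evaluate as (r i) ≈ 0#)
    too-many-roots [] r r-inj root = 1≉0 (root Fin.zero)
    too-many-roots (a ∷ as) r r-inj root = too-many-roots (divide (a ∷ as) (r Fin.zero)) (λ i → r (Fin.suc i))
      (λ e → Fin.suc-injective (r-inj e))
      λ i → cancel0 (-≉0 (λ e → contradiction (r-inj e) λ ()))
        (trans (sym (divide-correct (a ∷ as) (r Fin.zero) (r (Fin.suc i)))) (≈⇒-≈0 (trans (root (Fin.suc i)) (sym (root Fin.zero)))))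

    -- degree n + 2 < N, so x ↦ xⁿ⁺² - x cannot vanish everywhere
    pow-nontrivial : ∀ n → ℕ.suc (ℕ.suc n) ℕ.< N → ∃ λ x → ¬ (pow R x (ℕ.suc (ℕ.suc n)) ≈ x)
    pow-nontrivial n n<N with all? (λ x → pow R x (ℕ.suc (ℕ.suc n)) ≟ x) (λ e p → trans (pow-cong (ℕ.suc (ℕ.suc n)) (sym e)) (trans p e))
    ... | inj₂ found = found
    ... | inj₁ all = contradiction
      (λ i → trans (solve 2 (λ x p → :0 :+ x :* (:- :1 :+ x :* p) := x :* (x :* p) :- x) refl (r i) (evaluate (monomial n) (r i)))
        (≈⇒-≈0 (trans (*-congˡ (*-congˡ (evaluate-monomial n (r i)))) (all (r i)))))
      -- Constant term 0, linear coefficient - 1 and zeros above: the polynomial is xⁿ⁺² - x.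
      (too-many-roots (0# ∷ - 1# ∷ monomial n) r λ e → Fin.inject≤-injective n<N n<N _ _ (from-injective e))
      where
      r : Fin (ℕ.suc (ℕ.suc (ℕ.suc n))) → Carrier
      r i = from (Fin.inject≤ i n<N)

-- Arithmetic of the parameters: Euler's criterion, fixed fields, the element ι

module FrobeniusSetting where

  module N = +-*-Solver

  parity : ∀ n → ∃ λ j → n ≡.≡ 2 ℕ.* j ⊎ n ≡.≡ ℕ.suc (2 ℕ.* j)
  parity ℕ.zero = 0 , inj₁ ≡.refl
  parity (ℕ.suc n) with parity n
  ... | j , inj₁ e = j , inj₂ (≡.cong ℕ.suc e)
  ... | j , inj₂ e = ℕ.suc j , inj₁ (≡.trans (≡.cong (λ n → ℕ.suc n) e) (≡.cong ℕ.suc (≡.sym (ℕ.+-suc j (j ℕ.+ 0)))))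

  odd-^ : ∀ {n a} → n ≡.≡ ℕ.suc (2 ℕ.* a) → ∀ j → ∃ λ b → n ℕ.^ j ≡.≡ ℕ.suc (2 ℕ.* b)
  odd-^ e ℕ.zero = 0 , ≡.refl
  odd-^ {n} {a} e (ℕ.suc j) with odd-^ {n} {a} e j
  ... | b , f = a ℕ.+ b ℕ.+ 2 ℕ.* (a ℕ.* b) , ≡.trans (≡.cong₂ ℕ._*_ e f)
    (N.solve 2 (λ a b → (N.con 1 N.:+ N.con 2 N.:* a) N.:* (N.con 1 N.:+ N.con 2 N.:* b) N.:= N.con 1 N.:+ N.con 2 N.:* (a N.:+ b N.:+ N.con 2 N.:* (a N.:* b))) ≡.refl a b)

  geometric : ∀ a j → ∃ λ u → ℕ.suc a ℕ.^ j ≡.≡ ℕ.suc (a ℕ.* u)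
  geometric a ℕ.zero = 0 , ≡.cong ℕ.suc (≡.sym (ℕ.*-zeroʳ a))
  geometric a (ℕ.suc j) with geometric a j
  ... | u , e = ℕ.suc (u ℕ.+ a ℕ.* u) , ≡.trans (≡.cong (ℕ.suc a ℕ.*_) e)
    (N.solve 2 (λ a u → (N.con 1 N.:+ a) N.:* (N.con 1 N.:+ a N.:* u) N.:= N.con 1 N.:+ a N.:* (N.con 1 N.:+ (u N.:+ a N.:* u))) ≡.refl a u)

  module Euler {c ℓ} (R : CommutativeRing c ℓ) {N : ℕ} (isFinite : IsFiniteFieldOfOrder R N) where
    open CommutativeRing R
    open RingTools R
    open Powers R
    open FiniteField.Finite R N isFinite
    open FiniteField.Fermat R N isFinite
    open Field isField _≟_

    pow-2* : ∀ x n → pow R x (2 ℕ.* n) ≈ pow R x n * pow R x n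
    pow-2* x n = trans (pow-+ x n (n ℕ.+ 0)) (*-congˡ (reflexive (≡.cong (pow R x) (ℕ.+-identityʳ n))))

    pow-sign : ∀ {x} n → pow R x (2 ℕ.* n) ≈ 1# → pow R x n ≈ 1# ⊎ pow R x n ≈ - 1#
    pow-sign {x} n e = sign (trans (sym (pow-2* x n)) (trans e (sym (*-identityˡ 1#))))

    pow-≉0 : ∀ {x} → ¬ (x ≈ 0#) → ∀ n → ¬ (pow R x n ≈ 0#)
    pow-≉0 x≉0 ℕ.zero = 1≉0
    pow-≉0 x≉0 (ℕ.suc n) = *-≉0 x≉0 (pow-≉0 x≉0 n)

    -- Halving the exponent: if n = 2j then yʲ = ±1, and the sign is corrected by the square η².
    square-root : ∀ n → 0 ℕ.< n → ∀ η y → pow R η n ≈ - 1# → pow R y n ≈ 1# → IsSquare R y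
    square-root = <-rec _ step
      where
      -1≉0 : ¬ (- 1# ≈ 0#)
      -1≉0 e = 1≉0 (comb₁ e (solve 0 (:1 :- :0 := (:- :1) :* (:- :1 :- :0)) refl))
      step : ∀ n → (∀ {j} → j ℕ.< n → 0 ℕ.< j → ∀ η y → pow R η j ≈ - 1# → pow R y j ≈ 1# → IsSquare R y) →
        0 ℕ.< n → ∀ η y → pow R η n ≈ - 1# → pow R y n ≈ 1# → IsSquare R y
      step n rec 0<n η y ηⁿ yⁿ with parity n
      -- For n = 2 j + 1 the hypothesis gives y = y yⁿ, the square of y to the power j + 1.
      ... | j , inj₂ ≡.refl = pow R y (ℕ.suc j) , trans
            (solve 2 (λ y z → y :* z :* (y :* z) := y :* (y :* (z :* z))) refl y (pow R y j))
            (trans (*-congˡ (trans (*-congˡ (sym (pow-2* y j))) yⁿ)) (*-identityʳ y))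
      ... | ℕ.zero , inj₁ ≡.refl = contradiction 0<n ℕ.n≮0
      ... | j@(ℕ.suc _) , inj₁ ≡.refl = cases (pow-sign j yⁿ)
        where
        j<n : j ℕ.< 2 ℕ.* j
        j<n = ℕ.m<m+n j ℕ.z<s
        η≉0 : ¬ (η ≈ 0#)
        η≉0 e = -1≉0 (trans (sym ηⁿ) (trans (*-congʳ e) (zeroˡ _)))
        η²ʲ : pow R (η * η) j ≈ - 1#
        η²ʲ = trans (pow-distrib η η j) (trans (sym (pow-2* η j)) ηⁿ)
        cases : pow R y j ≈ 1# ⊎ pow R y j ≈ - 1# → IsSquare R y
        cases (inj₁ e) = rec j<n ℕ.z<s (η * η) y η²ʲ e
        cases (inj₂ e) with rec j<n ℕ.z<s (η * η) (y * (η * η)) η²ʲ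
          (trans (pow-distrib y (η * η) j) (trans (*-cong e η²ʲ) (solve 0 ((:- :1) :* (:- :1) := :1) refl)))
        ... | w , w²≈ = w * inv η η≉0 , comb₂ w²≈ (inv-r η η≉0)
          (solve 4 (λ w y h i → w :* i :* (w :* i) :- y :=
            (i :* i) :* (w :* w :- y :* (h :* h)) :+ (y :* (h :* i :+ :1)) :* (h :* i :- :1)) refl w y η (inv η η≉0))

    module _ {n : ℕ} (0<n : 0 ℕ.< n) (N≡ : N ≡.≡ ℕ.suc (2 ℕ.* n)) where

      pow-half : ∀ {x} → ¬ (x ≈ 0#) → pow R x n ≈ 1# ⊎ pow R x n ≈ - 1#
      pow-half x≉0 = pow-sign n (pow-order N≡ x≉0)

      private
        -- As n + 1 < N, some ζ has ζⁿ⁺¹ ≠ ζ; it is nonzero and ζⁿ is not 1, so it is - 1.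
        witness : ∀ j → n ≡.≡ ℕ.suc j → ∃ λ ζ → pow R ζ n ≈ - 1#
        witness j ≡.refl = from-moved (pow-nontrivial j (≡.subst (ℕ.suc n ℕ.<_) (≡.sym N≡) (ℕ.s<s (ℕ.m<m+n n ℕ.z<s))))
          where
          from-moved : (∃ λ ζ → ¬ (pow R ζ (ℕ.suc n) ≈ ζ)) → ∃ λ ζ → pow R ζ n ≈ - 1#
          from-moved (ζ , ζ-moved) with ζ ≟ 0#
          ... | yes ζ≈0 = contradiction (trans (*-congʳ ζ≈0) (trans (zeroˡ _) (sym ζ≈0))) ζ-moved
          ... | no ζ≉0 with pow-half ζ≉0
          ... | inj₁ e = contradiction (trans (*-congˡ e) (*-identityʳ ζ)) ζ-moved
          ... | inj₂ e = ζ , e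

      -- Euler's criterion, the direction that also requires an element with n-th power - 1 to
      -- correct signs while halving the exponent.
      nonsquare⇒-1 : ∀ {b} → ¬ IsSquare R b → pow R b n ≈ - 1#
      nonsquare⇒-1 {b} nonsquare with b ≟ 0#
      ... | yes b≈0 = contradiction (0# , trans (zeroˡ 0#) (sym b≈0)) nonsquare
      ... | no b≉0 with pow-half b≉0
      ... | inj₂ e = e
      ... | inj₁ e = let ζ , ζⁿ = witness (ℕ.pred n) (≡.sym (ℕ.suc-pred n {{ℕ.>-nonZero 0<n}})) in
        contradiction (square-root n 0<n ζ b ζⁿ e) nonsquare

  module Parameters {c ℓ} (R : CommutativeRing c ℓ) (p m h k e o : ℕ) (prime : Prime p) (p≢2 : ¬ (p ≡.≡ 2))
    (m≡2h : m ≡.≡ 2 ℕ.* h) (1≤h : 1 ℕ.≤ h) (1≤k : 1 ℕ.≤ k) (k<m : k ℕ.< m)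
    (e≡gcd : e ≡.≡ gcd k m) (m≡eo : m ≡.≡ e ℕ.* o) (o-odd : ¬ (2 ∣ o))
    (isFinite : IsFiniteFieldOfOrder R (p ℕ.^ m)) (A B : CommutativeRing.Carrier R)
    (B-nonsquare : ¬ IsSquare R B) (AB-fixed : InSubfield R (p ℕ.^ h) (CommutativeRing._*_ R A B))
    (AB≉0 : ¬ CommutativeRing._≈_ R (CommutativeRing._*_ R A B) (CommutativeRing.0# R))
    where
    open CommutativeRing R
    open RingTools R
    open Powers R
    open FiniteField.Finite R (p ℕ.^ m) isFinite
    open FiniteField.Fermat R (p ℕ.^ m) isFinite
    open Field isField _≟_
    open Euler R isFinite

    private
      instance
        p-nonTrivial : ℕ.NonTrivial p
        p-nonTrivial = prime⇒nonTrivial prime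
        p-nonZero : ℕ.NonZero p
        p-nonZero = ℕ.nonTrivial⇒nonZero p

      p-odd : ∃ λ a → p ≡.≡ ℕ.suc (2 ℕ.* a)
      p-odd with parity p
      ... | a , inj₂ eq = a , eq
      ... | a , inj₁ eq with prime⇒irreducible prime (divides a (≡.trans eq (ℕ.*-comm 2 a)))
      ... | inj₂ 2≡p = contradiction (≡.sym 2≡p) p≢2

      o-suc : ∃ λ j → o ≡.≡ ℕ.suc (2 ℕ.* j)
      o-suc with parity o
      ... | j , inj₂ eq = j , eq
      ... | j , inj₁ eq = contradiction (divides j (≡.trans eq (ℕ.*-comm 2 j))) o-odd

      e-even : ∃ λ d → e ≡.≡ 2 ℕ.* d
      e-even with euclidsLemma e o prime[2] (≡.subst (2 ∣_) (≡.trans (≡.sym m≡2h) m≡eo) (m∣m*n h))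
      ... | inj₁ (divides d eq) = d , ≡.trans eq (ℕ.*-comm d 2)
      ... | inj₂ 2∣o = contradiction 2∣o o-odd

      e∣k : e ∣ k
      e∣k = ≡.subst (_∣ k) (≡.sym e≡gcd) (gcd[m,n]∣m k m)

      Q-odd : ∃ λ a → p ℕ.^ h ≡.≡ ℕ.suc (2 ℕ.* a)
      Q-odd = odd-^ {a = proj₁ p-odd} (proj₂ p-odd) h
      a : ℕ
      a = proj₁ Q-odd
      -- With p^h = 1 + 2 a this is (p^m - 1) / 2, factored so that p^h - 1 = 2 a divides it
      -- visibly.
      n : ℕ
      n = 2 ℕ.* a ℕ.* ℕ.suc a

      N≡ : p ℕ.^ m ≡.≡ ℕ.suc (2 ℕ.* n)
      N≡ = ≡.trans (≡.cong (p ℕ.^_) (≡.trans m≡2h (≡.cong (h ℕ.+_) (ℕ.+-identityʳ h)))) (≡.trans (ℕ.^-distribˡ-+-* p h h)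
        (≡.trans (≡.cong₂ ℕ._*_ (proj₂ Q-odd) (proj₂ Q-odd))
        (N.solve 1 (λ a → (N.con 1 N.:+ N.con 2 N.:* a) N.:* (N.con 1 N.:+ N.con 2 N.:* a) N.:= N.con 1 N.:+ N.con 2 N.:* (N.con 2 N.:* a N.:* (N.con 1 N.:+ a))) ≡.refl a)))

      1<p^ : ∀ {j} → 1 ℕ.≤ j → 1 ℕ.< p ℕ.^ j
      1<p^ {j} 1≤j = ℕ.^-monoʳ-< p (ℕ.nonTrivial⇒n>1 p) {0} {j} 1≤j

      0<n : 0 ℕ.< n
      0<n = positive n N≡
        where
        positive : ∀ n → p ℕ.^ m ≡.≡ ℕ.suc (2 ℕ.* n) → 0 ℕ.< n
        positive (ℕ.suc n) _ = ℕ.z<s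
        positive ℕ.zero eq = contradiction (≡.subst (1 ℕ.<_) eq (1<p^ (ℕ.≤-trans 1≤k (ℕ.<⇒≤ k<m)))) (ℕ.<-irrefl ≡.refl)

      p≈0 : times R p 1# ≈ 0#
      p≈0 = root m N≈0
        where
        root : ∀ j → times R (p ℕ.^ j) 1# ≈ 0# → times R p 1# ≈ 0#
        root ℕ.zero eq = contradiction (trans (sym (+-identityʳ 1#)) eq) 1≉0
        root (ℕ.suc j) eq with *≈0 (trans (sym (times-* p (p ℕ.^ j))) eq)
        ... | inj₁ p≈0 = p≈0
        ... | inj₂ eq′ = root j eq′

      2≉0 : ¬ (1# + 1# ≈ 0#)
      2≉0 2≈0 = 1≉0 (trans (sym (trans (+-congˡ even≈0) (+-identityʳ 1#))) (trans (reflexive (≡.cong (λ n → times R n 1#) (≡.sym (proj₂ p-odd)))) p≈0))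
        where
        even≈0 : times R (2 ℕ.* proj₁ p-odd) 1# ≈ 0#
        even≈0 = trans (times-* 2 (proj₁ p-odd)) (trans (*-congʳ (trans (+-congˡ (+-identityʳ 1#)) 2≈0)) (zeroˡ _))

      fermat : ∀ x → pow R x (p ℕ.^ m) ≈ x
      fermat x = trans (reflexive (≡.cong (pow R x) N≡)) (go (x ≟ 0#))
        where
        go : Dec (x ≈ 0#) → pow R x (ℕ.suc (2 ℕ.* n)) ≈ x
        go (yes x≈0) = trans (*-congʳ x≈0) (trans (zeroˡ _) (sym x≈0))
        go (no x≉0) = trans (*-congˡ (pow-order N≡ x≉0)) (*-identityʳ x)

      open Frobenius p prime p≈0

      φ : ℕ → Carrier → Carrier
      φ j x = pow R x (p ℕ.^ j)

      φ-cong : ∀ j {x y} → x ≈ y → φ j x ≈ φ j y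
      φ-cong j = pow-cong (p ℕ.^ j)

      φ-∘ : ∀ i j x → φ j (φ i x) ≈ φ (i ℕ.+ j) x
      φ-∘ i j x = frobenius-∘ x i j

      φ-≡ : ∀ {i j} → i ≡.≡ j → ∀ x → φ i x ≈ φ j x
      φ-≡ eq x = reflexive (≡.cong (λ i → φ i x) eq)

      φ-fixed-* : ∀ i j {x} → φ i x ≈ x → φ (j ℕ.* i) x ≈ x
      φ-fixed-* i ℕ.zero fixed = *-identityʳ _
      φ-fixed-* i (ℕ.suc j) {x} fixed = trans (sym (φ-∘ i (j ℕ.* i) x)) (trans (φ-cong (j ℕ.* i) fixed) (φ-fixed-* i j fixed))

      -- Bézout over the naturals: the gcd plus a multiple of one exponent is a multiple of the
      -- other, and all these multiples fix x.
      φ-fixed-gcd : ∀ i j {x} → φ i x ≈ x → φ j x ≈ x → φ (gcd i j) x ≈ x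
      φ-fixed-gcd i j {x} fi fj with Bézout.identity (gcd-GCD i j)
      ... | Bézout.+- a b eq = trans (trans (φ-cong (gcd i j) (sym (φ-fixed-* j b fj))) (trans (φ-∘ (b ℕ.* j) (gcd i j) x)
              (φ-≡ (≡.trans (ℕ.+-comm (b ℕ.* j) (gcd i j)) eq) x))) (φ-fixed-* i a fi)
      ... | Bézout.-+ a b eq = trans (trans (φ-cong (gcd i j) (sym (φ-fixed-* i a fi))) (trans (φ-∘ (a ℕ.* i) (gcd i j) x)
              (φ-≡ (≡.trans (ℕ.+-comm (a ℕ.* i) (gcd i j)) eq) x))) (φ-fixed-* j b fj)

      -- φᵏ has odd order on the field, so its square has the same fixed points
      φ-fixed-half : ∀ i → (∃ λ l → i ≡.≡ l ℕ.* e) → ∀ {x} → φ (2 ℕ.* i) x ≈ x → φ i x ≈ x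
      φ-fixed-half i (l , i≡le) {x} fixed = trans (φ-cong i (sym (φ-fixed-* (2 ℕ.* i) (proj₁ o-suc) fixed)))
        (trans (φ-∘ (proj₁ o-suc ℕ.* (2 ℕ.* i)) i x) (trans (φ-≡ total x) (φ-fixed-* m l (fermat x))))
        where
        total : proj₁ o-suc ℕ.* (2 ℕ.* i) ℕ.+ i ≡.≡ l ℕ.* m
        total = ≡.trans (N.solve 2 (λ j i → j N.:* (N.con 2 N.:* i) N.:+ i N.:= i N.:* (N.con 1 N.:+ N.con 2 N.:* j)) ≡.refl (proj₁ o-suc) i)
          (≡.trans (≡.cong₂ ℕ._*_ i≡le (≡.sym (proj₂ o-suc))) (≡.trans (ℕ.*-assoc l e o) (≡.cong (l ℕ.*_) (≡.sym m≡eo))))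

      k≡ : ∃ λ l → k ≡.≡ l ℕ.* e
      k≡ with e∣k
      ... | divides l eq = l , eq

      φ⁴-fixed : ∀ x → φ k (φ k (φ k (φ k x))) ≈ x → φ k x ≈ x
      φ⁴-fixed x fixed = φ-fixed-half k k≡ (φ-fixed-half (2 ℕ.* k) (2 ℕ.* proj₁ k≡ , ≡.trans (≡.cong (2 ℕ.*_) (proj₂ k≡)) (≡.sym (ℕ.*-assoc 2 (proj₁ k≡) e)))
        (trans (sym four) fixed))
        where
        four : φ k (φ k (φ k (φ k x))) ≈ φ (2 ℕ.* (2 ℕ.* k)) x
        four = trans (φ-cong k (trans (φ-cong k (φ-∘ k k x)) (φ-∘ (k ℕ.+ k) k x))) (trans (φ-∘ (k ℕ.+ k ℕ.+ k) k x)
          (φ-≡ (N.solve 1 (λ k → k N.:+ k N.:+ k N.:+ k N.:= N.con 2 N.:* (N.con 2 N.:* k)) ≡.refl k) x))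

      φ-surjective : ∀ y → ∃ λ x → φ k x ≈ y
      φ-surjective y = φ (m ℕ.∸ k) y , trans (φ-∘ (m ℕ.∸ k) k y) (trans (φ-≡ (ℕ.m∸n+n≡m (ℕ.<⇒≤ k<m)) y) (fermat y))

      φhφh : ∀ x → φ h (φ h x) ≈ x
      φhφh x = trans (φ-∘ h h x) (trans (φ-≡ (≡.sym (≡.trans m≡2h (≡.cong (h ℕ.+_) (ℕ.+-identityʳ h)))) x) (fermat x))

      p^k≈0 : times R (p ℕ.^ k) 1# ≈ 0#
      p^k≈0 = go k 1≤k
        where
        go : ∀ k → 1 ℕ.≤ k → times R (p ℕ.^ k) 1# ≈ 0#
        go (ℕ.suc j) _ = trans (times-* p (p ℕ.^ j)) (trans (*-congʳ p≈0) (zeroˡ _))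

      moved : ∃ λ g → ¬ (φ k g ≈ g)
      moved = go (p ℕ.^ k) (1<p^ 1≤k) (ℕ.^-monoʳ-< p (ℕ.nonTrivial⇒n>1 p) k<m)
        where
        go : ∀ q → 1 ℕ.< q → q ℕ.< p ℕ.^ m → ∃ λ g → ¬ (pow R g q ≈ g)
        go (ℕ.suc (ℕ.suc j)) _ q<N = pow-nontrivial j q<N
        go ℕ.zero ()
        go (ℕ.suc ℕ.zero) 1<1 = contradiction 1<1 (ℕ.<-irrefl ≡.refl)

      B≉0 : ¬ (B ≈ 0#)
      B≉0 B≈0 = B-nonsquare (0# , trans (zeroˡ 0#) (sym B≈0))

      A≉0 : ¬ (A ≈ 0#)
      A≉0 A≈0 = AB≉0 (trans (*-congʳ A≈0) (zeroˡ B))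

      -1≉1 : ¬ (- 1# ≈ 1#)
      -1≉1 eq = 2≉0 (comb₁ eq (solve 0 (:1 :+ :1 :- :0 := (:- :1) :* (:- :1 :- :1)) refl))

      Bⁿ : pow R B n ≈ - 1#
      Bⁿ = nonsquare⇒-1 0<n N≡ B-nonsquare

      ABᵃ : pow R (A * B) (2 ℕ.* a) ≈ 1#
      ABᵃ = cancel AB≉0 (trans (trans (reflexive (≡.cong (pow R (A * B)) (≡.sym (proj₂ Q-odd)))) AB-fixed) (sym (*-identityʳ _)))

      -- A B lies in the subfield of order p^h and p^h - 1 divides n, so (A B)ⁿ = 1; as Bⁿ = - 1,
      -- also Aⁿ = - 1. Thus A is a non-square along with B.
      Aⁿ : pow R A n ≈ - 1#
      Aⁿ = comb₂ (trans (sym (pow-distrib A B n)) (trans (sym (pow-* (A * B) (2 ℕ.* a) (ℕ.suc a))) (trans (pow-cong (ℕ.suc a) ABᵃ) (pow-1# (ℕ.suc a))))) Bⁿ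
        (solve 2 (λ x y → x :- (:- :1) := (:- :1) :* (x :* y :- :1) :+ x :* (y :- (:- :1))) refl (pow R A n) (pow R B n))

      φ-fixes-signs : ∀ j {x} → x ≈ 1# ⊎ x ≈ - 1# → φ j x ≈ x
      φ-fixes-signs j (inj₁ s) = trans (φ-cong j s) (trans (pow-1# (p ℕ.^ j)) (sym s))
      φ-fixes-signs j (inj₂ s) = trans (φ-cong j s) (trans (trans (reflexive (≡.cong (pow R (- 1#)) (proj₂ odd))) (pow-neg-odd (proj₁ odd))) (sym s))
        where
        odd : ∃ λ b → p ℕ.^ j ≡.≡ ℕ.suc (2 ℕ.* b)
        odd = odd-^ {a = proj₁ p-odd} (proj₂ p-odd) j

      -- Raise A H z = z to the power n: zⁿ is a sign for z ≠ 0 and so is fixed by H, and cancelling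
      -- it would leave Aⁿ = 1.
      A-free : ∀ z → A * φ (k ℕ.+ h) z ≈ z → z ≈ 0#
      A-free z eq with z ≟ 0#
      ... | yes z≈0 = z≈0
      ... | no z≉0 = contradiction (cancel (pow-≉0 z≉0 n) (trans (*-comm _ _) (trans (*-cong (sym Aⁿ) (sym stable))
              (trans (sym (pow-distrib A (φ (k ℕ.+ h) z) n)) (trans (pow-cong n eq) (sym (*-identityʳ _))))))) -1≉1
        where
        stable : pow R (φ (k ℕ.+ h) z) n ≈ pow R z n
        stable = trans (pow-swap z (p ℕ.^ (k ℕ.+ h)) n) (φ-fixes-signs (k ℕ.+ h) (pow-half 0<n N≡ z≉0))

      module φk = IsEndo (frobenius k)

      -- with N = A A^Q, the forbidden equation says (A B)^q = N^q A B; raising it to the power (Q - 1) / 2,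
      -- where (A B)^((Q - 1) / 2) = ± 1, gives N^((Q - 1) / 2) = 1, whereas this is A^((p^m - 1) / 2) = - 1
      AB-free : ¬ (φ k B ≈ φ (k ℕ.+ h) A * (A * B))
      AB-free eq = -1≉1 (trans (sym Aⁿ) (trans (sym (trans norm exponent)) (endo-injective (frobenius k) (trans norm-fixed (sym φk.1-homo)))))
        where
        s : Carrier
        s = pow R (A * B) a
        s-fixed : φ k s ≈ s
        s-fixed = φ-fixes-signs k (pow-sign a ABᵃ)
        norm : pow R (A * φ h A) a ≈ pow R A (ℕ.suc (p ℕ.^ h) ℕ.* a)
        norm = pow-* A (ℕ.suc (p ℕ.^ h)) a
        exponent : pow R A (ℕ.suc (p ℕ.^ h) ℕ.* a) ≈ pow R A n
        exponent = reflexive (≡.cong (pow R A) (≡.trans (≡.cong (λ q → ℕ.suc q ℕ.* a) (proj₂ Q-odd))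
          (N.solve 1 (λ a → (N.con 2 N.:+ N.con 2 N.:* a) N.:* a N.:= N.con 2 N.:* a N.:* (N.con 1 N.:+ a)) ≡.refl a)))
        conjugate : φ k (A * B) ≈ φ k (A * φ h A) * (A * B)
        conjugate = comb₄ (φk.*-homo A B) (φk.*-homo A (φ h A)) eq (trans (pow-swap A (p ℕ.^ h) (p ℕ.^ k)) (φ-∘ k h A))
          (solve 8 (λ A B FA FB FAB f HA FGA → FAB :- f :* (A :* B) :=
            :1 :* (FAB :- FA :* FB) :+ (:- (A :* B)) :* (f :- FA :* FGA) :+ FA :* (FB :- HA :* (A :* B)) :+ (:- (FA :* (A :* B))) :* (FGA :- HA))
            refl A B (φ k A) (φ k B) (φ k (A * B)) (φ k (A * φ h A)) (φ (k ℕ.+ h) A) (φ k (φ h A)))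
        norm-fixed : φ k (pow R (A * φ h A) a) ≈ 1#
        norm-fixed = cancel (pow-≉0 AB≉0 a) (trans (*-comm _ _) (trans (*-congʳ (pow-swap (A * φ h A) a (p ℕ.^ k)))
          (trans (sym (pow-distrib (φ k (A * φ h A)) (A * B) a)) (trans (pow-cong a (sym conjugate))
          (trans (pow-swap (A * B) (p ℕ.^ k) a) (trans s-fixed (sym (*-identityʳ s))))))))

      -- Here d is e / 2. With p^d = 1 + 2 b one has w = p^e - 1, and w u = p^m - 1.
      d : ℕ
      d = proj₁ e-even
      P-odd : ∃ λ b → p ℕ.^ d ≡.≡ ℕ.suc (2 ℕ.* b)
      P-odd = odd-^ {a = proj₁ p-odd} (proj₂ p-odd) d
      b : ℕ
      b = proj₁ P-odd
      w : ℕ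
      w = 2 ℕ.* (b ℕ.* (2 ℕ.* ℕ.suc b))
      powers : ∃ λ u → ℕ.suc w ℕ.^ o ≡.≡ ℕ.suc (w ℕ.* u)
      powers = geometric w o
      u : ℕ
      u = proj₁ powers

      p^e≡ : p ℕ.^ e ≡.≡ ℕ.suc w
      p^e≡ = ≡.trans (≡.cong (p ℕ.^_) (≡.trans (proj₂ e-even) (≡.cong (d ℕ.+_) (ℕ.+-identityʳ d)))) (≡.trans (ℕ.^-distribˡ-+-* p d d)
        (≡.trans (≡.cong₂ ℕ._*_ (proj₂ P-odd) (proj₂ P-odd))
        (N.solve 1 (λ b → (N.con 1 N.:+ N.con 2 N.:* b) N.:* (N.con 1 N.:+ N.con 2 N.:* b) N.:= N.con 1 N.:+ N.con 2 N.:* (b N.:* (N.con 2 N.:* (N.con 1 N.:+ b)))) ≡.refl b)))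

      n≡ : n ≡.≡ ℕ.suc b ℕ.* u ℕ.* (2 ℕ.* b)
      n≡ = ℕ.*-cancelˡ-≡ _ _ 2 (≡.trans (ℕ.suc-injective (≡.trans (≡.sym N≡) (≡.trans (≡.cong (p ℕ.^_) m≡eo)
        (≡.trans (≡.sym (ℕ.^-*-assoc p e o)) (≡.trans (≡.cong (ℕ._^ o) p^e≡) (proj₂ powers))))))
        (N.solve 2 (λ b u → N.con 2 N.:* (b N.:* (N.con 2 N.:* (N.con 1 N.:+ b))) N.:* u N.:= N.con 2 N.:* ((N.con 1 N.:+ b) N.:* u N.:* (N.con 2 N.:* b))) ≡.refl b u))

      -- the exponent t satisfies t (p^d - 1) = (p^m - 1) / 2, and B to the power (p^m - 1) / 2 is - 1
      ι : Carrier
      ι = pow R B (ℕ.suc b ℕ.* u)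

      φd-ι : φ d ι ≈ - ι
      φd-ι = trans (reflexive (≡.cong (pow R ι) (proj₂ P-odd))) (trans (*-congˡ (trans (pow-* B (ℕ.suc b ℕ.* u) (2 ℕ.* b))
        (trans (reflexive (≡.cong (pow R B) (≡.sym n≡))) Bⁿ))) (solve 1 (λ i → i :* (:- :1) := :- i) refl ι))

      φe-ι : φ e ι ≈ ι
      φe-ι = trans (φ-≡ (≡.trans (proj₂ e-even) (≡.cong (d ℕ.+_) (ℕ.+-identityʳ d))) ι) (trans (sym (φ-∘ d d ι))
        (trans (φ-cong d φd-ι) (trans (φd.neg-homo ι) (trans (-‿cong φd-ι) (solve 1 (λ i → :- (:- i) := i) refl ι)))))
        where module φd = IsEndo (frobenius d)

      -- For o = 1 + 2 j, h = m / 2 = d o = j e + d. So on elements fixed by the e-th Frobenius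
      -- power, the h-th acts as the d-th.
      h≡ : h ≡.≡ proj₁ o-suc ℕ.* e ℕ.+ d
      h≡ = ℕ.*-cancelˡ-≡ h _ 2 (≡.trans (≡.sym m≡2h) (≡.trans m≡eo (≡.trans (≡.cong (e ℕ.*_) (proj₂ o-suc))
        (≡.trans (N.solve 2 (λ e j → e N.:* (N.con 1 N.:+ N.con 2 N.:* j) N.:= e N.:+ N.con 2 N.:* (j N.:* e)) ≡.refl e (proj₁ o-suc))
        (≡.trans (≡.cong (ℕ._+ 2 ℕ.* (proj₁ o-suc ℕ.* e)) (proj₂ e-even))
          (N.solve 2 (λ d x → N.con 2 N.:* d N.:+ N.con 2 N.:* x N.:= N.con 2 N.:* (x N.:+ d)) ≡.refl d (proj₁ o-suc ℕ.* e)))))))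

      φh-ι : φ h ι ≈ - ι
      φh-ι = trans (φ-≡ h≡ ι) (trans (sym (φ-∘ (proj₁ o-suc ℕ.* e) d ι)) (trans (φ-cong d (φ-fixed-* e (proj₁ o-suc) φe-ι)) φd-ι))

    setting : Presemifield.Setting R
    setting = record
      { isField = isField ; _≟_ = _≟_ ; 2≉0 = 2≉0
      ; F = φ k ; G = φ h ; H = φ (k ℕ.+ h) ; F-endo = frobenius k ; G-endo = frobenius h
      ; H≈GF = λ x → sym (φ-∘ k h x)
      ; FG≈GF = λ x → pow-swap x (p ℕ.^ h) (p ℕ.^ k)
      ; GG≈id = φhφh ; F⁴-fixed = φ⁴-fixed ; F-surjective = φ-surjective
      ; injective⇒surjective = injective⇒surjective
      ; q = p ℕ.^ k ; Q = p ℕ.^ h ; F-pow = λ _ → refl ; G-pow = λ _ → refl ; q≈0 = p^k≈0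
      ; g = proj₁ moved ; g-moved = proj₂ moved
      ; ι = ι ; ι≉0 = pow-≉0 B≉0 (ℕ.suc b ℕ.* u) ; Fι≈ι = trans (φ-≡ (proj₂ k≡) ι) (φ-fixed-* e (proj₁ k≡) φe-ι) ; Gι≈-ι = φh-ι
      ; A = A ; B = B ; A≉0 = A≉0 ; B≉0 = B≉0 ; A-free = A-free ; AB-free = AB-free
      }

    -- The whole field is fixed by the m-th Frobenius power, so being fixed by the i-th amounts to
    -- being fixed by the power gcd(i, m).
    fixed⇒InSubfield : ∀ i {x} → pow R x (p ℕ.^ i) ≈ x → InSubfield R (p ℕ.^ gcd i m) x
    fixed⇒InSubfield i {x} fixed = φ-fixed-gcd i m fixed (fermat x)

    InSubfield⇒fixed : ∀ i {x} → InSubfield R (p ℕ.^ gcd i m) x → pow R x (p ℕ.^ i) ≈ x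
    InSubfield⇒fixed i {x} fixed with gcd[m,n]∣m i m
    ... | divides l eq = trans (φ-≡ eq x) (φ-fixed-* (gcd i m) l fixed)

-- From conjugation of scalars to a field automorphism

module Semilinearity {c ℓ} (R : CommutativeRing c ℓ) where

  open CommutativeRing R

  _•_ : Carrier → Pair R → Pair R
  s • (x , y) = s * x , s * y

  Conjugates : (Carrier → Set ℓ) → (Pair R → Pair R) → Set (c ⊔ ℓ)
  Conjugates K Z = ∀ s → K s → ∃ λ ρ → K ρ × ∀ z → _≈²_ R (Z (s • z)) (ρ • Z z)

  private
    infix 4 _≋_
    _≋_ = _≈²_ R
    ≋-refl : ∀ {z} → z ≋ z
    ≋-refl = refl , refl
    ≋-sym : ∀ {z w} → z ≋ w → w ≋ z
    ≋-sym (p , q) = sym p , sym q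
    ≋-trans : ∀ {z w v} → z ≋ w → w ≋ v → z ≋ v
    ≋-trans (p , q) (r , s) = trans p r , trans q s
    •-cong : ∀ {s t z w} → s ≈ t → z ≋ w → s • z ≋ t • w
    •-cong e (p , q) = *-cong e p , *-cong e q

  inverse-additive : ∀ {Z Z′} → Congruent R Z → Additive R Z → IsInverseOf R Z′ Z → Additive R Z′
  inverse-additive {Z} {Z′} Z-cong Z-add (Z′-cong , ZZ′ , Z′Z) x y x′ y′ =
    ≋-trans (Z′-cong _ _ (≋-sym (≋-trans (Z-add (proj₁ a) (proj₂ a) (proj₁ b) (proj₂ b))
      (+-cong (proj₁ (ZZ′ (x , y))) (proj₁ (ZZ′ (x′ , y′))) , +-cong (proj₂ (ZZ′ (x , y))) (proj₂ (ZZ′ (x′ , y′)))))))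
    (Z′Z (proj₁ a + proj₁ b , proj₂ a + proj₂ b))
    where
    a b : Pair R
    a = Z′ (x , y)
    b = Z′ (x′ , y′)

  -- Bijectivity of Z makes the companion map of scalars multiplicative, additive and injective. Its
  -- surjectivity on K is the conjugation property of the inverse map.
  conjugates⇒semilinear : ∀ {K Z Z′} → (∀ {x y} → x ≈ y → K x → K y) → Congruent R Z → Additive R Z → IsInverseOf R Z′ Z →
    Conjugates K Z → Conjugates K Z′ → SemilinearOver R K Z
  conjugates⇒semilinear {K} {Z} {Z′} K-resp Z-cong Z-add (Z′-cong , ZZ′ , Z′Z) conj conj′ = Z-add , σ ,
    ( (λ x y _ _ e → proj₁ (Z-cong (x • e₀) (y • e₀) (•-cong e (≋-refl {e₀}))))
    , (λ x Kx → K-resp (sym (σ≈ρ x Kx)) (proj₁ (proj₂ (conj x Kx))))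
    , (λ x y _ _ → proj₁ (≋-trans (Z-cong ((x + y) • e₀) (x * proj₁ e₀ + y * proj₁ e₀ , x * proj₂ e₀ + y * proj₂ e₀)
        (distribʳ (proj₁ e₀) x y , distribʳ (proj₂ e₀) x y)) (Z-add (x * proj₁ e₀) (x * proj₂ e₀) (y * proj₁ e₀) (y * proj₂ e₀))))
    , (λ x y Kx _ → proj₁ (≋-trans (Z-cong ((x * y) • e₀) (x • (y • e₀)) (*-assoc x y _ , *-assoc x y _)) (σ-linear x Kx (y • e₀))))
    , trans (proj₁ (Z-cong (1# • e₀) e₀ (*-identityˡ _ , *-identityˡ _))) (proj₁ (ZZ′ (1# , 0#)))
    , (λ x y Kx Ky e → •-injective λ z → ≋-trans (≋-sym (Z′Z (x • z))) (≋-trans (Z′-cong (Z (x • z)) (Z (y • z))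
        (≋-trans (σ-linear x Kx z) (≋-trans (•-cong e (≋-refl {Z z})) (≋-sym (σ-linear y Ky z))))) (Z′Z (y • z))))
    , (λ y Ky → proj₁ (conj′ y Ky) , proj₁ (proj₂ (conj′ y Ky)) ,
        trans (proj₁ (≋-trans (Z-cong (proj₁ (conj′ y Ky) • e₀) (Z′ (y • (1# , 0#))) (≋-sym (proj₂ (proj₂ (conj′ y Ky)) (1# , 0#)))) (ZZ′ (y • (1# , 0#)))))
          (*-identityʳ y))
    ) , λ s x y Ks → σ-linear s Ks (x , y)
    where
    e₀ : Pair R
    e₀ = Z′ (1# , 0#)
    σ : Carrier → Carrier
    -- The conjugated scalar ρ depends on a proof of K s, whereas σ must be defined on the whole
    -- field. As Z e₀ = (1, 0), the first coordinate of Z (s e₀) extends ρ without such a proof.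
    σ s = proj₁ (Z (s • e₀))
    σ≈ρ : ∀ s Ks → σ s ≈ proj₁ (conj s Ks)
    σ≈ρ s Ks = trans (proj₁ (proj₂ (proj₂ (conj s Ks)) e₀)) (trans (*-congˡ (proj₁ (ZZ′ (1# , 0#)))) (*-identityʳ _))
    σ-linear : ∀ s → K s → ∀ z → Z (s • z) ≋ σ s • Z z
    σ-linear s Ks z = ≋-trans (proj₂ (proj₂ (conj s Ks)) z) (•-cong (sym (σ≈ρ s Ks)) (≋-refl {Z z}))
    •-injective : ∀ {s t} → (∀ z → s • z ≋ t • z) → s ≈ t
    •-injective {s} {t} e = trans (sym (*-identityʳ s)) (trans (proj₁ (e (1# , 0#))) (*-identityʳ t))

-- Semilinearity of X and Y

open import Data.Nat using (ℕ; _+_; _*_; _^_; _≤_; _<_)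
open import Relation.Binary.PropositionalEquality using (_≡_; _≢_)

theorem2p4 : ∀ {c ℓ} (M : CommutativeRing c ℓ) (p m h k e o d : ℕ) →
    Prime p → p ≢ 2 →
    m ≡ 2 * h → 1 ≤ h →
    1 ≤ k → k < m →
    e ≡ gcd k m → m ≡ e * o → ¬ (2 ∣ o) →
    d ≡ gcd (k + h) m →
    IsFiniteFieldOfOrder M (p ^ m) →
    (A B : CommutativeRing.Carrier M) →
    ¬ IsSquare M B →
    InSubfield M (p ^ h) (CommutativeRing._*_ M A B) →
    ¬ (CommutativeRing._≈_ M (CommutativeRing._*_ M A B) (CommutativeRing.0# M)) →
    (X X' Y Y' : Pair M → Pair M) →
    FpLinear M X → IsInverseOf M X' X →
    FpLinear M Y → IsInverseOf M Y' Y →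
    (∀ u v → ∃ λ u' → ∃ λ v' → ∀ z →
    _≈²_ M (X (Rmap M A B (p ^ k) (p ^ (k + h)) u v (Y' z))) (Rmap M A B (p ^ k) (p ^ (k + h)) u' v' z)) →
    (∀ u' v' → ∃ λ u → ∃ λ v → ∀ z →
    _≈²_ M (X (Rmap M A B (p ^ k) (p ^ (k + h)) u v (Y' z))) (Rmap M A B (p ^ k) (p ^ (k + h)) u' v' z)) →
    SemilinearOver M (InSubfield M (p ^ e)) Y × SemilinearOver M (InSubfield M (p ^ d)) X
theorem2p4 {c} {ℓ} M p m h k e o d p-prime p≢2 m≡2h 1≤h 1≤k k<m e≡ m≡eo o-odd d≡ fin A B B-nonsquare AB-fixed AB≉0
  X X′ Y Y′ (X-cong , X-add , _) X-inv@(X′-cong , XX′ , X′X) (Y-cong , Y-add , _) Y-inv@(Y′-cong , YY′ , Y′Y) onto from =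
  conjugates⇒semilinear (resp {p ^ e}) Y-cong Y-add Y-inv
    (transport k e≡ (Conjugation.conj-F autotopism)) (transport k e≡ (Conjugation.conj-F (inverse autotopism))) ,
  conjugates⇒semilinear (resp {p ^ d}) X-cong X-add X-inv
    (transport (k + h) d≡ (Conjugation.conj-X autotopism)) (transport (k + h) d≡ (Conjugation.conj-X (inverse autotopism)))
  where
  open CommutativeRing M using (_≈_)
  open Semilinearity M
  open FrobeniusSetting.Parameters M p m h k e o p-prime p≢2 m≡2h 1≤h 1≤k k<m e≡ m≡eo o-odd fin A B B-nonsquare AB-fixed AB≉0
  open Autotopisms M setting using (Autotopism; inverse; module Conjugation)

  autotopism : Autotopism X Y X′ Y′
  autotopism = record
    { X-add = record { cong = X-cong _ _ ; +-homo = λ z w → X-add _ _ _ _ }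
    ; Y-add = record { cong = Y-cong _ _ ; +-homo = λ z w → Y-add _ _ _ _ }
    ; X′-add = record { cong = X′-cong _ _ ; +-homo = λ z w → inverse-additive X-cong X-add X-inv _ _ _ _ }
    ; Y′-add = record { cong = Y′-cong _ _ ; +-homo = λ z w → inverse-additive Y-cong Y-add Y-inv _ _ _ _ }
    ; XX′ = XX′ ; X′X = X′X ; YY′ = YY′ ; Y′Y = Y′Y
    -- `Rmap` at u, v unfolds to right multiplication by (u, v), so the two inclusions of spread
    -- sets carry over after pairing the parameters.
    ; onto = λ w → let u′ , v′ , e = onto (proj₁ w) (proj₂ w) in (u′ , v′) , e
    ; from = λ w → let u , v , e = from (proj₁ w) (proj₂ w) in (u , v) , e }

  resp : ∀ {j x y} → x ≈ y → InSubfield M j x → InSubfield M j y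
  resp {j} x≈y x-fixed = CommutativeRing.trans M (Powers.pow-cong M j (CommutativeRing.sym M x≈y)) (CommutativeRing.trans M x-fixed x≈y)

  transport : ∀ i {g Z} → g ≡ gcd i m → Conjugates (λ x → pow M x (p ^ i) ≈ x) Z → Conjugates (InSubfield M (p ^ g)) Z
  transport i ≡.refl conj s s-fixed =
    let ρ , ρ-fixed , Z-s = conj s (InSubfield⇒fixed i s-fixed)
    in ρ , fixed⇒InSubfield i ρ-fixed , Z-s
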